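{- Let $\Gamma=(X,\mathcal E)$ be the Petersen graph (the distance-regular graph with $10$ vertices and intersection array $\{3,2;1,1\}$); the spectrum of its adjacency matrix $A$ is $3^11^5(-2)^4$. Let $x\in X$ and $T=T(x)$. Order the three vertices of $\Gamma_1(x)$ arbitrarily, and order $\Gamma_2(x)$ as $y_1,\dots,y_6$ so that each of the pairs $\{y_1,y_2\},\{y_3,y_4\},\{y_5,y_6\}$ has a common neighbor in $\Gamma_1(x)$, and the subgraph induced on $\Gamma_2(x)$ is the 6-cycle $y_1,y_3,y_5,y_2,y_4,y_6$ (in this cyclic order). Then the standard module $V=\mathbb C^X$ is an orthogonal direct sum of irreducible $T$-modules $V=W_0\oplus W_{1,a}\oplus W_{1,b}\oplus W_{2,a}\oplus W_{2,b}\oplus W_{2,c}$, where two summands are isomorphic if and only if they have the same type in the following list, and the data are as listed. Each listed basis is a pure basis of the module. For each summand other than $W_0$, the seed vector $\nu$ spans $E_r^*W$ (so $\dim E_r^*W=1$), where $r$ is the endpoint of the summand $W$, and is given by its essential part. Type I ($W_0$): endpoint 0, multiplicity 1, dimension 3, diameter 2, shape $(1,1,1)$; basis $e_0^*,e_1^*,e_2^*$; matrix representing $A$: $\begin{pmatrix}0&3&0\\1&0&2\\0&1&2\end{pmatrix}$, with eigenvalues $3,1,-2$. Type II ($W_{1,a},W_{1,b}$): endpoint 1, multiplicity 2, dimension 2, diameter 1, shape $(1,1)$; basis $\nu,A\nu$ (with $A\nu=E_2^*A\nu$), where $\nu=[1,-1,0]$ for $W_{1,a}$ and $\nu=[1,1,-2]$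 for $W_{1,b}$; matrix representing $A$: $\begin{pmatrix}0&2\\1&-1\end{pmatrix}$, with eigenvalues $1,-2$. Type III ($W_{2,a},W_{2,b}$): endpoint 2, multiplicity 2, dimension 1, diameter 0, shape $(1)$; basis $\nu$, where $\nu=[1,-1,1,-1,0,0]$ for $W_{2,a}$ and $\nu=[1,-1,-1,1,-2,2]$ for $W_{2,b}$; matrix representing $A$: $\begin{pmatrix}1\end{pmatrix}$, with eigenvalue $1$. Type IV ($W_{2,c}$): endpoint 2, multiplicity 1, dimension 1, diameter 0, shape $(1)$; basis $\nu$, where $\nu=[1,-1,-1,1,1,-1]$; matrix representing $A$: $\begin{pmatrix}-2\end{pmatrix}$, with eigenvalue $-2$. Moreover $\dim T=3^2+2^2+1^2+1^2=15$.
   Context: Let $\Gamma=(X,\mathcal E)$ be a finite undirected connected graph without loops or multiple edges, with path-length distance $d$ and diameter $D\ge1$; put $\Gamma_i(x)=\{y\in X:d(x,y)=i\}$. $\Gamma$ is distance-regular if for all $0\le h,i,j\le D$ the number $p^h_{i,j}=|\Gamma_i(y)\cap\Gamma_j(z)|$ is the same for all $y,z\in X$ with $d(y,z)=h$. Its intersection array is $\{b_0,\dots,b_{D-1};c_1,\dots,c_D\}$ with $b_i=p^i_{1,i+1}$, $c_i=p^i_{1,i-1}$. $A\in\mathrm{Mat}_X(\mathbb C)$ is the adjacency matrix; in its spectrum, exponents denote multiplicities. The standard module $V=\mathbb C^X$ (column vectors) carries the Hermitian inner product $\langle u,v\rangle=u^t\bar v$. Fix a base vertex $x\in X$. For $0\le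 i\le D$, $E_i^*=E_i^*(x)$ is the diagonal matrix with $(y,y)$-entry $1$ if $d(x,y)=i$ and $0$ otherwise, and $e_i^*\in V$ is the vector with $y$-entry $1$ if $d(x,y)=i$ and $0$ otherwise. The Terwilliger algebra $T=T(x)$ is the subalgebra of $\mathrm{Mat}_X(\mathbb C)$ generated by $A$ and $E_0^*,\dots,E_D^*$. A $T$-module is a subspace $W\subseteq V$ with $BW\subseteq W$ for all $B\in T$; it is irreducible if $W\ne0$ and it properly contains no nonzero $T$-module. Isomorphisms of $T$-modules are vector space isomorphisms commuting with every $B\in T$. The endpoint of $W$ is $r=\min\{i:E_i^*W\ne0\}$; the diameter of an irreducible $W$ is $\delta=|\{i:E_i^*W\ne0\}|-1$, and its shape is $(\dim E_r^*W,\dots,\dim E_{r+\delta}^*W)$. The multiplicity of an irreducible module is the number of summands isomorphic to it in an orthogonal decomposition of $V$ into irreducible $T$-modules. A nonzero vector is pure with support $i$ if it lies in $E_i^*V$; its essential part is the row vector of its coordinates at the vertices of $\Gamma_i(x)$, in the chosen order (all its other coordinates are $0$). A pure basis of an irreducible $T$-module is an ordered basis of pure vectors with weakly increasing supports. The matrix $B$ representing $A$ with respect to a basis $v_1,\dots,v_\ell$ is given by $Av_j=\sum_iB_{ij}v_i$. -}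

module Defs where

open import Algebra.Bundles using (CommutativeMonoid)
open import Algebra.Bundles.Raw using (RawMonoid)
import Algebra.Definitions.RawMonoid as RawMonoidDefs
import Algebra.Properties.CommutativeSemigroup as CommutativeSemigroupProperties
open import Algebra.Module.Bundles.Raw using (RawLeftModule)
open import Algebra.Module.Morphism.Structures using (module LeftModuleMorphisms)
open import Data.Bool.Base using (if_then_else_)
open import Data.Fin.Base using (Fin; toℕ)
open import Data.Fin.Patterns using (0F; 1F; 2F; 3F; 4F; 5F)
open import Data.Fin.Properties using (any?) renaming (_≟_ to _≟ᶠ_)
open import Data.Fin.Subset using (Subset; ∣_∣) renaming (_∈_ to _∈ˢ_)
open import Data.Integer.Base as ℤ using (ℤ)
open import Data.List.Base as List using (List; []; _∷_; allFin; filter; length)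
open import Data.List.Relation.Unary.All using (All)
open import Data.List.Relation.Unary.Any using (Any)
open import Data.Nat.Base as ℕ using (ℕ; zero; suc)
import Data.Nat.DivMod as ℕ
import Data.Nat.Literals as ℕ-Literals
import Data.Nat.Properties as ℕ
open import Data.Product.Base using (Σ; ∃; ∃-syntax; ∃₂; _×_; _,_; proj₁; proj₂)
open import Data.Rational.Base as ℚ using (ℚ; 0ℚ; 1ℚ; ½)
import Data.Rational.Properties as ℚ
open import Data.Sum.Base using (_⊎_; inj₁; inj₂)
open import Data.Unit.Base using (⊤)
open import Data.Vec.Base using (Vec; []; _∷_; lookup)
open import Function.Base using (_∘_)
open import Function.Bundles using (_⇔_)
open import Function.Definitions using (Injective)
open import Level using (0ℓ)
open import Relation.Binary.Core using (Rel)
open import Relation.Binary.Definitions using (Symmetric; Irreflexive)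
  renaming (Decidable to Decidable₂)
open import Relation.Binary.PropositionalEquality.Core
  using (_≡_; _≢_; refl; sym; trans; cong; cong₂; subst)
open import Relation.Nullary using (¬_; Dec; yes; no; does)
open import Relation.Nullary.Decidable using (_×-dec_)
open import Relation.Unary using (Pred; Decidable; _∈_; _⊆_)

-- The relations and operations on ℝ and ℂ are opaque only to keep the type
-- checker from normalising rational arithmetic.

Eventually : Pred ℕ 0ℓ → Set
Eventually P = ∃[ N ] (∀ n → N ℕ.≤ n → P n)

IsCauchy : (ℕ → ℚ) → Set
IsCauchy s = ∀ ε → 0ℚ ℚ.< ε →
  ∃[ N ] (∀ m n → N ℕ.≤ m → N ℕ.≤ n → ℚ.∣ s m ℚ.- s n ∣ ℚ.< ε)

-- Real numbers are Cauchy sequences of rationals, equal when their difference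
-- is a null sequence.
record ℝ : Set where
  constructor mkℝ
  field
    seq    : ℕ → ℚ
    cauchy : IsCauchy seq

open ℝ public

infix 4 _≈ʳ_ _#ʳ_

opaque
  _≈ʳ_ : Rel ℝ 0ℓ
  x ≈ʳ y = ∀ ε → 0ℚ ℚ.< ε →
    Eventually (λ n → ℚ.∣ seq x n ℚ.- seq y n ∣ ℚ.< ε)

  -- Apartness, the positive form of inequality (classically: ¬ x ≈ʳ y).
  _#ʳ_ : Rel ℝ 0ℓ
  x #ʳ y = ∃[ ε ] 0ℚ ℚ.< ε ×
    Eventually (λ n → ε ℚ.≤ ℚ.∣ seq x n ℚ.- seq y n ∣)

private opaque
  half-pos : ∀ {ε} → 0ℚ ℚ.< ε → 0ℚ ℚ.< ½ ℚ.* ε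
  half-pos {ε} 0<ε =
    subst (ℚ._< ½ ℚ.* ε) (ℚ.*-zeroʳ ½) (ℚ.*-monoʳ-<-pos ½ 0<ε)

  halves : ∀ ε → ½ ℚ.* ε ℚ.+ ½ ℚ.* ε ≡ ε
  halves ε = trans (sym (ℚ.*-distribʳ-+ ε ½ ½)) (ℚ.*-identityˡ ε)

  const-cauchy : ∀ q → IsCauchy (λ _ → q)
  const-cauchy q ε 0<ε = zero , λ _ _ _ _ →
    subst (ℚ._< ε) (sym (cong ℚ.∣_∣ (ℚ.+-inverseʳ q))) 0<ε

  neg-cauchy : ∀ {s} → IsCauchy s → IsCauchy (λ n → ℚ.- s n)
  neg-cauchy {s} cs ε 0<ε with N , h ← cs ε 0<ε = N , λ m n N≤m N≤n →
    subst (ℚ._< ε)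
      (trans (sym (ℚ.∣-p∣≡∣p∣ (s m ℚ.- s n)))
             (cong ℚ.∣_∣ (ℚ.neg-distrib-+ (s m) (ℚ.- s n))))
      (h m n N≤m N≤n)

  add-cauchy : ∀ {s t} → IsCauchy s → IsCauchy t → IsCauchy (λ n → s n ℚ.+ t n)
  add-cauchy {s} {t} cs ct ε 0<ε
    with M , h ← cs (½ ℚ.* ε) (half-pos 0<ε)
       | N , k ← ct (½ ℚ.* ε) (half-pos 0<ε) =
    M ℕ.⊔ N , λ m n b≤m b≤n →
      let open ℚ.≤-Reasoning in begin-strict
        ℚ.∣ (s m ℚ.+ t m) ℚ.- (s n ℚ.+ t n) ∣
          ≡⟨ cong ℚ.∣_∣ (rearrange (s m) (t m) (s n) (t n)) ⟩
        ℚ.∣ (s m ℚ.- s n) ℚ.+ (t m ℚ.- t n) ∣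
          ≤⟨ ℚ.∣p+q∣≤∣p∣+∣q∣ (s m ℚ.- s n) (t m ℚ.- t n) ⟩
        ℚ.∣ s m ℚ.- s n ∣ ℚ.+ ℚ.∣ t m ℚ.- t n ∣
          <⟨ ℚ.+-mono-<
               (h m n (ℕ.≤-trans (ℕ.m≤m⊔n M N) b≤m) (ℕ.≤-trans (ℕ.m≤m⊔n M N) b≤n))
               (k m n (ℕ.≤-trans (ℕ.m≤n⊔m M N) b≤m) (ℕ.≤-trans (ℕ.m≤n⊔m M N) b≤n)) ⟩
        ½ ℚ.* ε ℚ.+ ½ ℚ.* ε
          ≡⟨ halves ε ⟩
        ε ∎
    where
    rearrange : ∀ a b c d →
      (a ℚ.+ b) ℚ.- (c ℚ.+ d) ≡ (a ℚ.- c) ℚ.+ (b ℚ.- d)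
    rearrange a b c d = trans (cong ((a ℚ.+ b) ℚ.+_) (ℚ.neg-distrib-+ c d))
      (CommutativeSemigroupProperties.interchange
        (CommutativeMonoid.commutativeSemigroup ℚ.+-0-commutativeMonoid)
        a b (ℚ.- c) (ℚ.- d))

  eventually-bounded : ∀ {s} → IsCauchy s →
    ∃[ K ] 0ℚ ℚ.< K × Eventually (λ n → ℚ.∣ s n ∣ ℚ.≤ K)
  eventually-bounded {s} cs with N , h ← cs 1ℚ (ℚ.positive⁻¹ 1ℚ) =
    1ℚ ℚ.+ ℚ.∣ s N ∣ ,
    ℚ.+-mono-<-≤ (ℚ.positive⁻¹ 1ℚ) (ℚ.0≤∣p∣ (s N)) ,
    N , λ n N≤n → let open ℚ.≤-Reasoning in begin
      ℚ.∣ s n ∣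
        ≡⟨ cong ℚ.∣_∣ (split (s n) (s N)) ⟩
      ℚ.∣ (s n ℚ.- s N) ℚ.+ s N ∣
        ≤⟨ ℚ.∣p+q∣≤∣p∣+∣q∣ (s n ℚ.- s N) (s N) ⟩
      ℚ.∣ s n ℚ.- s N ∣ ℚ.+ ℚ.∣ s N ∣
        ≤⟨ ℚ.+-monoˡ-≤ ℚ.∣ s N ∣ (ℚ.<⇒≤ (h n N N≤n ℕ.≤-refl)) ⟩
      1ℚ ℚ.+ ℚ.∣ s N ∣ ∎
    where
    split : ∀ a b → a ≡ (a ℚ.- b) ℚ.+ b
    split a b = sym (trans (ℚ.+-assoc a (ℚ.- b) b)
      (trans (cong (a ℚ.+_) (ℚ.+-inverseˡ b)) (ℚ.+-identityʳ a)))

  share : ∀ K .{{_ : ℚ.Positive K}} → ℚ → ℚ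
  share K ε = (ℚ.1/ K) {{ℚ.pos⇒nonZero K}} ℚ.* (½ ℚ.* ε)

  share-pos : ∀ K ε .{{_ : ℚ.Positive K}} → 0ℚ ℚ.< ε → 0ℚ ℚ.< share K ε
  share-pos K ε 0<ε = subst (ℚ._< share K ε) (ℚ.*-zeroʳ K⁻¹)
    (ℚ.*-monoʳ-<-pos K⁻¹ {{ℚ.1/pos⇒pos K}} (half-pos 0<ε))
    where
    K⁻¹ : ℚ
    K⁻¹ = (ℚ.1/ K) {{ℚ.pos⇒nonZero K}}

  *-share : ∀ K ε .{{_ : ℚ.Positive K}} → K ℚ.* share K ε ≡ ½ ℚ.* ε
  *-share K ε = trans (sym (ℚ.*-assoc K K⁻¹ (½ ℚ.* ε)))
    (trans (cong (ℚ._* (½ ℚ.* ε)) (ℚ.*-inverseʳ K {{ℚ.pos⇒nonZero K}}))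
           (ℚ.*-identityˡ (½ ℚ.* ε)))
    where
    K⁻¹ : ℚ
    K⁻¹ = (ℚ.1/ K) {{ℚ.pos⇒nonZero K}}

  product-bound : ∀ K ε p q .{{_ : ℚ.Positive K}} →
    ℚ.∣ p ∣ ℚ.≤ K → ℚ.∣ q ∣ ℚ.< share K ε → ℚ.∣ p ℚ.* q ∣ ℚ.< ½ ℚ.* ε
  product-bound K ε p q p≤K q<δ = begin-strict
    ℚ.∣ p ℚ.* q ∣        ≡⟨ ℚ.∣p*q∣≡∣p∣*∣q∣ p q ⟩
    ℚ.∣ p ∣ ℚ.* ℚ.∣ q ∣  ≤⟨ ℚ.*-monoʳ-≤-nonNeg ℚ.∣ q ∣ {{ℚ.∣-∣-nonNeg q}} p≤K ⟩
    K ℚ.* ℚ.∣ q ∣        <⟨ ℚ.*-monoʳ-<-pos K q<δ ⟩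
    K ℚ.* share K ε      ≡⟨ *-share K ε ⟩
    ½ ℚ.* ε              ∎
    where open ℚ.≤-Reasoning

  telescope : ∀ a b c → a ℚ.- c ≡ (a ℚ.- b) ℚ.+ (b ℚ.- c)
  telescope a b c = sym (trans (ℚ.+-assoc a (ℚ.- b) (b ℚ.- c))
    (cong (a ℚ.+_) (trans (sym (ℚ.+-assoc (ℚ.- b) b (ℚ.- c)))
      (trans (cong (ℚ._- c) (ℚ.+-inverseˡ b)) (ℚ.+-identityˡ (ℚ.- c))))))

  *-distribˡ-- : ∀ a b c → a ℚ.* (b ℚ.- c) ≡ a ℚ.* b ℚ.- a ℚ.* c
  *-distribˡ-- a b c = trans (ℚ.*-distribˡ-+ a b (ℚ.- c))
    (cong (a ℚ.* b ℚ.+_) (sym (ℚ.neg-distribʳ-* a c)))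

  product-difference : ∀ a b c d →
    a ℚ.* b ℚ.- c ℚ.* d ≡ a ℚ.* (b ℚ.- d) ℚ.+ d ℚ.* (a ℚ.- c)
  product-difference a b c d = trans (telescope (a ℚ.* b) (a ℚ.* d) (c ℚ.* d))
    (sym (cong₂ ℚ._+_ (*-distribˡ-- a b d)
      (trans (*-distribˡ-- d a c) (cong₂ ℚ._-_ (ℚ.*-comm d a) (ℚ.*-comm d c)))))

  mul-cauchy : ∀ {s t} → IsCauchy s → IsCauchy t → IsCauchy (λ n → s n ℚ.* t n)
  mul-cauchy {s} {t} cs ct ε 0<ε =
    let K , 0<K , M₁ , s≤K = eventually-bounded {s} cs
        L , 0<L , M₂ , t≤L = eventually-bounded {t} ct
        K⁺ = ℚ.positive 0<K
        L⁺ = ℚ.positive 0<L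
        N₁ , h = cs (share L {{L⁺}} ε) (share-pos L ε {{L⁺}} 0<ε)
        N₂ , k = ct (share K {{K⁺}} ε) (share-pos K ε {{K⁺}} 0<ε)
        M = M₁ ℕ.⊔ M₂
        N = N₁ ℕ.⊔ N₂
        ≤₁ : ∀ {n} → M ℕ.⊔ N ℕ.≤ n → M₁ ℕ.≤ n
        ≤₁ b≤n = ℕ.m⊔n≤o⇒m≤o M₁ M₂ (ℕ.m⊔n≤o⇒m≤o M N b≤n)
        ≤₂ : ∀ {n} → M ℕ.⊔ N ℕ.≤ n → M₂ ℕ.≤ n
        ≤₂ b≤n = ℕ.m⊔n≤o⇒n≤o M₁ M₂ (ℕ.m⊔n≤o⇒m≤o M N b≤n)
        ≤₃ : ∀ {n} → M ℕ.⊔ N ℕ.≤ n → N₁ ℕ.≤ n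
        ≤₃ b≤n = ℕ.m⊔n≤o⇒m≤o N₁ N₂ (ℕ.m⊔n≤o⇒n≤o M N b≤n)
        ≤₄ : ∀ {n} → M ℕ.⊔ N ℕ.≤ n → N₂ ℕ.≤ n
        ≤₄ b≤n = ℕ.m⊔n≤o⇒n≤o N₁ N₂ (ℕ.m⊔n≤o⇒n≤o M N b≤n)
    in M ℕ.⊔ N , λ m n b≤m b≤n → estimate
         (product-bound K ε (s m) (t m ℚ.- t n) {{K⁺}} (s≤K m (≤₁ b≤m)) (k m n (≤₄ b≤m) (≤₄ b≤n)))
         (product-bound L ε (t n) (s m ℚ.- s n) {{L⁺}} (t≤L n (≤₂ b≤n)) (h m n (≤₃ b≤m) (≤₃ b≤n)))
    where
    estimate : ∀ {m n} →
      ℚ.∣ s m ℚ.* (t m ℚ.- t n) ∣ ℚ.< ½ ℚ.* ε →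
      ℚ.∣ t n ℚ.* (s m ℚ.- s n) ∣ ℚ.< ½ ℚ.* ε →
      ℚ.∣ s m ℚ.* t m ℚ.- s n ℚ.* t n ∣ ℚ.< ε
    estimate {m} {n} p q = begin-strict
      ℚ.∣ s m ℚ.* t m ℚ.- s n ℚ.* t n ∣
        ≡⟨ cong ℚ.∣_∣ (product-difference (s m) (t m) (s n) (t n)) ⟩
      ℚ.∣ s m ℚ.* (t m ℚ.- t n) ℚ.+ t n ℚ.* (s m ℚ.- s n) ∣
        ≤⟨ ℚ.∣p+q∣≤∣p∣+∣q∣ (s m ℚ.* (t m ℚ.- t n)) (t n ℚ.* (s m ℚ.- s n)) ⟩
      ℚ.∣ s m ℚ.* (t m ℚ.- t n) ∣ ℚ.+ ℚ.∣ t n ℚ.* (s m ℚ.- s n) ∣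
        <⟨ ℚ.+-mono-< p q ⟩
      ½ ℚ.* ε ℚ.+ ½ ℚ.* ε
        ≡⟨ halves ε ⟩
      ε ∎
      where open ℚ.≤-Reasoning

infixl 6 _+ʳ_
infixl 7 _*ʳ_
infix  8 -ʳ_

opaque
  fromℚ : ℚ → ℝ
  fromℚ q = mkℝ (λ _ → q) (const-cauchy q)

  _+ʳ_ : ℝ → ℝ → ℝ
  mkℝ s cs +ʳ mkℝ t ct = mkℝ (λ n → s n ℚ.+ t n) (add-cauchy {s} {t} cs ct)

  _*ʳ_ : ℝ → ℝ → ℝ
  mkℝ s cs *ʳ mkℝ t ct = mkℝ (λ n → s n ℚ.* t n) (mul-cauchy {s} {t} cs ct)

  -ʳ_ : ℝ → ℝ
  -ʳ mkℝ s cs = mkℝ (λ n → ℚ.- s n) (neg-cauchy {s} cs)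

infix 5 _+i_
record ℂ : Set where
  constructor _+i_
  field
    re im : ℝ

open ℂ public

infix  4 _≈ᶜ_ _#ᶜ_
infixl 6 _+ᶜ_
infixl 7 _*ᶜ_
infix  8 -ᶜ_

opaque
  _≈ᶜ_ : Rel ℂ 0ℓ
  z ≈ᶜ w = re z ≈ʳ re w × im z ≈ʳ im w

  _#ᶜ_ : Rel ℂ 0ℓ
  z #ᶜ w = re z #ʳ re w ⊎ im z #ʳ im w

  _+ᶜ_ : ℂ → ℂ → ℂ
  (a +i b) +ᶜ (c +i d) = (a +ʳ c) +i (b +ʳ d)

  _*ᶜ_ : ℂ → ℂ → ℂ
  (a +i b) *ᶜ (c +i d) = (a *ʳ c +ʳ -ʳ (b *ʳ d)) +i (a *ʳ d +ʳ b *ʳ c)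

  -ᶜ_ : ℂ → ℂ
  -ᶜ (a +i b) = (-ʳ a) +i (-ʳ b)

  conj : ℂ → ℂ
  conj (a +i b) = a +i (-ʳ b)

  fromℤ : ℤ → ℂ
  fromℤ z = fromℚ (z ℚ./ 1) +i fromℚ 0ℚ

0ᶜ 1ᶜ : ℂ
0ᶜ = fromℤ ℤ.0ℤ
1ᶜ = fromℤ ℤ.1ℤ

-- Numerals now denote naturals or complex numbers, as required.
open import Agda.Builtin.FromNat using (Number; fromNat)
open import Agda.Builtin.FromNeg using (Negative; fromNeg)

instance
  ℕ-number : Number ℕ
  ℕ-number = ℕ-Literals.number

  ℂ-number : Number ℂ
  ℂ-number = record { Constraint = λ _ → ⊤ ; fromNat = λ n → fromℤ (ℤ.+ n) }

  ℂ-negative : Negative ℂ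
  ℂ-negative = record { Constraint = λ _ → ⊤ ; fromNeg = λ n → fromℤ (ℤ.- (ℤ.+ n)) }

+ᶜ-rawMonoid : RawMonoid 0ℓ 0ℓ
+ᶜ-rawMonoid = record { Carrier = ℂ ; _≈_ = _≈ᶜ_ ; _∙_ = _+ᶜ_ ; ε = 0ᶜ }

open RawMonoidDefs +ᶜ-rawMonoid public using (sum)

[_]ᶜ : ∀ {P : Set} → Dec P → ℂ
[ P? ]ᶜ = if does P? then 1ᶜ else 0ᶜ

-- The space ℂ^I.  Matrices are vectors indexed by pairs, so that the notions
-- below (subspace, basis, dimension) apply to both.
𝕍 : Set → Set
𝕍 Ix = Ix → ℂ

Mat : ℕ → ℕ → Set
Mat m n = 𝕍 (Fin m × Fin n)

private variable
  Ix : Set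
  k ℓ m n : ℕ

infix  4 _≈ᵛ_
infixl 6 _+ᵛ_
infixr 7 _·_ _*ᵛ_
infixl 7 _*ᵐ_

_≈ᵛ_ : Rel (𝕍 Ix) 0ℓ
u ≈ᵛ v = ∀ i → u i ≈ᶜ v i

0ᵛ : 𝕍 Ix
0ᵛ _ = 0ᶜ

_+ᵛ_ : 𝕍 Ix → 𝕍 Ix → 𝕍 Ix
(u +ᵛ v) i = u i +ᶜ v i

_·_ : ℂ → 𝕍 Ix → 𝕍 Ix
(c · v) i = c *ᶜ v i

-- v ≠ 0, in the positive form.
NonZero : Pred (𝕍 Ix) 0ℓ
NonZero v = ∃[ i ] v i #ᶜ 0ᶜ

sumᵛ : (Fin k → 𝕍 Ix) → 𝕍 Ix
sumᵛ vs i = sum (λ j → vs j i)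

linComb : (Fin k → ℂ) → (Fin k → 𝕍 Ix) → 𝕍 Ix
linComb c vs = sumᵛ (λ j → c j · vs j)

⟨_,_⟩ : 𝕍 (Fin n) → 𝕍 (Fin n) → ℂ
⟨ u , v ⟩ = sum (λ y → u y *ᶜ conj (v y))

_*ᵛ_ : Mat m n → 𝕍 (Fin n) → 𝕍 (Fin m)
(M *ᵛ v) i = sum (λ j → M (i , j) *ᶜ v j)

_*ᵐ_ : Mat m n → Mat n k → Mat m k
(M *ᵐ N) (i , j) = sum (λ l → M (i , l) *ᶜ N (l , j))

1ᵐ : Mat n n
1ᵐ (i , j) = [ i ≟ᶠ j ]ᶜ

matrix : Vec (Vec ℂ n) m → Mat m n
matrix rows (i , j) = lookup (lookup rows i) j

record IsSubspace (W : Pred (𝕍 Ix) 0ℓ) : Set where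
  field
    resp : ∀ {u v} → u ≈ᵛ v → u ∈ W → v ∈ W
    0∈   : 0ᵛ ∈ W
    +∈   : ∀ {u v} → u ∈ W → v ∈ W → (u +ᵛ v) ∈ W
    ·∈   : ∀ c {v} → v ∈ W → (c · v) ∈ W

record IsBasis (W : Pred (𝕍 Ix) 0ℓ) (vs : Fin k → 𝕍 Ix) : Set where
  field
    members     : ∀ j → vs j ∈ W
    independent : ∀ c → linComb c vs ≈ᵛ 0ᵛ → ∀ j → c j ≈ᶜ 0ᶜ
    spanning    : ∀ {v} → v ∈ W → ∃[ c ] v ≈ᵛ linComb c vs

HasDimension : Pred (𝕍 Ix) 0ℓ → ℕ → Set
HasDimension {Ix} W k = Σ (Fin k → 𝕍 Ix) (IsBasis W)

NonZeroSpace : Pred (𝕍 Ix) 0ℓ → Set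
NonZeroSpace W = ∃[ v ] v ∈ W × NonZero v

Eigenspace : Mat n n → ℂ → Pred (𝕍 (Fin n)) 0ℓ
Eigenspace M θ v = M *ᵛ v ≈ᵛ θ · v

HasEigenvalues : Mat n n → List ℂ → Set
HasEigenvalues M θs =
  ∀ θ → NonZeroSpace (Eigenspace M θ) ⇔ Any (θ ≈ᶜ_) θs

-- The spectrum as a list of eigenvalues with multiplicities.  It is only used
-- for real symmetric matrices, where the multiplicity of an eigenvalue is the
-- dimension of its eigenspace.
HasSpectrum : Mat n n → List (ℂ × ℕ) → Set
HasSpectrum M θms =
  HasEigenvalues M (List.map proj₁ θms) ×
  All (λ (θ , m) → HasDimension (Eigenspace M θ) m) θms

HasCardinality : Pred (Fin n) 0ℓ → ℕ → Set
HasCardinality {n} P k = Σ (Subset n) λ S → (∀ i → i ∈ˢ S ⇔ P i) × ∣ S ∣ ≡ k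

record Graph (n : ℕ) : Set₁ where
  infix 4 _∼_ _∼?_
  field
    _∼_    : Rel (Fin n) 0ℓ
    _∼?_   : Decidable₂ _∼_
    ∼-sym  : Symmetric _∼_
    irrefl : Irreflexive _≡_ _∼_

-- The least k < n satisfying P, or n if there is none.
least : {P : Pred ℕ 0ℓ} → Decidable P → ℕ → ℕ
least P? zero    = zero
least P? (suc n) = if does (P? zero) then zero else suc (least (P? ∘ suc) n)

module _ (Γ : Graph n) where
  open Graph Γ

  Walk : ℕ → Rel (Fin n) 0ℓ
  Walk zero    x y = x ≡ y
  Walk (suc k) x y = ∃[ z ] x ∼ z × Walk k z y

  walk? : ∀ k → Decidable₂ (Walk k)
  walk? zero    x y = x ≟ᶠ y
  walk? (suc k) x y = any? (λ z → (x ∼? z) ×-dec walk? k z y)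

  Connected : Set
  Connected = ∀ x y → ∃[ k ] Walk k x y

  -- A shortest walk has fewer than n edges, so in a connected graph the bounded
  -- search always succeeds and finds the path-length distance.
  dist : Fin n → Fin n → ℕ
  dist x y = least (λ k → walk? k x y) n

  IsDiameter : ℕ → Set
  IsDiameter D = (∀ x y → dist x y ℕ.≤ D) × ∃₂ λ x y → dist x y ≡ D

  -- ∣ Γᵢ(y) ∩ Γⱼ(z) ∣
  meet : ℕ → ℕ → Fin n → Fin n → ℕ
  meet i j y z =
    length (filter (λ w → (dist y w ℕ.≟ i) ×-dec (dist z w ℕ.≟ j)) (allFin n))

  IsIntersectionNumber : (h i j p : ℕ) → Set
  IsIntersectionNumber h i j p = ∀ y z → dist y z ≡ h → meet i j y z ≡ p

  record DistanceRegular (D : ℕ) : Set where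
    field
      connected : Connected
      diameter  : IsDiameter D
      D≥1       : D ℕ.≥ 1
      regular   : ∀ h i j → h ℕ.≤ D → i ℕ.≤ D → j ℕ.≤ D →
                  ∃[ p ] IsIntersectionNumber h i j p

  -- The array {b₀,…,b_{D-1}; c₁,…,c_D}: entry i of c is c_{i+1}.
  HasIntersectionArray : ∀ {D} (b c : Vec ℕ D) → Set
  HasIntersectionArray {D} b c = ∀ (i : Fin D) →
    IsIntersectionNumber (toℕ i) 1 (suc (toℕ i)) (lookup b i) ×
    IsIntersectionNumber (suc (toℕ i)) 1 (toℕ i) (lookup c i)

  adjacency : Mat n n
  adjacency (y , z) = [ y ∼? z ]ᶜ

  record Ordering (x : Fin n) (i k : ℕ) : Set where
    field
      at        : Fin k → Fin n
      injective : Injective _≡_ _≡_ at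
      exact     : ∀ y → dist x y ≡ i ⇔ (∃[ t ] at t ≡ y)

  -- c₀, …, c_k, in this cyclic order, induce a cycle.
  IsInducedCycle : (Fin (suc k) → Fin n) → Set
  IsInducedCycle {k} c = ∀ s t → c s ∼ c t ⇔ (next s t ⊎ next t s)
    where
    next : Rel (Fin (suc k)) 0ℓ
    next s t = suc (toℕ s) ℕ.% suc k ≡ toℕ t

  CommonNeighbourIn : ∀ (x : Fin n) (i : ℕ) (y z : Fin n) → Set
  CommonNeighbourIn x i y z = ∃[ w ] dist x w ≡ i × w ∼ y × w ∼ z

-- The vector with essential part e: coordinates e at the vertices of Γᵢ(x), in
-- the chosen order, and 0 elsewhere.
fromEssential : ∀ {Γ : Graph n} {x i k} → Ordering Γ x i k → Vec ℂ k → 𝕍 (Fin n)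
fromEssential o e y with any? (λ t → Ordering.at o t ≟ᶠ y)
... | yes (t , _) = lookup e t
... | no  _       = 0ᶜ

record TypeData : Set where
  field
    endpoint multiplicity dimension diameter : ℕ
    shape       : Vec ℕ (suc diameter)
    matrixOfA   : Mat dimension dimension
    eigenvalues : List ℂ

module Terwilliger (Γ : Graph n) (D : ℕ) (x : Fin n) where

  V : Set
  V = 𝕍 (Fin n)

  A : Mat n n
  A = adjacency Γ

  E* : ℕ → Mat n n
  E* i (y , z) = if does (y ≟ᶠ z) then [ dist Γ x y ℕ.≟ i ]ᶜ else 0ᶜ

  e* : ℕ → V
  e* i y = [ dist Γ x y ℕ.≟ i ]ᶜ

  data T : Pred (Mat n n) 0ℓ where
    A∈   : A ∈ T
    E*∈  : ∀ i → i ℕ.≤ D → E* i ∈ T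
    1∈   : 1ᵐ ∈ T
    +∈   : ∀ {M N} → M ∈ T → N ∈ T → (M +ᵛ N) ∈ T
    ·∈   : ∀ c {M} → M ∈ T → (c · M) ∈ T
    *∈   : ∀ {M N} → M ∈ T → N ∈ T → (M *ᵐ N) ∈ T
    resp : ∀ {M N} → M ≈ᵛ N → M ∈ T → N ∈ T

  record TModule : Set₁ where
    field
      Carrier    : Pred V 0ℓ
      isSubspace : IsSubspace Carrier
      closed     : ∀ {B w} → B ∈ T → w ∈ Carrier → (B *ᵛ w) ∈ Carrier

    private module S = IsSubspace isSubspace

    rawLeftModule : RawLeftModule ℂ 0ℓ 0ℓ
    rawLeftModule = record
      { Carrierᴹ = ∃ Carrier
      ; _≈ᴹ_     = λ (u , _) (v , _) → u ≈ᵛ v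
      ; _+ᴹ_     = λ (u , u∈) (v , v∈) → u +ᵛ v , S.+∈ u∈ v∈
      ; _*ₗ_     = λ c (v , v∈) → c · v , S.·∈ c v∈
      ; 0ᴹ       = 0ᵛ , S.0∈
      ; -ᴹ_      = λ (v , v∈) → (-ᶜ 1ᶜ) · v , S.·∈ (-ᶜ 1ᶜ) v∈
      }

  open TModule public using (Carrier)

  record _≅_ (W₁ W₂ : TModule) : Set where
    private
      module W₁ = TModule W₁
      module W₂ = TModule W₂
    open LeftModuleMorphisms W₁.rawLeftModule W₂.rawLeftModule
    field
      to            : ∃ W₁.Carrier → ∃ W₂.Carrier
      isIsomorphism : IsLeftModuleIsomorphism to
      commutes      : ∀ {B} (B∈T : B ∈ T) (w : ∃ W₁.Carrier) →
        proj₁ (to (B *ᵛ proj₁ w , W₁.closed B∈T (proj₂ w))) ≈ᵛ B *ᵛ proj₁ (to w)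

  Irreducible : TModule → Set₁
  Irreducible W = NonZeroSpace (Carrier W) ×
    (∀ U → Carrier U ⊆ Carrier W → NonZeroSpace (Carrier U) → Carrier W ⊆ Carrier U)

  record IsOrthogonalDecomposition (W : Fin k → TModule) : Set₁ where
    field
      irreducible : ∀ i → Irreducible (W i)
      spanning    : ∀ v → ∃[ w ] (∀ i → w i ∈ Carrier (W i)) × v ≈ᵛ sumᵛ w
      direct      : ∀ w w′ → (∀ i → w i ∈ Carrier (W i)) → (∀ i → w′ i ∈ Carrier (W i)) →
                    sumᵛ w ≈ᵛ sumᵛ w′ → ∀ i → w i ≈ᵛ w′ i
      orthogonal  : ∀ {i j u v} → i ≢ j → u ∈ Carrier (W i) → v ∈ Carrier (W j) →
                    ⟨ u , v ⟩ ≈ᶜ 0ᶜ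

  E*[_] : ℕ → Pred V 0ℓ → Pred V 0ℓ
  E*[ i ] W v = ∃[ w ] w ∈ W × v ≈ᵛ E* i *ᵛ w

  IsEndpoint : TModule → ℕ → Set
  IsEndpoint W r = NonZeroSpace (E*[ r ] (Carrier W)) ×
    (∀ i → i ℕ.< r → ¬ NonZeroSpace (E*[ i ] (Carrier W)))

  HasDiameter : TModule → ℕ → Set
  HasDiameter W δ =
    HasCardinality {suc D} (λ i → NonZeroSpace (E*[ toℕ i ] (Carrier W))) (suc δ)

  -- For every orthogonal decomposition of V into irreducible T-modules, not just
  -- for one: that the number does not depend on the decomposition is part of the
  -- definition.
  HasMultiplicity : TModule → ℕ → Set₁
  HasMultiplicity W m = ∀ {k} (U : Fin k → TModule) → IsOrthogonalDecomposition U →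
    HasCardinality (λ j → U j ≅ W) m

  Pure : V → ℕ → Set
  Pure v i = NonZero v × (∃[ u ] v ≈ᵛ E* i *ᵛ u)

  IsPureBasis : TModule → (Fin k → V) → Set
  IsPureBasis {k} W vs = IsBasis (Carrier W) vs ×
    Σ (Fin k → Fin (suc D)) λ supp →
      (∀ j → Pure (vs j) (toℕ (supp j))) ×
      (∀ i j → toℕ i ℕ.≤ toℕ j → toℕ (supp i) ℕ.≤ toℕ (supp j))

  Represents : Mat k k → (Fin k → V) → Set
  Represents B vs = ∀ j → A *ᵛ vs j ≈ᵛ linComb (λ i → B (i , j)) vs

  record HasData (W : TModule) (t : TypeData) (basis : Fin (TypeData.dimension t) → V) :
         Set₁ where
    private module t = TypeData t
    field
      endpoint     : IsEndpoint W t.endpoint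
      multiplicity : HasMultiplicity W t.multiplicity
      dimension    : HasDimension (Carrier W) t.dimension
      diameter     : HasDiameter W t.diameter
      shape        : ∀ (i : Fin (suc t.diameter)) →
        HasDimension (E*[ t.endpoint ℕ.+ toℕ i ] (Carrier W)) (lookup t.shape i)
      pureBasis    : IsPureBasis W basis
      represents   : Represents t.matrixOfA basis
      eigenvalues  : HasEigenvalues t.matrixOfA t.eigenvalues

  -- ν spans E_r* W, and E_r* W has dimension 1.
  IsSeed : TModule → ℕ → V → Set
  IsSeed W r ν = IsBasis {k = 1} (E*[ r ] (Carrier W)) (λ _ → ν)

data SummandType : Set where
  I II III IV : SummandType

typeData : SummandType → TypeData
typeData I = record
  { endpoint     = 0
  ; multiplicity = 1
  ; dimension    = 3
  ; diameter     = 2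
  ; shape        = 1 ∷ 1 ∷ 1 ∷ []
  ; matrixOfA    = matrix
      ( (0 ∷ 3 ∷ 0 ∷ [])
      ∷ (1 ∷ 0 ∷ 2 ∷ [])
      ∷ (0 ∷ 1 ∷ 2 ∷ [])
      ∷ [])
  ; eigenvalues  = 3 ∷ 1 ∷ -2 ∷ []
  }
typeData II = record
  { endpoint     = 1
  ; multiplicity = 2
  ; dimension    = 2
  ; diameter     = 1
  ; shape        = 1 ∷ 1 ∷ []
  ; matrixOfA    = matrix
      ( (0 ∷  2 ∷ [])
      ∷ (1 ∷ -1 ∷ [])
      ∷ [])
  ; eigenvalues  = 1 ∷ -2 ∷ []
  }
typeData III = record
  { endpoint     = 2
  ; multiplicity = 2
  ; dimension    = 1
  ; diameter     = 0
  ; shape        = 1 ∷ []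
  ; matrixOfA    = matrix ((1 ∷ []) ∷ [])
  ; eigenvalues  = 1 ∷ []
  }
typeData IV = record
  { endpoint     = 2
  ; multiplicity = 1
  ; dimension    = 1
  ; diameter     = 0
  ; shape        = 1 ∷ []
  ; matrixOfA    = matrix ((-2 ∷ []) ∷ [])
  ; eigenvalues  = -2 ∷ []
  }

seed₁ₐ seed₁ᵦ : Vec ℂ 3
seed₁ₐ = 1 ∷ -1 ∷  0 ∷ []
seed₁ᵦ = 1 ∷  1 ∷ -2 ∷ []

seed₂ₐ seed₂ᵦ seed₂ᵪ : Vec ℂ 6
seed₂ₐ = 1 ∷ -1 ∷  1 ∷ -1 ∷  0 ∷  0 ∷ []
seed₂ᵦ = 1 ∷ -1 ∷ -1 ∷  1 ∷ -2 ∷  2 ∷ []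
seed₂ᵪ = 1 ∷ -1 ∷ -1 ∷  1 ∷  1 ∷ -1 ∷ []

petersenSpectrum : List (ℂ × ℕ)
petersenSpectrum = (3 , 1) ∷ (1 , 5) ∷ (-2 , 4) ∷ []

-- Indices are shifted by one: y 0F, …, y 5F are y₁, …, y₆.
Admissible : ∀ {Γ : Graph n} {x} → Ordering Γ x 2 6 → Set
Admissible {Γ = Γ} {x} o =
  CommonNeighbourIn Γ x 1 (y 0F) (y 1F) ×
  CommonNeighbourIn Γ x 1 (y 2F) (y 3F) ×
  CommonNeighbourIn Γ x 1 (y 4F) (y 5F) ×
  IsInducedCycle Γ (lookup (y 0F ∷ y 2F ∷ y 4F ∷ y 1F ∷ y 3F ∷ y 5F ∷ []))
  where y = Ordering.at o

{-# OPTIONS --safe #-}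
module Submission where

-- The intersection array determines the graph up to a labelling of its vertices,
-- in which the vectors of the listed bases have integer coordinates.  These ten
-- vectors form an orthogonal basis of V, on which A and the E*ᵢ act through the
-- matrices of the four types; hence T acts on them through M₃ ⊕ M₂ ⊕ ℂ ⊕ ℂ, and
-- faithfully.  Explicit polynomials in A and the E*ᵢ act as the 15 matrix units,
-- so these units are a basis of T.  A nonzero vector of an irreducible T-module
-- has a nonzero image under some diagonal unit, and then its images under the
-- units in that column span the module, which is thereby classified by its type.
-- In two decompositions of V the numbers of summands of one type are the traces
-- of the matrix products CD and DC, so they are equal.

open import Defs
open import Algebra.Bundles using (CommutativeRing)
open import Algebra.Module.Morphism.Structures using (module LeftModuleMorphisms)
import Algebra.Properties.Semiring.Sum as SemiringSum
import Algebra.Solver.Ring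
open import Algebra.Solver.Ring.AlmostCommutativeRing using (fromCommutativeRing; _-Raw-AlmostCommutative⟶_)
open import Data.Bool.Base using (if_then_else_; Bool; true; false)
open import Data.Empty using (⊥; ⊥-elim)
open import Data.Fin.Base as Fin using (Fin; zero; suc; toℕ)
open import Data.Fin.Patterns using (0F; 1F; 2F; 3F; 4F; 5F; 6F; 7F; 8F; 9F)
open import Data.Fin.Permutation using (Permutation; permutation; _⟨$⟩ʳ_; _⟨$⟩ˡ_; inverseʳ; inverseˡ)
import Data.Fin.Permutation as Perm
open import Data.Fin.Properties using (all?; any?) renaming (_≟_ to _≟ᶠ_)
import Data.Fin.Properties as Fin
open import Data.Fin.Subset using (∣_∣) renaming (_∈_ to _∈ˢ_)
open import Data.Integer.Base as ℤ using (ℤ)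
import Data.Integer.Properties as ℤ
open import Data.List.Base as List using (List; []; _∷_; filter; allFin; length)
import Data.List.Membership.Propositional.Properties as List∈
open import Data.List.Relation.Unary.All as All using ([]; _∷_)
open import Data.List.Relation.Unary.Any as Any using (Any; here; there)
import Data.List.Relation.Unary.Any.Properties as Any
open import Data.List.Relation.Unary.Unique.Propositional using (Unique; _∷_)
import Data.List.Relation.Unary.Unique.Propositional.Properties as Unique
open import Data.Maybe.Base using (just; nothing)
open import Data.Nat.Base as ℕ using (ℕ; zero; suc)
open import Data.Nat.Base using (_+_; _^_)
import Data.Nat.DivMod as ℕ
import Data.Nat.Properties as ℕ
open import Data.Product.Base using (Σ; Σ-syntax; ∃; ∃-syntax; _×_; _,_; proj₁; proj₂)
open import Data.Rational.Base as ℚ using (ℚ; 0ℚ; 1ℚ; ½)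
import Data.Rational.Properties as ℚ
import Data.Rational.Solver as ℚ-Solver
import Data.Rational.Unnormalised.Base as ℚᵘ
import Data.Rational.Unnormalised.Properties as ℚᵘ
open import Data.Sum.Base as Sum using (_⊎_; inj₁; inj₂)
open import Data.Vec.Base as Vec using (Vec; []; _∷_; lookup; tabulate)
import Data.Vec.Functional as Vector
import Data.Vec.Properties as Vec
open import Function.Base using (_∘_; case_of_)
open import Function.Bundles using (_⇔_; mk⇔; Equivalence)
open import Level using (0ℓ)
open import Relation.Binary.Bundles using (Setoid)
open import Relation.Binary.Definitions using (DecidableEquality; WeaklyDecidable)
open import Relation.Binary.PropositionalEquality.Core using (_≡_; _≢_; refl; sym; trans; cong; cong₂; subst; subst₂)
import Relation.Binary.Reasoning.Setoid as SetoidReasoning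
open import Relation.Nullary using (¬_; Dec; yes; no; does; proof; contradiction; ¬?)
open import Relation.Nullary.Decidable
  using (from-yes; map′; does-⇔; dec-true; dec-false; _→-dec_; _⊎-dec_; _×-dec_)
open import Relation.Nullary.Reflects using (Reflects; ofʸ; ofⁿ)
open import Relation.Unary using (Pred; _∈_)

-- Complex numbers are pairs of Cauchy sequences, so neither equality with 0 nor a rank can be
-- decided, and nonzero means apart from 0. Case distinctions are replaced by two facts: a sum apart
-- from 0 has a summand apart from 0, and a number apart from 0 is invertible. They find the
-- diagonal unit that does not annihilate a given vector. The multiplicity is claimed for every
-- decomposition into irreducible modules; a trace compares two decompositions without elimination
-- or basis exchange. All numerical facts are identities between integers, decided by evaluation and
-- then carried to `ℂ`. Division is postponed by common denominators: 6 for the matrix units, 12 for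
-- the ten orthogonal vectors, 180 for the eigenvectors of `A`. The order of the three inner
-- vertices is arbitrary, so the tables depend on the bijection from the outer pairs to the inner
-- vertices and are decided for all six bijections.

private variable
  Ix : Set
  k l m n : ℕ

-- Polynomial identities over the rationals

private module ℚ-identities where
  open ℚ-Solver.+-*-Solver

  p≡p-q+q : ∀ a b → a ≡ (a ℚ.- b) ℚ.+ b
  p≡p-q+q = solve 2 (λ a b → a := (a :+ :- b) :+ b) refl

  p*[q*r]≡[q*p]*r : ∀ a b c → a ℚ.* (b ℚ.* c) ≡ (b ℚ.* a) ℚ.* c
  p*[q*r]≡[q*p]*r = solve 3 (λ a b c → a :* (b :* c) := (b :* a) :* c) refl

  inverse-expansion : ∀ p q p′ q′ → p′ ℚ.* (q′ ℚ.* (q ℚ.- p)) ≡ p′ ℚ.* (q ℚ.* q′) ℚ.- q′ ℚ.* (p ℚ.* p′)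
  inverse-expansion = solve 4 (λ p q p′ q′ → p′ :* (q′ :* (q :+ :- p)) := p′ :* (q :* q′) :+ :- (q′ :* (p :* p′))) refl

  neg*neg : ∀ p → (ℚ.- p) ℚ.* (ℚ.- p) ≡ p ℚ.* p
  neg*neg = solve 1 (λ p → (:- p) :* (:- p) := p :* p) refl

  -- Four summands, each of them small if `x` is close to `y + z`, `y` is close to `w`, and both `z`
  -- and `w` are small.
  regroup : ∀ x y z w → x ≡ ((x ℚ.- (y ℚ.+ z)) ℚ.+ z) ℚ.+ ((y ℚ.- w) ℚ.+ w)
  regroup = solve 4 (λ x y z w → x := ((x :+ :- (y :+ z)) :+ z) :+ ((y :+ :- w) :+ w)) refl

  neg-difference : ∀ p q → ℚ.- (p ℚ.- q) ≡ q ℚ.- p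
  neg-difference = solve 2 (λ p q → :- (p :+ :- q) := q :+ :- p) refl

  neg-neg : ∀ p → ℚ.- (ℚ.- p) ≡ p
  neg-neg = solve 1 (λ p → :- (:- p) := p) refl

  telescope : ∀ p q r → (p ℚ.- q) ℚ.+ (q ℚ.- r) ≡ p ℚ.- r
  telescope = solve 3 (λ p q r → (p :+ :- q) :+ (q :+ :- r) := p :+ :- r) refl

  difference-interchange : ∀ p q r s → (p ℚ.- q) ℚ.+ (r ℚ.- s) ≡ (p ℚ.+ r) ℚ.- (q ℚ.+ s)
  difference-interchange = solve 4 (λ p q r s → (p :+ :- q) :+ (r :+ :- s) := (p :+ r) :+ :- (q :+ s)) refl

  product-difference : ∀ p q r s → p ℚ.* (r ℚ.- s) ℚ.+ s ℚ.* (p ℚ.- q) ≡ p ℚ.* r ℚ.- q ℚ.* s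
  product-difference = solve 4 (λ p q r s → p :* (r :+ :- s) :+ s :* (p :+ :- q) := p :* r :+ :- (q :* s)) refl

  difference-neg : ∀ p q → ℚ.- (p ℚ.- q) ≡ (ℚ.- p) ℚ.- (ℚ.- q)
  difference-neg = solve 2 (λ p q → :- (p :+ :- q) := (:- p) :+ :- (:- q)) refl

  *-comm-re : ∀ a b c d → a ℚ.* c ℚ.+ (ℚ.- (b ℚ.* d)) ≡ c ℚ.* a ℚ.+ (ℚ.- (d ℚ.* b))
  *-comm-re = solve 4 (λ a b c d → a :* c :+ :- (b :* d) := c :* a :+ :- (d :* b)) refl
  *-comm-im : ∀ a b c d → a ℚ.* d ℚ.+ b ℚ.* c ≡ c ℚ.* b ℚ.+ d ℚ.* a
  *-comm-im = solve 4 (λ a b c d → a :* d :+ b :* c := c :* b :+ d :* a) refl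

  *-assoc-re : ∀ a b c d e f →
    (a ℚ.* c ℚ.+ (ℚ.- (b ℚ.* d))) ℚ.* e ℚ.+ (ℚ.- ((a ℚ.* d ℚ.+ b ℚ.* c) ℚ.* f)) ≡
    a ℚ.* (c ℚ.* e ℚ.+ (ℚ.- (d ℚ.* f))) ℚ.+ (ℚ.- (b ℚ.* (c ℚ.* f ℚ.+ d ℚ.* e)))
  *-assoc-re = solve 6 (λ a b c d e f →
    (a :* c :+ :- (b :* d)) :* e :+ :- ((a :* d :+ b :* c) :* f) :=
    a :* (c :* e :+ :- (d :* f)) :+ :- (b :* (c :* f :+ d :* e))) refl
  *-assoc-im : ∀ a b c d e f →
    (a ℚ.* c ℚ.+ (ℚ.- (b ℚ.* d))) ℚ.* f ℚ.+ (a ℚ.* d ℚ.+ b ℚ.* c) ℚ.* e ≡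
    a ℚ.* (c ℚ.* f ℚ.+ d ℚ.* e) ℚ.+ b ℚ.* (c ℚ.* e ℚ.+ (ℚ.- (d ℚ.* f)))
  *-assoc-im = solve 6 (λ a b c d e f →
    (a :* c :+ :- (b :* d)) :* f :+ (a :* d :+ b :* c) :* e :=
    a :* (c :* f :+ d :* e) :+ b :* (c :* e :+ :- (d :* f))) refl

  *-identity-re : ∀ a b → 1ℚ ℚ.* a ℚ.+ (ℚ.- (0ℚ ℚ.* b)) ≡ a
  *-identity-re = solve 2 (λ a b → con 1ℚ :* a :+ :- (con 0ℚ :* b) := a) refl
  *-identity-im : ∀ a b → 1ℚ ℚ.* b ℚ.+ 0ℚ ℚ.* a ≡ b
  *-identity-im = solve 2 (λ a b → con 1ℚ :* b :+ con 0ℚ :* a := b) refl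

  *-distrib-re : ∀ a b c d e f →
    a ℚ.* (c ℚ.+ e) ℚ.+ (ℚ.- (b ℚ.* (d ℚ.+ f))) ≡
    (a ℚ.* c ℚ.+ (ℚ.- (b ℚ.* d))) ℚ.+ (a ℚ.* e ℚ.+ (ℚ.- (b ℚ.* f)))
  *-distrib-re = solve 6 (λ a b c d e f → a :* (c :+ e) :+ :- (b :* (d :+ f)) :=
    (a :* c :+ :- (b :* d)) :+ (a :* e :+ :- (b :* f))) refl
  *-distrib-im : ∀ a b c d e f →
    a ℚ.* (d ℚ.+ f) ℚ.+ b ℚ.* (c ℚ.+ e) ≡
    (a ℚ.* d ℚ.+ b ℚ.* c) ℚ.+ (a ℚ.* f ℚ.+ b ℚ.* e)
  *-distrib-im = solve 6 (λ a b c d e f → a :* (d :+ f) :+ b :* (c :+ e) :=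
    (a :* d :+ b :* c) :+ (a :* f :+ b :* e)) refl

  -- With `c` the inverse of `a² + b²`, this and the next identity compute the product of `a + bi`
  -- with its inverse `ac - bci`.
  *-inverse-re : ∀ a b c → a ℚ.* (a ℚ.* c) ℚ.+ (ℚ.- (b ℚ.* (ℚ.- (b ℚ.* c)))) ≡ (a ℚ.* a ℚ.+ b ℚ.* b) ℚ.* c
  *-inverse-re = solve 3 (λ a b c → a :* (a :* c) :+ :- (b :* (:- (b :* c))) := (a :* a :+ b :* b) :* c) refl
  *-inverse-im : ∀ a b c → a ℚ.* (ℚ.- (b ℚ.* c)) ℚ.+ b ℚ.* (a ℚ.* c) ≡ 0ℚ
  *-inverse-im = solve 3 (λ a b c → a :* (:- (b :* c)) :+ b :* (a :* c) := con 0ℚ) refl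

  conj-*-re : ∀ a b c d →
    a ℚ.* c ℚ.+ (ℚ.- (b ℚ.* d)) ≡ a ℚ.* c ℚ.+ (ℚ.- ((ℚ.- b) ℚ.* (ℚ.- d)))
  conj-*-re = solve 4 (λ a b c d → a :* c :+ :- (b :* d) := a :* c :+ :- ((:- b) :* (:- d))) refl
  conj-*-im : ∀ a b c d → ℚ.- (a ℚ.* d ℚ.+ b ℚ.* c) ≡ a ℚ.* (ℚ.- d) ℚ.+ (ℚ.- b) ℚ.* c
  conj-*-im = solve 4 (λ a b c d → :- (a :* d :+ b :* c) := a :* (:- d) :+ (:- b) :* c) refl

open ℚ-identities

-- Cauchy sequences of rationals

Null : (ℕ → ℚ) → Set
Null s = ∀ ε → 0ℚ ℚ.< ε → Eventually (λ n → ℚ.∣ s n ∣ ℚ.< ε)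

Bounded : (ℕ → ℚ) → Set
Bounded s = ∃[ K ] 0ℚ ℚ.< K × Eventually (λ n → ℚ.∣ s n ∣ ℚ.≤ K)

Eventually-zip : {P Q R : ℕ → Set} → (∀ {n} → P n → Q n → R n) →
  Eventually P → Eventually Q → Eventually R
Eventually-zip f (M , p) (N , q) = M ℕ.⊔ N , λ n b →
  f (p n (ℕ.m⊔n≤o⇒m≤o M N b)) (q n (ℕ.m⊔n≤o⇒n≤o M N b))

Eventually-map : {P Q : ℕ → Set} → (∀ {n} → P n → Q n) → Eventually P → Eventually Q
Eventually-map f (M , p) = M , λ n b → f (p n b)

opaque
  half-positive : ∀ {ε} → 0ℚ ℚ.< ε → 0ℚ ℚ.< ½ ℚ.* ε
  half-positive {ε} 0<ε =
    subst (ℚ._< ½ ℚ.* ε) (ℚ.*-zeroʳ ½) (ℚ.*-monoʳ-<-pos ½ 0<ε)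

  two-halves : ∀ ε → ½ ℚ.* ε ℚ.+ ½ ℚ.* ε ≡ ε
  two-halves ε = trans (sym (ℚ.*-distribʳ-+ ε ½ ½)) (ℚ.*-identityˡ ε)

  ∣+∣-halves : ∀ {ε} p q → ℚ.∣ p ∣ ℚ.< ½ ℚ.* ε → ℚ.∣ q ∣ ℚ.< ½ ℚ.* ε → ℚ.∣ p ℚ.+ q ∣ ℚ.< ε
  ∣+∣-halves {ε} p q p< q< = begin-strict
    ℚ.∣ p ℚ.+ q ∣
      ≤⟨ ℚ.∣p+q∣≤∣p∣+∣q∣ p q ⟩
    ℚ.∣ p ∣ ℚ.+ ℚ.∣ q ∣
      <⟨ ℚ.+-mono-< p< q< ⟩
    ½ ℚ.* ε ℚ.+ ½ ℚ.* ε
      ≡⟨ two-halves ε ⟩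
    ε ∎
    where open ℚ.≤-Reasoning

  quotient : ∀ K ε → 0ℚ ℚ.< K → 0ℚ ℚ.< ε →
    ∃[ δ ] 0ℚ ℚ.< δ × (∀ p q → ℚ.∣ p ∣ ℚ.≤ K → ℚ.∣ q ∣ ℚ.< δ → ℚ.∣ p ℚ.* q ∣ ℚ.< ε)
  quotient K ε 0<K 0<ε = δ ,
    subst (ℚ._< δ) (ℚ.*-zeroʳ K⁻¹) (ℚ.*-monoʳ-<-pos K⁻¹ {{ℚ.1/pos⇒pos K {{K⁺}}}} 0<ε) ,
    λ p q p≤K q<δ → let open ℚ.≤-Reasoning in begin-strict
      ℚ.∣ p ℚ.* q ∣
        ≡⟨ ℚ.∣p*q∣≡∣p∣*∣q∣ p q ⟩
      ℚ.∣ p ∣ ℚ.* ℚ.∣ q ∣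
        ≤⟨ ℚ.*-monoʳ-≤-nonNeg ℚ.∣ q ∣ {{ℚ.∣-∣-nonNeg q}} p≤K ⟩
      K ℚ.* ℚ.∣ q ∣
        <⟨ ℚ.*-monoʳ-<-pos K {{K⁺}} q<δ ⟩
      K ℚ.* δ
        ≡⟨ sym (ℚ.*-assoc K K⁻¹ ε) ⟩
      K ℚ.* K⁻¹ ℚ.* ε
        ≡⟨ cong (ℚ._* ε) (ℚ.*-inverseʳ K {{K≢0}}) ⟩
      1ℚ ℚ.* ε
        ≡⟨ ℚ.*-identityˡ ε ⟩
      ε ∎
    where
    K⁺ : ℚ.Positive K
    K⁺ = ℚ.positive 0<K
    K≢0 : ℚ.NonZero K
    K≢0 = ℚ.pos⇒nonZero K {{K⁺}}
    K⁻¹ δ : ℚ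
    K⁻¹ = (ℚ.1/ K) {{K≢0}}
    δ = K⁻¹ ℚ.* ε

  null-resp : ∀ {s t} → (∀ n → s n ≡ t n) → Null s → Null t
  null-resp s≡t h ε 0<ε =
    Eventually-map (λ {n} → subst (λ q → ℚ.∣ q ∣ ℚ.< ε) (s≡t n)) (h ε 0<ε)

  null-zero : ∀ {s} → Eventually (λ n → s n ≡ 0ℚ) → Null s
  null-zero h ε 0<ε =
    Eventually-map (λ {n} e → subst (ℚ._< ε) (sym (cong ℚ.∣_∣ e)) 0<ε) h

  null-+ : ∀ {s t} → Null s → Null t → Null (λ n → s n ℚ.+ t n)
  null-+ {s} {t} h k ε 0<ε = Eventually-zip (λ {n} → ∣+∣-halves (s n) (t n))
    (h _ (half-positive 0<ε)) (k _ (half-positive 0<ε))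

  null-neg : ∀ {s} → Null s → Null (λ n → ℚ.- s n)
  null-neg {s} h ε 0<ε =
    Eventually-map (λ {n} → subst (ℚ._< ε) (sym (ℚ.∣-p∣≡∣p∣ (s n)))) (h ε 0<ε)

  null-* : ∀ {s t} → Bounded s → Null t → Null (λ n → s n ℚ.* t n)
  null-* {s} {t} (K , 0<K , s≤K) h ε 0<ε =
    let δ , 0<δ , small = quotient K ε 0<K 0<ε
    in Eventually-zip (λ {n} → small (s n) (t n)) s≤K (h δ 0<δ)

  cauchy⇒bounded : ∀ {s} → IsCauchy s → Bounded s
  cauchy⇒bounded {s} cs with N , h ← cs 1ℚ (ℚ.positive⁻¹ 1ℚ) =
    1ℚ ℚ.+ ℚ.∣ s N ∣ ,
    ℚ.+-mono-<-≤ (ℚ.positive⁻¹ 1ℚ) (ℚ.0≤∣p∣ (s N)) ,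
    N , λ n N≤n → let open ℚ.≤-Reasoning in begin
      ℚ.∣ s n ∣
        ≡⟨ cong ℚ.∣_∣ (p≡p-q+q (s n) (s N)) ⟩
      ℚ.∣ (s n ℚ.- s N) ℚ.+ s N ∣
        ≤⟨ ℚ.∣p+q∣≤∣p∣+∣q∣ (s n ℚ.- s N) (s N) ⟩
      ℚ.∣ s n ℚ.- s N ∣ ℚ.+ ℚ.∣ s N ∣
        ≤⟨ ℚ.+-monoˡ-≤ ℚ.∣ s N ∣ (ℚ.<⇒≤ (h n N N≤n ℕ.≤-refl)) ⟩
      1ℚ ℚ.+ ℚ.∣ s N ∣ ∎

  -- The value 0 at 0 is arbitrary.
  inv : ℚ → ℚ
  inv q with q ℚ.≟ 0ℚ
  ... | yes _  = 0ℚ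
  ... | no q≢0 = (ℚ.1/ q) {{ℚ.≢-nonZero q≢0}}

  inv-inverseʳ : ∀ q → q ≢ 0ℚ → q ℚ.* inv q ≡ 1ℚ
  inv-inverseʳ q q≢0 with q ℚ.≟ 0ℚ
  ... | yes q≡0 = contradiction q≡0 q≢0
  ... | no q≢0  = ℚ.*-inverseʳ q {{ℚ.≢-nonZero q≢0}}

  away⇒≢0 : ∀ {δ q} → 0ℚ ℚ.< δ → δ ℚ.≤ ℚ.∣ q ∣ → q ≢ 0ℚ
  away⇒≢0 0<δ δ≤q refl = ℚ.<-irrefl refl (ℚ.<-≤-trans 0<δ δ≤q)

  -- The bound is `1/δ`: the product of `∣ inv q ∣` with `δ/δ` is at most its product with
  -- `∣ q ∣/δ`, which is `1/δ`.
  inv-bound : ∀ {δ} → 0ℚ ℚ.< δ → ∃[ K ] 0ℚ ℚ.< K × (∀ q → δ ℚ.≤ ℚ.∣ q ∣ → ℚ.∣ inv q ∣ ℚ.≤ K)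
  inv-bound {δ} 0<δ = K , ℚ.positive⁻¹ K {{K⁺}} , λ q δ≤q →
    let open ℚ.≤-Reasoning in begin
      ℚ.∣ inv q ∣
        ≡⟨ sym (ℚ.*-identityʳ _) ⟩
      ℚ.∣ inv q ∣ ℚ.* 1ℚ
        ≡⟨ cong (ℚ.∣ inv q ∣ ℚ.*_) (sym (ℚ.*-inverseʳ δ {{δ≢0}})) ⟩
      ℚ.∣ inv q ∣ ℚ.* (δ ℚ.* K)
        ≤⟨ ℚ.*-monoˡ-≤-nonNeg ℚ.∣ inv q ∣ {{ℚ.∣-∣-nonNeg (inv q)}}
           (ℚ.*-monoʳ-≤-nonNeg K {{ℚ.pos⇒nonNeg K {{K⁺}}}} δ≤q) ⟩
      ℚ.∣ inv q ∣ ℚ.* (ℚ.∣ q ∣ ℚ.* K)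
        ≡⟨ p*[q*r]≡[q*p]*r ℚ.∣ inv q ∣ ℚ.∣ q ∣ K ⟩
      (ℚ.∣ q ∣ ℚ.* ℚ.∣ inv q ∣) ℚ.* K
        ≡⟨ cong (ℚ._* K) (sym (ℚ.∣p*q∣≡∣p∣*∣q∣ q (inv q))) ⟩
      ℚ.∣ q ℚ.* inv q ∣ ℚ.* K
        ≡⟨ cong (λ p → ℚ.∣ p ∣ ℚ.* K) (inv-inverseʳ q (away⇒≢0 0<δ δ≤q)) ⟩
      1ℚ ℚ.* K
        ≡⟨ ℚ.*-identityˡ K ⟩
      K ∎
    where
    δ⁺ : ℚ.Positive δ
    δ⁺ = ℚ.positive 0<δ
    δ≢0 : ℚ.NonZero δ
    δ≢0 = ℚ.pos⇒nonZero δ {{δ⁺}}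
    K : ℚ
    K = (ℚ.1/ δ) {{δ≢0}}
    K⁺ : ℚ.Positive K
    K⁺ = ℚ.1/pos⇒pos δ {{δ⁺}}

  inv-difference : ∀ p q → p ≢ 0ℚ → q ≢ 0ℚ → inv p ℚ.- inv q ≡ inv p ℚ.* (inv q ℚ.* (q ℚ.- p))
  inv-difference p q p≢0 q≢0 = sym (trans (inverse-expansion p q (inv p) (inv q))
    (trans (cong₂ (λ u v → inv p ℚ.* u ℚ.- inv q ℚ.* v) (inv-inverseʳ q q≢0) (inv-inverseʳ p p≢0))
      (cong₂ ℚ._-_ (ℚ.*-identityʳ (inv p)) (ℚ.*-identityʳ (inv q)))))

  inv-cauchy : ∀ {s δ} → IsCauchy s → 0ℚ ℚ.< δ → Eventually (λ n → δ ℚ.≤ ℚ.∣ s n ∣) →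
    IsCauchy (λ n → inv (s n))
  inv-cauchy {s} {δ} cs 0<δ (M , away) ε 0<ε =
    let K , 0<K , inv≤K = inv-bound 0<δ
        -- `inv-difference` has two bounded factors, `inv p` and `inv q`; the tolerance is divided
        -- by the bound `K` once for each.
        ε₁ , 0<ε₁ , small₁ = quotient K ε 0<K 0<ε
        ε₂ , 0<ε₂ , small₂ = quotient K ε₁ 0<K 0<ε₁
        N , close = cs ε₂ 0<ε₂
    in M ℕ.⊔ N , λ m n b≤m b≤n →
      let am = away m (ℕ.m⊔n≤o⇒m≤o M N b≤m)
          an = away n (ℕ.m⊔n≤o⇒m≤o M N b≤n)
      in subst (λ q → ℚ.∣ q ∣ ℚ.< ε) (sym (inv-difference (s m) (s n) (away⇒≢0 0<δ am) (away⇒≢0 0<δ an)))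
        (small₁ _ _ (inv≤K (s m) am) (small₂ _ _ (inv≤K (s n) an)
          (close n m (ℕ.m⊔n≤o⇒n≤o M N b≤n) (ℕ.m⊔n≤o⇒n≤o M N b≤m))))

  ∣p∣*∣p∣≡p*p : ∀ p → ℚ.∣ p ∣ ℚ.* ℚ.∣ p ∣ ≡ p ℚ.* p
  ∣p∣*∣p∣≡p*p p with ℚ.∣p∣≡p∨∣p∣≡-p p
  ... | inj₁ e = cong₂ ℚ._*_ e e
  ... | inj₂ e = trans (cong₂ ℚ._*_ e e) (neg*neg p)

  0≤p*p : ∀ p → 0ℚ ℚ.≤ p ℚ.* p
  0≤p*p p = subst (0ℚ ℚ.≤_) (trans (ℚ.∣p*q∣≡∣p∣*∣q∣ p p) (∣p∣*∣p∣≡p*p p)) (ℚ.0≤∣p∣ (p ℚ.* p))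

  0<δ*δ : ∀ {δ} → 0ℚ ℚ.< δ → 0ℚ ℚ.< δ ℚ.* δ
  0<δ*δ {δ} 0<δ = subst (ℚ._< δ ℚ.* δ) (ℚ.*-zeroʳ δ) (ℚ.*-monoʳ-<-pos δ {{ℚ.positive 0<δ}} 0<δ)

  square-away : ∀ {δ} p q → 0ℚ ℚ.< δ → δ ℚ.≤ ℚ.∣ p ∣ → δ ℚ.* δ ℚ.≤ ℚ.∣ p ℚ.* p ℚ.+ q ℚ.* q ∣
  square-away {δ} p q 0<δ δ≤p = begin
    δ ℚ.* δ
      ≤⟨ ℚ.*-monoˡ-≤-nonNeg δ {{δ⁺}} δ≤p ⟩
    δ ℚ.* ℚ.∣ p ∣
      ≤⟨ ℚ.*-monoʳ-≤-nonNeg ℚ.∣ p ∣ {{ℚ.∣-∣-nonNeg p}} δ≤p ⟩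
    ℚ.∣ p ∣ ℚ.* ℚ.∣ p ∣
      ≡⟨ ∣p∣*∣p∣≡p*p p ⟩
    p ℚ.* p
      ≡⟨ sym (ℚ.+-identityʳ (p ℚ.* p)) ⟩
    p ℚ.* p ℚ.+ 0ℚ
      ≤⟨ ℚ.+-monoʳ-≤ (p ℚ.* p) (0≤p*p q) ⟩
    p ℚ.* p ℚ.+ q ℚ.* q
      ≡⟨ sym (ℚ.0≤p⇒∣p∣≡p (ℚ.+-mono-≤ (0≤p*p p) (0≤p*p q))) ⟩
    ℚ.∣ p ℚ.* p ℚ.+ q ℚ.* q ∣ ∎
    where
    open ℚ.≤-Reasoning
    δ⁺ : ℚ.NonNegative δ
    δ⁺ = ℚ.pos⇒nonNeg δ {{ℚ.positive 0<δ}}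

  half-smaller : ∀ {ε} → 0ℚ ℚ.< ε → ½ ℚ.* ε ℚ.< ε
  half-smaller {ε} 0<ε = subst (½ ℚ.* ε ℚ.<_) (two-halves ε)
    (subst (ℚ._< ½ ℚ.* ε ℚ.+ ½ ℚ.* ε) (ℚ.+-identityʳ (½ ℚ.* ε))
      (ℚ.+-monoʳ-< (½ ℚ.* ε) (half-positive 0<ε)))

Away : (ℕ → ℚ) → Set
Away s = ∃[ δ ] 0ℚ ℚ.< δ × Eventually (λ n → δ ℚ.≤ ℚ.∣ s n ∣)

opaque
  -- The value of y at a sufficiently late index decides which of y and z stays
  -- away from 0.
  away-split : ∀ x y z → IsCauchy y → Away x → Null (λ n → x n ℚ.- (y n ℚ.+ z n)) →
    Away y ⊎ Away z
  away-split x y z cy (ε , 0<ε , N₁ , away) null = decide (ℚ.∣ y M ∣ ℚ.<? q)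
    where
    -- These are ε/2, ε/4 and ε/8. Four errors below ε/4 add up to less than ε, against the bound on
    -- `x`; two below ε/8 add up to less than ε/4, the threshold for `y M`.
    h q r : ℚ
    h = ½ ℚ.* ε
    q = ½ ℚ.* h
    r = ½ ℚ.* q
    0<q : 0ℚ ℚ.< q
    0<q = half-positive (half-positive 0<ε)
    0<r : 0ℚ ℚ.< r
    0<r = half-positive 0<q
    N₂ N₃ M : ℕ
    N₂ = proj₁ (null q 0<q)
    N₃ = proj₁ (cy r 0<r)
    M = N₁ ℕ.⊔ (N₂ ℕ.⊔ N₃)
    N₁≤M : N₁ ℕ.≤ M
    N₁≤M = ℕ.m≤m⊔n N₁ (N₂ ℕ.⊔ N₃)
    N₂≤M : N₂ ℕ.≤ M
    N₂≤M = ℕ.≤-trans (ℕ.m≤m⊔n N₂ N₃) (ℕ.m≤n⊔m N₁ (N₂ ℕ.⊔ N₃))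
    N₃≤M : N₃ ℕ.≤ M
    N₃≤M = ℕ.≤-trans (ℕ.m≤n⊔m N₂ N₃) (ℕ.m≤n⊔m N₁ (N₂ ℕ.⊔ N₃))
    close : ∀ n → M ℕ.≤ n → ℚ.∣ x n ℚ.- (y n ℚ.+ z n) ∣ ℚ.< q
    close n M≤n = proj₂ (null q 0<q) n (ℕ.≤-trans N₂≤M M≤n)
    near : ∀ m n → M ℕ.≤ m → M ℕ.≤ n → ℚ.∣ y m ℚ.- y n ∣ ℚ.< r
    near m n M≤m M≤n = proj₂ (cy r 0<r) m n (ℕ.≤-trans N₃≤M M≤m) (ℕ.≤-trans N₃≤M M≤n)
    decide : Dec (ℚ.∣ y M ∣ ℚ.< q) → Away y ⊎ Away z
    decide (yes yM<q) = inj₂ (q , 0<q , M , λ n M≤n → ℚ.≮⇒≥ λ zn<q →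
      ℚ.<-irrefl refl (ℚ.≤-<-trans (away n (ℕ.≤-trans N₁≤M M≤n))
        (subst (λ t → ℚ.∣ t ∣ ℚ.< ε) (sym (regroup (x n) (y n) (z n) (y M)))
          (∣+∣-halves ((x n ℚ.- (y n ℚ.+ z n)) ℚ.+ z n) ((y n ℚ.- y M) ℚ.+ y M)
            (∣+∣-halves (x n ℚ.- (y n ℚ.+ z n)) (z n) (close n M≤n) zn<q)
            (∣+∣-halves (y n ℚ.- y M) (y M)
              (ℚ.<-trans (near n M M≤n ℕ.≤-refl) (half-smaller 0<q)) yM<q)))))
    decide (no yM≮q) = inj₁ (r , 0<r , M , λ n M≤n → ℚ.≮⇒≥ λ yn<r →
      yM≮q (subst (λ t → ℚ.∣ t ∣ ℚ.< q) (sym (p≡p-q+q (y M) (y n)))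
        (∣+∣-halves (y M ℚ.- y n) (y n) (near M n ℕ.≤-refl M≤n) yn<r)))

-- The field of complex numbers

opaque
  unfolding _≈ʳ_

  ≈ʳ⇒null : ∀ x y → x ≈ʳ y → Null (λ n → seq x n ℚ.- seq y n)
  ≈ʳ⇒null x y h = h

  null⇒≈ʳ : ∀ x y → Null (λ n → seq x n ℚ.- seq y n) → x ≈ʳ y
  null⇒≈ʳ x y h = h

-- Needed for inverses: the terms of `z` times its inverse equal 1 only from some index on.
eventually⇒≈ʳ : ∀ x y → Eventually (λ n → seq x n ≡ seq y n) → x ≈ʳ y
eventually⇒≈ʳ x y h = null⇒≈ʳ x y (null-zero {λ n → seq x n ℚ.- seq y n} (Eventually-map (λ {n} e →
  trans (cong (ℚ._- seq y n) e) (ℚ.+-inverseʳ (seq y n))) h))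

pointwise⇒≈ʳ : ∀ x y → (∀ n → seq x n ≡ seq y n) → x ≈ʳ y
pointwise⇒≈ʳ x y h = eventually⇒≈ʳ x y (0 , λ n _ → h n)

≈ʳ-sym : ∀ {x y} → x ≈ʳ y → y ≈ʳ x
≈ʳ-sym {x} {y} h = null⇒≈ʳ y x (null-resp {λ n → ℚ.- (seq x n ℚ.- seq y n)}
    (λ n → neg-difference (seq x n) (seq y n)) (null-neg {λ n → seq x n ℚ.- seq y n} (≈ʳ⇒null x y h)))

≈ʳ-trans : ∀ {x y z} → x ≈ʳ y → y ≈ʳ z → x ≈ʳ z
≈ʳ-trans {x} {y} {z} h k = null⇒≈ʳ x z
    (null-resp {λ n → (seq x n ℚ.- seq y n) ℚ.+ (seq y n ℚ.- seq z n)}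
      (λ n → telescope (seq x n) (seq y n) (seq z n))
      (null-+ {λ n → seq x n ℚ.- seq y n} {λ n → seq y n ℚ.- seq z n} (≈ʳ⇒null x y h) (≈ʳ⇒null y z k)))

opaque
  unfolding _+ʳ_

  +ʳ-cong : ∀ {x y u v} → x ≈ʳ y → u ≈ʳ v → x +ʳ u ≈ʳ y +ʳ v
  +ʳ-cong {x} {y} {u} {v} h k = null⇒≈ʳ (x +ʳ u) (y +ʳ v)
      (null-resp {λ n → (seq x n ℚ.- seq y n) ℚ.+ (seq u n ℚ.- seq v n)}
        (λ n → difference-interchange (seq x n) (seq y n) (seq u n) (seq v n))
        (null-+ {λ n → seq x n ℚ.- seq y n} {λ n → seq u n ℚ.- seq v n} (≈ʳ⇒null x y h) (≈ʳ⇒null u v k)))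

  *ʳ-cong : ∀ {x y u v} → x ≈ʳ y → u ≈ʳ v → x *ʳ u ≈ʳ y *ʳ v
  *ʳ-cong {x} {y} {u} {v} h k = null⇒≈ʳ (x *ʳ u) (y *ʳ v)
      (null-resp {λ n → seq x n ℚ.* (seq u n ℚ.- seq v n) ℚ.+ seq v n ℚ.* (seq x n ℚ.- seq y n)}
        (λ n → product-difference (seq x n) (seq y n) (seq u n) (seq v n))
        (null-+ {λ n → seq x n ℚ.* (seq u n ℚ.- seq v n)} {λ n → seq v n ℚ.* (seq x n ℚ.- seq y n)}
          (null-* {seq x} {λ n → seq u n ℚ.- seq v n} (cauchy⇒bounded (cauchy x)) (≈ʳ⇒null u v k))
          (null-* {seq v} {λ n → seq x n ℚ.- seq y n} (cauchy⇒bounded (cauchy v)) (≈ʳ⇒null x y h))))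

  -ʳ-cong : ∀ {x y} → x ≈ʳ y → -ʳ x ≈ʳ -ʳ y
  -ʳ-cong {x} {y} h = null⇒≈ʳ (-ʳ x) (-ʳ y)
      (null-resp {λ n → ℚ.- (seq x n ℚ.- seq y n)} (λ n → difference-neg (seq x n) (seq y n))
        (null-neg {λ n → seq x n ℚ.- seq y n} (≈ʳ⇒null x y h)))

opaque
  unfolding _≈ᶜ_ _+ʳ_

  ≈ᶜ-refl : ∀ {z} → z ≈ᶜ z
  ≈ᶜ-refl {z} = pointwise⇒≈ʳ (re z) (re z) (λ _ → refl) , pointwise⇒≈ʳ (im z) (im z) (λ _ → refl)

  ≈ᶜ-sym : ∀ {z w} → z ≈ᶜ w → w ≈ᶜ z
  ≈ᶜ-sym (h , k) = ≈ʳ-sym h , ≈ʳ-sym k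

  ≈ᶜ-trans : ∀ {z w u} → z ≈ᶜ w → w ≈ᶜ u → z ≈ᶜ u
  ≈ᶜ-trans (h , k) (h′ , k′) = ≈ʳ-trans h h′ , ≈ʳ-trans k k′

  +ᶜ-cong : ∀ {x y u v} → x ≈ᶜ y → u ≈ᶜ v → x +ᶜ u ≈ᶜ y +ᶜ v
  +ᶜ-cong (h , k) (h′ , k′) = +ʳ-cong h h′ , +ʳ-cong k k′

  *ᶜ-cong : ∀ {x y u v} → x ≈ᶜ y → u ≈ᶜ v → x *ᶜ u ≈ᶜ y *ᶜ v
  *ᶜ-cong (h , k) (h′ , k′) =
    +ʳ-cong (*ʳ-cong h h′) (-ʳ-cong (*ʳ-cong k k′)) , +ʳ-cong (*ʳ-cong h k′) (*ʳ-cong k h′)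

  -ᶜ-cong : ∀ {x y} → x ≈ᶜ y → -ᶜ x ≈ᶜ -ᶜ y
  -ᶜ-cong (h , k) = -ʳ-cong h , -ʳ-cong k

  conj-cong : ∀ {x y} → x ≈ᶜ y → conj x ≈ᶜ conj y
  conj-cong (h , k) = h , -ʳ-cong k

  private
    -- The operations act term by term on the sequences, so each ring law is inherited from the
    -- rationals in the same way.
    pointwise : ∀ z w → (∀ n → seq (re z) n ≡ seq (re w) n) →
      (∀ n → seq (im z) n ≡ seq (im w) n) → z ≈ᶜ w
    pointwise z w h k = pointwise⇒≈ʳ (re z) (re w) h , pointwise⇒≈ʳ (im z) (im w) k

  +ᶜ-assoc : ∀ x y z → (x +ᶜ y) +ᶜ z ≈ᶜ x +ᶜ (y +ᶜ z)
  +ᶜ-assoc x y z = pointwise ((x +ᶜ y) +ᶜ z) (x +ᶜ (y +ᶜ z)) (λ n → ℚ.+-assoc (seq (re x) n) (seq (re y) n) (seq (re z) n))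
    (λ n → ℚ.+-assoc (seq (im x) n) (seq (im y) n) (seq (im z) n))

  +ᶜ-comm : ∀ x y → x +ᶜ y ≈ᶜ y +ᶜ x
  +ᶜ-comm x y = pointwise (x +ᶜ y) (y +ᶜ x) (λ n → ℚ.+-comm (seq (re x) n) (seq (re y) n)) (λ n → ℚ.+-comm (seq (im x) n) (seq (im y) n))

  +ᶜ-identityˡ : ∀ x → 0ᶜ +ᶜ x ≈ᶜ x
  +ᶜ-identityˡ x = pointwise (0ᶜ +ᶜ x) (x) (λ n → ℚ.+-identityˡ (seq (re x) n)) (λ n → ℚ.+-identityˡ (seq (im x) n))

  -ᶜ-inverseˡ : ∀ x → -ᶜ x +ᶜ x ≈ᶜ 0ᶜ
  -ᶜ-inverseˡ x = pointwise (-ᶜ x +ᶜ x) (0ᶜ) (λ n → ℚ.+-inverseˡ (seq (re x) n)) (λ n → ℚ.+-inverseˡ (seq (im x) n))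

  *ᶜ-comm : ∀ x y → x *ᶜ y ≈ᶜ y *ᶜ x
  *ᶜ-comm x y = pointwise (x *ᶜ y) (y *ᶜ x)
    (λ n → *-comm-re (seq (re x) n) (seq (im x) n) (seq (re y) n) (seq (im y) n))
    (λ n → *-comm-im (seq (re x) n) (seq (im x) n) (seq (re y) n) (seq (im y) n))

  *ᶜ-assoc : ∀ x y z → (x *ᶜ y) *ᶜ z ≈ᶜ x *ᶜ (y *ᶜ z)
  *ᶜ-assoc x y z = pointwise ((x *ᶜ y) *ᶜ z) (x *ᶜ (y *ᶜ z))
    (λ n → *-assoc-re (seq (re x) n) (seq (im x) n) (seq (re y) n) (seq (im y) n) (seq (re z) n) (seq (im z) n))
    (λ n → *-assoc-im (seq (re x) n) (seq (im x) n) (seq (re y) n) (seq (im y) n) (seq (re z) n) (seq (im z) n))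

  *ᶜ-identityˡ : ∀ x → 1ᶜ *ᶜ x ≈ᶜ x
  *ᶜ-identityˡ x = pointwise (1ᶜ *ᶜ x) (x)
    (λ n → *-identity-re (seq (re x) n) (seq (im x) n)) (λ n → *-identity-im (seq (re x) n) (seq (im x) n))

  *ᶜ-distribˡ-+ᶜ : ∀ x y z → x *ᶜ (y +ᶜ z) ≈ᶜ x *ᶜ y +ᶜ x *ᶜ z
  *ᶜ-distribˡ-+ᶜ x y z = pointwise (x *ᶜ (y +ᶜ z)) (x *ᶜ y +ᶜ x *ᶜ z)
    (λ n → *-distrib-re (seq (re x) n) (seq (im x) n) (seq (re y) n) (seq (im y) n) (seq (re z) n) (seq (im z) n))
    (λ n → *-distrib-im (seq (re x) n) (seq (im x) n) (seq (re y) n) (seq (im y) n) (seq (re z) n) (seq (im z) n))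

opaque
  unfolding _≈ᶜ_ _+ʳ_

  conj-+ : ∀ x y → conj (x +ᶜ y) ≈ᶜ conj x +ᶜ conj y
  conj-+ x y =
    pointwise⇒≈ʳ (re (conj (x +ᶜ y))) (re (conj x +ᶜ conj y)) (λ _ → refl) ,
    pointwise⇒≈ʳ (im (conj (x +ᶜ y))) (im (conj x +ᶜ conj y))
      (λ n → ℚ.neg-distrib-+ (seq (im x) n) (seq (im y) n))

  conj-* : ∀ x y → conj (x *ᶜ y) ≈ᶜ conj x *ᶜ conj y
  conj-* x y =
    pointwise⇒≈ʳ (re (conj (x *ᶜ y))) (re (conj x *ᶜ conj y))
      (λ n → conj-*-re (seq (re x) n) (seq (im x) n) (seq (re y) n) (seq (im y) n)) ,
    pointwise⇒≈ʳ (im (conj (x *ᶜ y))) (im (conj x *ᶜ conj y))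
      (λ n → conj-*-im (seq (re x) n) (seq (im x) n) (seq (re y) n) (seq (im y) n))

ℂ-commutativeRing : CommutativeRing 0ℓ 0ℓ
ℂ-commutativeRing = record
  { Carrier = ℂ ; _≈_ = _≈ᶜ_ ; _+_ = _+ᶜ_ ; _*_ = _*ᶜ_ ; -_ = -ᶜ_ ; 0# = 0ᶜ ; 1# = 1ᶜ
  ; isCommutativeRing = record
    { isRing = record
      { +-isAbelianGroup = record
        { isGroup = record
          { isMonoid = record
            { isSemigroup = record
              { isMagma = record
                { isEquivalence = record { refl = ≈ᶜ-refl ; sym = ≈ᶜ-sym ; trans = ≈ᶜ-trans }
                ; ∙-cong = +ᶜ-cong }
              ; assoc = +ᶜ-assoc }
            ; identity = comm∧idˡ⇒id +ᶜ-comm +ᶜ-identityˡ }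
          ; inverse = comm∧invˡ⇒inv +ᶜ-comm -ᶜ-inverseˡ
          ; ⁻¹-cong = -ᶜ-cong }
        ; comm = +ᶜ-comm }
      ; *-cong = *ᶜ-cong
      ; *-assoc = *ᶜ-assoc
      ; *-identity = comm∧idˡ⇒id *ᶜ-comm *ᶜ-identityˡ
      ; distrib = comm∧distrˡ⇒distr +ᶜ-cong *ᶜ-comm *ᶜ-distribˡ-+ᶜ }
    ; *-comm = *ᶜ-comm } }
  where
  ℂ-setoid : Setoid 0ℓ 0ℓ
  ℂ-setoid = record { Carrier = ℂ ; _≈_ = _≈ᶜ_
    ; isEquivalence = record { refl = ≈ᶜ-refl ; sym = ≈ᶜ-sym ; trans = ≈ᶜ-trans } }
  open import Algebra.Consequences.Setoid ℂ-setoid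

opaque
  unfolding _≈ᶜ_ _#ʳ_ _+ʳ_

  -- Takes the place of deciding whether a number vanishes: witnesses of being nonzero are extracted
  -- from finite sums by repeated use of it.
  #ᶜ-split : ∀ {x y z} → x #ᶜ 0ᶜ → x ≈ᶜ y +ᶜ z → y #ᶜ 0ᶜ ⊎ z #ᶜ 0ᶜ
  #ᶜ-split {x} {y} {z} x#0 (x≈re , x≈im) = case x#0 of λ where
      (inj₁ away) → Sum.map inj₁ inj₁ (split (re x) (re y) (re z) away x≈re)
      (inj₂ away) → Sum.map inj₂ inj₂ (split (im x) (im y) (im z) away x≈im)
    where
    p-0 : ∀ {x} → Away (λ n → x n ℚ.- 0ℚ) → Away x
    p-0 {x} (δ , 0<δ , h) = δ , 0<δ ,
      Eventually-map (λ {n} → subst (λ p → δ ℚ.≤ ℚ.∣ p ∣) (ℚ.+-identityʳ (x n))) h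
    0-p : ∀ {x} → Away x → Away (λ n → x n ℚ.- 0ℚ)
    0-p {x} (δ , 0<δ , h) = δ , 0<δ ,
      Eventually-map (λ {n} → subst (λ p → δ ℚ.≤ ℚ.∣ p ∣) (sym (ℚ.+-identityʳ (x n)))) h
    split : ∀ a b c → Away (λ n → seq a n ℚ.- 0ℚ) → a ≈ʳ b +ʳ c →
      b #ʳ fromℚ 0ℚ ⊎ c #ʳ fromℚ 0ℚ
    split a b c away a≈ = Sum.map (0-p {seq b}) (0-p {seq c})
      (away-split (seq a) (seq b) (seq c) (cauchy b) (p-0 {seq a} away) (≈ʳ⇒null a (b +ʳ c) a≈))

  -- The inverse is the conjugate divided by the squared absolute value. If either coordinate stays
  -- `ε` away from 0, the squared absolute value stays `ε²` away.
  #ᶜ⇒invertible : ∀ {z} → z #ᶜ 0ᶜ → ∃[ w ] z *ᶜ w ≈ᶜ 1ᶜ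
  #ᶜ⇒invertible {z} z#0 = w ,
      eventually⇒≈ʳ (re (z *ᶜ w)) (re 1ᶜ) (Eventually-map (λ {n} δ≤ → trans
        (*-inverse-re (seq (re z) n) (seq (im z) n) (inv (norm n))) (inv-inverseʳ (norm n) (away⇒≢0 0<δ δ≤))) away) ,
      pointwise⇒≈ʳ (im (z *ᶜ w)) (im 1ᶜ) (λ n → *-inverse-im (seq (re z) n) (seq (im z) n) (inv (norm n)))
    where
    norm : ℕ → ℚ
    norm n = seq (re z) n ℚ.* seq (re z) n ℚ.+ seq (im z) n ℚ.* seq (im z) n
    norm-away : ∃[ δ ] 0ℚ ℚ.< δ × Eventually (λ n → δ ℚ.≤ ℚ.∣ norm n ∣)
    norm-away = case z#0 of λ where
      (inj₁ (ε , 0<ε , h)) → ε ℚ.* ε , 0<δ*δ 0<ε , Eventually-map (λ {n} ε≤ →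
        square-away (seq (re z) n) (seq (im z) n) 0<ε
          (subst (λ p → ε ℚ.≤ ℚ.∣ p ∣) (ℚ.+-identityʳ _) ε≤)) h
      (inj₂ (ε , 0<ε , h)) → ε ℚ.* ε , 0<δ*δ 0<ε , Eventually-map (λ {n} ε≤ →
        subst (λ q → ε ℚ.* ε ℚ.≤ ℚ.∣ q ∣) (ℚ.+-comm (seq (im z) n ℚ.* seq (im z) n) _)
          (square-away (seq (im z) n) (seq (re z) n) 0<ε
            (subst (λ p → ε ℚ.≤ ℚ.∣ p ∣) (ℚ.+-identityʳ _) ε≤))) h
    δ : ℚ
    δ = proj₁ norm-away
    0<δ : 0ℚ ℚ.< δ
    0<δ = proj₁ (proj₂ norm-away)
    away : Eventually (λ n → δ ℚ.≤ ℚ.∣ norm n ∣)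
    away = proj₂ (proj₂ norm-away)
    r : ℝ
    r = mkℝ (λ n → inv (norm n))
      (inv-cauchy {norm} (cauchy (re z *ʳ re z +ʳ im z *ʳ im z)) 0<δ away)
    w : ℂ
    w = (re z *ʳ r) +i (-ʳ (im z *ʳ r))

  1≉0 : ¬ 1ᶜ ≈ᶜ 0ᶜ
  1≉0 (h , _) with N , k ← ≈ʳ⇒null (re 1ᶜ) (re 0ᶜ) h 1ℚ (ℚ.positive⁻¹ 1ℚ) = ℚ.<-irrefl refl (k N ℕ.≤-refl)

-- The embedding of the integers

-- The comparison takes place among unnormalised fractions, where denominators equal to 1 leave only
-- factors 1 to remove.
/1-+ : ∀ i j → (i ℤ.+ j) ℚ./ 1 ≡ i ℚ./ 1 ℚ.+ j ℚ./ 1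
/1-+ i j = ℚ.toℚᵘ-injective (begin
  ℚ.toℚᵘ ((i ℤ.+ j) ℚ./ 1)
    ≈⟨ ℚ.toℚᵘ-fromℚᵘ (ℚᵘ.mkℚᵘ (i ℤ.+ j) 0) ⟩
  ℚᵘ.mkℚᵘ (i ℤ.+ j) 0
    ≡⟨ cong (λ k → ℚᵘ.mkℚᵘ k 0) (sym (cong₂ ℤ._+_ (ℤ.*-identityʳ i) (ℤ.*-identityʳ j))) ⟩
  ℚᵘ.mkℚᵘ i 0 ℚᵘ.+ ℚᵘ.mkℚᵘ j 0
    ≈⟨ ℚᵘ.≃-sym (ℚᵘ.+-cong (ℚ.toℚᵘ-fromℚᵘ (ℚᵘ.mkℚᵘ i 0)) (ℚ.toℚᵘ-fromℚᵘ (ℚᵘ.mkℚᵘ j 0))) ⟩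
  ℚ.toℚᵘ (i ℚ./ 1) ℚᵘ.+ ℚ.toℚᵘ (j ℚ./ 1)
    ≈⟨ ℚᵘ.≃-sym (ℚ.toℚᵘ-homo-+ (i ℚ./ 1) (j ℚ./ 1)) ⟩
  ℚ.toℚᵘ (i ℚ./ 1 ℚ.+ j ℚ./ 1) ∎)
  where open ℚᵘ.≃-Reasoning

/1-* : ∀ i j → (i ℤ.* j) ℚ./ 1 ≡ (i ℚ./ 1) ℚ.* (j ℚ./ 1)
/1-* i j = ℚ.toℚᵘ-injective (begin
  ℚ.toℚᵘ ((i ℤ.* j) ℚ./ 1)
    ≈⟨ ℚ.toℚᵘ-fromℚᵘ (ℚᵘ.mkℚᵘ (i ℤ.* j) 0) ⟩
  ℚᵘ.mkℚᵘ i 0 ℚᵘ.* ℚᵘ.mkℚᵘ j 0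
    ≈⟨ ℚᵘ.≃-sym (ℚᵘ.*-cong (ℚ.toℚᵘ-fromℚᵘ (ℚᵘ.mkℚᵘ i 0)) (ℚ.toℚᵘ-fromℚᵘ (ℚᵘ.mkℚᵘ j 0))) ⟩
  ℚ.toℚᵘ (i ℚ./ 1) ℚᵘ.* ℚ.toℚᵘ (j ℚ./ 1)
    ≈⟨ ℚᵘ.≃-sym (ℚ.toℚᵘ-homo-* (i ℚ./ 1) (j ℚ./ 1)) ⟩
  ℚ.toℚᵘ ((i ℚ./ 1) ℚ.* (j ℚ./ 1)) ∎)
  where open ℚᵘ.≃-Reasoning

/1-neg : ∀ i → (ℤ.- i) ℚ./ 1 ≡ ℚ.- (i ℚ./ 1)
/1-neg ℤ.+0       = refl
/1-neg ℤ.+[1+ _ ] = refl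
/1-neg ℤ.-[1+ n ] = sym (neg-neg (ℤ.+[1+ n ] ℚ./ 1))

/1-injective : ∀ i → i ℚ./ 1 ≡ 0ℚ → i ≡ ℤ.0ℤ
/1-injective i e with ℚᵘ.*≡* h ← ℚᵘ.≃-trans (ℚᵘ.≃-sym (ℚ.toℚᵘ-fromℚᵘ (ℚᵘ.mkℚᵘ i 0))) (ℚ.toℚᵘ-cong e) =
  trans (sym (ℤ.*-identityʳ i)) h

opaque
  unfolding _≈ᶜ_ _#ʳ_ _+ʳ_

  fromℤ-+ : ∀ i j → fromℤ (i ℤ.+ j) ≈ᶜ fromℤ i +ᶜ fromℤ j
  fromℤ-+ i j = pointwise⇒≈ʳ (re (fromℤ (i ℤ.+ j))) (re (fromℤ i +ᶜ fromℤ j)) (λ _ → /1-+ i j) ,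
    pointwise⇒≈ʳ (im (fromℤ (i ℤ.+ j))) (im (fromℤ i +ᶜ fromℤ j)) (λ _ → refl)

  fromℤ-* : ∀ i j → fromℤ (i ℤ.* j) ≈ᶜ fromℤ i *ᶜ fromℤ j
  fromℤ-* i j =
    pointwise⇒≈ʳ (re (fromℤ (i ℤ.* j))) (re (fromℤ i *ᶜ fromℤ j)) (λ _ → trans (/1-* i j) (sym (ℚ.+-identityʳ _))) ,
    pointwise⇒≈ʳ (im (fromℤ (i ℤ.* j))) (im (fromℤ i *ᶜ fromℤ j)) (λ _ → sym (cong₂ ℚ._+_ (ℚ.*-zeroʳ (i ℚ./ 1)) (ℚ.*-zeroˡ (j ℚ./ 1))))

  fromℤ-neg : ∀ i → fromℤ (ℤ.- i) ≈ᶜ -ᶜ fromℤ i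
  fromℤ-neg i = pointwise⇒≈ʳ (re (fromℤ (ℤ.- i))) (re (-ᶜ fromℤ i)) (λ _ → /1-neg i) ,
    pointwise⇒≈ʳ (im (fromℤ (ℤ.- i))) (im (-ᶜ fromℤ i)) (λ _ → refl)

  conj-fromℤ : ∀ i → conj (fromℤ i) ≈ᶜ fromℤ i
  conj-fromℤ i = pointwise⇒≈ʳ (re (fromℤ i)) (re (fromℤ i)) (λ _ → refl) ,
    pointwise⇒≈ʳ (im (conj (fromℤ i))) (im (fromℤ i)) (λ _ → refl)

  fromℤ-#0 : ∀ {i} → i ≢ ℤ.0ℤ → fromℤ i #ᶜ 0ᶜ
  fromℤ-#0 {i} i≢0 = inj₁ (ℚ.∣ i ℚ./ 1 ∣ ,
    ℚ.≰⇒> (λ ≤0 → i≢0 (/1-injective i (ℚ.∣p∣≡0⇒p≡0 (i ℚ./ 1) (ℚ.≤-antisym ≤0 (ℚ.0≤∣p∣ (i ℚ./ 1)))))) ,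
    0 , λ _ _ → ℚ.≤-reflexive (cong ℚ.∣_∣ (sym (ℚ.+-identityʳ (i ℚ./ 1)))))

module R = CommutativeRing ℂ-commutativeRing
open SemiringSum R.semiring
  using (sum-cong-≋; sum-replicate-zero)
  renaming (∑-distrib-+ to ∑-distrib; ∑-comm to ∑-commute; *-distribˡ-sum to distribˡ-∑; *-distribʳ-sum to distribʳ-∑; sum-permute to ∑-permute)

module ℂ-Reasoning = SetoidReasoning R.setoid

≡⇒≈ᶜ : ∀ {x y} → x ≡ y → x ≈ᶜ y
≡⇒≈ᶜ = R.reflexive

-- Gives the ring solver integer coefficients, whose equality is decidable.
fromℤ-morphism : CommutativeRing.rawRing ℤ.+-*-commutativeRing
  -Raw-AlmostCommutative⟶ fromCommutativeRing ℂ-commutativeRing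
fromℤ-morphism = record
  { ⟦_⟧ = fromℤ ; +-homo = fromℤ-+ ; *-homo = fromℤ-* ; -‿homo = fromℤ-neg
  ; 0-homo = R.refl ; 1-homo = R.refl }

private
  _coeff≟_ : WeaklyDecidable (λ i j → fromℤ i ≈ᶜ fromℤ j)
  i coeff≟ j with i ℤ.≟ j
  ... | yes i≡j = just (≡⇒≈ᶜ (cong fromℤ i≡j))
  ... | no _    = nothing

module ℂ-Solver = Algebra.Solver.Ring (CommutativeRing.rawRing ℤ.+-*-commutativeRing)
  (fromCommutativeRing ℂ-commutativeRing) fromℤ-morphism _coeff≟_

-- Invertible scalars

Invertible : ℂ → Set
Invertible z = ∃[ w ] z *ᶜ w ≈ᶜ 1ᶜ

*-invertibleˡ : ∀ {x y} → Invertible (x *ᶜ y) → Invertible x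
*-invertibleˡ {x} {y} (w , e) = y *ᶜ w , R.trans (R.sym (R.*-assoc x y w)) e

invertible-cancel : ∀ {x y} → Invertible x → x *ᶜ y ≈ᶜ 0ᶜ → y ≈ᶜ 0ᶜ
invertible-cancel {x} {y} (w , e) h = begin
  y
    ≈⟨ R.*-identityˡ y ⟨
  1ᶜ *ᶜ y
    ≈⟨ R.*-congʳ e ⟨
  x *ᶜ w *ᶜ y
    ≈⟨ R.*-congʳ (R.*-comm x w) ⟩
  w *ᶜ x *ᶜ y
    ≈⟨ R.*-assoc w x y ⟩
  w *ᶜ (x *ᶜ y)
    ≈⟨ R.*-congˡ h ⟩
  w *ᶜ 0ᶜ
    ≈⟨ R.zeroʳ w ⟩
  0ᶜ ∎
  where open ℂ-Reasoning

0-not-invertible : ¬ Invertible 0ᶜ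
0-not-invertible (w , e) = 1≉0 (R.trans (R.sym e) (R.zeroˡ w))

0#0-absurd : ¬ 0ᶜ #ᶜ 0ᶜ
0#0-absurd h = 0-not-invertible (#ᶜ⇒invertible h)

fromℤ-invertible : ∀ {i} → i ≢ ℤ.0ℤ → Invertible (fromℤ i)
fromℤ-invertible i≢0 = #ᶜ⇒invertible (fromℤ-#0 i≢0)

fromℤ-zero : ∀ {i} → fromℤ i ≈ᶜ 0ᶜ → i ≡ ℤ.0ℤ
fromℤ-zero {i} h with i ℤ.≟ ℤ.0ℤ
... | yes i≡0 = i≡0
... | no i≢0  = contradiction
  (let w , e = fromℤ-invertible i≢0 in w , R.trans (R.*-congʳ (R.sym h)) e) 0-not-invertible

x-y≈0⇒x≈y : ∀ {x y} → x +ᶜ -ᶜ y ≈ᶜ 0ᶜ → x ≈ᶜ y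
x-y≈0⇒x≈y {x} {y} h = begin
  x
    ≈⟨ solve 2 (λ x y → x := (x :+ :- y) :+ y) R.refl x y ⟩
  (x +ᶜ -ᶜ y) +ᶜ y
    ≈⟨ R.+-congʳ h ⟩
  0ᶜ +ᶜ y
    ≈⟨ R.+-identityˡ y ⟩
  y ∎
  where
  open ℂ-Reasoning
  open ℂ-Solver

-- Brings an equality of traces in `ℂ` back to an equality of numbers of summands.
fromℤ-injective : ∀ {i j} → fromℤ i ≈ᶜ fromℤ j → i ≡ j
fromℤ-injective {i} {j} h = ℤ.i-j≡0⇒i≡j i j (fromℤ-zero (begin
  fromℤ (i ℤ.- j)
    ≈⟨ fromℤ-+ i (ℤ.- j) ⟩
  fromℤ i +ᶜ fromℤ (ℤ.- j)
    ≈⟨ R.+-cong h (fromℤ-neg j) ⟩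
  fromℤ j +ᶜ -ᶜ fromℤ j
    ≈⟨ R.-‿inverseʳ (fromℤ j) ⟩
  0ᶜ ∎))
  where open ℂ-Reasoning

-- Splits `x` as `y + 0`; the summand 0 is not apart from 0.
#0-resp : ∀ {x y} → x ≈ᶜ y → x #ᶜ 0ᶜ → y #ᶜ 0ᶜ
#0-resp {x} {y} x≈y x#0
  with #ᶜ-split {y = y} {z = 0ᶜ} x#0 (R.trans x≈y (R.sym (R.+-identityʳ y)))
... | inj₁ y#0 = y#0
... | inj₂ 0#0 = contradiction 0#0 0#0-absurd

sum-#0 : (f : Fin n → ℂ) → sum f #ᶜ 0ᶜ → ∃[ j ] f j #ᶜ 0ᶜ
sum-#0 {zero}  f h = contradiction h 0#0-absurd
sum-#0 {suc n} f h with #ᶜ-split h R.refl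
... | inj₁ f0#0 = zero , f0#0
... | inj₂ rest with j , fj#0 ← sum-#0 (f ∘ suc) rest = suc j , fj#0

-- Finite sums

[_]-yes : {P : Set} (P? : Dec P) → P → [ P? ]ᶜ ≡ 1ᶜ
[ yes _ ]-yes _ = refl
[ no ¬p ]-yes p = contradiction p ¬p

[_]-no : {P : Set} (P? : Dec P) → ¬ P → [ P? ]ᶜ ≡ 0ᶜ
[ yes p ]-no ¬p = contradiction p ¬p
[ no _ ]-no  _  = refl

δ-refl : (i : Fin n) → [ i ≟ᶠ i ]ᶜ ≈ᶜ 1ᶜ
δ-refl i = ≡⇒≈ᶜ ([ i ≟ᶠ i ]-yes refl)

δ-≢ : {i j : Fin n} → i ≢ j → [ i ≟ᶠ j ]ᶜ ≈ᶜ 0ᶜ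
δ-≢ {i = i} {j} i≢j = ≡⇒≈ᶜ ([ i ≟ᶠ j ]-no i≢j)

sum-cong : {f g : Fin n → ℂ} → (∀ i → f i ≈ᶜ g i) → sum f ≈ᶜ sum g
sum-cong h = sum-cong-≋ h

∑-distrib-+ : (f g : Fin n → ℂ) → sum (λ i → f i +ᶜ g i) ≈ᶜ sum f +ᶜ sum g
∑-distrib-+ f g = ∑-distrib f g

∑-comm : (f : Fin m → Fin n → ℂ) → sum (λ i → sum (λ j → f i j)) ≈ᶜ sum (λ j → sum (λ i → f i j))
∑-comm f = ∑-commute f

*-distribˡ-sum : (c : ℂ) (f : Fin n → ℂ) → c *ᶜ sum f ≈ᶜ sum (λ i → c *ᶜ f i)
*-distribˡ-sum c f = distribˡ-∑ c f

*-distribʳ-sum : (c : ℂ) (f : Fin n → ℂ) → sum f *ᶜ c ≈ᶜ sum (λ i → f i *ᶜ c)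
*-distribʳ-sum c f = distribʳ-∑ c f

sum-zero : {f : Fin n → ℂ} → (∀ i → f i ≈ᶜ 0ᶜ) → sum f ≈ᶜ 0ᶜ
sum-zero {n} h = R.trans (sum-cong h) (sum-replicate-zero n)

sum-single : (i : Fin n) (f : Fin n → ℂ) → (∀ j → j ≢ i → f j ≈ᶜ 0ᶜ) → sum f ≈ᶜ f i
sum-single zero f h = R.trans (R.+-congˡ (sum-zero (λ j → h (suc j) (λ ())))) (R.+-identityʳ _)
sum-single (suc i) f h = R.trans
  (R.+-cong (h zero (λ ())) (sum-single i (f ∘ suc) (λ j j≢i → h (suc j) (λ { refl → j≢i refl }))))
  (R.+-identityˡ _)

sum-δˡ : (i : Fin n) (f : Fin n → ℂ) → sum (λ j → [ i ≟ᶠ j ]ᶜ *ᶜ f j) ≈ᶜ f i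
sum-δˡ i f = R.trans (sum-single i _ λ j j≢i →
    R.trans (R.*-congʳ (δ-≢ (λ e → j≢i (sym e)))) (R.zeroˡ _))
  (R.trans (R.*-congʳ (δ-refl i)) (R.*-identityˡ _))

sum-δʳ : (i : Fin n) (f : Fin n → ℂ) → sum (λ j → f j *ᶜ [ j ≟ᶠ i ]ᶜ) ≈ᶜ f i
sum-δʳ i f = R.trans (sum-single i _ λ j j≢i →
    R.trans (R.*-congˡ (δ-≢ j≢i)) (R.zeroʳ _))
  (R.trans (R.*-congˡ (δ-refl i)) (R.*-identityʳ _))

-- Each `f j` is the sum of `[s a = j] f j` over `a`: by injectivity at most one term survives, and
-- off the image both sides vanish. Exchanging the sums finishes.
sum-image : (s : Fin m → Fin n) → (∀ {a b} → s a ≡ s b → a ≡ b) → (f : Fin n → ℂ) →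
  (∀ j → (∃[ a ] s a ≡ j) ⊎ f j ≈ᶜ 0ᶜ) → sum f ≈ᶜ sum (f ∘ s)
sum-image {m} {n} s s-injective f h = begin
  sum f
    ≈⟨ sum-cong column ⟩
  sum (λ j → sum (λ a → [ s a ≟ᶠ j ]ᶜ *ᶜ f j))
    ≈⟨ ∑-comm (λ j a → [ s a ≟ᶠ j ]ᶜ *ᶜ f j) ⟩
  sum (λ a → sum (λ j → [ s a ≟ᶠ j ]ᶜ *ᶜ f j))
    ≈⟨ sum-cong (λ a → sum-δˡ (s a) f) ⟩
  sum (f ∘ s) ∎
  where
  open ℂ-Reasoning
  column : ∀ j → f j ≈ᶜ sum (λ a → [ s a ≟ᶠ j ]ᶜ *ᶜ f j)
  column j with h j
  ... | inj₂ fj≈0 = R.trans fj≈0 (R.sym (sum-zero {m} (λ a → R.trans (R.*-congˡ fj≈0) (R.zeroʳ [ s a ≟ᶠ j ]ᶜ))))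
  ... | inj₁ (a , refl) = R.sym (R.trans
    (sum-single a _ λ b b≢a → R.trans (R.*-congʳ (δ-≢ (λ e → b≢a (s-injective e)))) (R.zeroˡ _))
    (R.trans (R.*-congʳ (δ-refl (s a))) (R.*-identityˡ _)))

-- Vectors

𝕍-setoid : Set → Setoid 0ℓ 0ℓ
𝕍-setoid Ix = record
  { Carrier = 𝕍 Ix ; _≈_ = _≈ᵛ_
  ; isEquivalence = record
    { refl  = λ _ → R.refl
    ; sym   = λ h i → R.sym (h i)
    ; trans = λ h k i → R.trans (h i) (k i) } }

module _ {Ix : Set} where
  open Setoid (𝕍-setoid Ix) public using ()
    renaming (refl to ≈ᵛ-refl; sym to ≈ᵛ-sym; trans to ≈ᵛ-trans; reflexive to ≡⇒≈ᵛ)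

module 𝕍-Reasoning {Ix : Set} = SetoidReasoning (𝕍-setoid Ix)

+ᵛ-cong : {u u′ v v′ : 𝕍 Ix} → u ≈ᵛ u′ → v ≈ᵛ v′ → u +ᵛ v ≈ᵛ u′ +ᵛ v′
+ᵛ-cong h k i = R.+-cong (h i) (k i)

·-cong : ∀ {c d} {u v : 𝕍 Ix} → c ≈ᶜ d → u ≈ᵛ v → c · u ≈ᵛ d · v
·-cong h k i = R.*-cong h (k i)

·-zeroˡ : ∀ {c} (v : 𝕍 Ix) → c ≈ᶜ 0ᶜ → c · v ≈ᵛ 0ᵛ
·-zeroˡ v h i = R.trans (R.*-congʳ h) (R.zeroˡ _)

·-zeroʳ : ∀ c {v : 𝕍 Ix} → v ≈ᵛ 0ᵛ → c · v ≈ᵛ 0ᵛ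
·-zeroʳ c h i = R.trans (R.*-congˡ (h i)) (R.zeroʳ _)

·-identity : (v : 𝕍 Ix) → 1ᶜ · v ≈ᵛ v
·-identity v i = R.*-identityˡ _

·-· : ∀ c d (v : 𝕍 Ix) → c · d · v ≈ᵛ (c *ᶜ d) · v
·-· c d v i = R.sym (R.*-assoc c d _)

linComb-cong : {c d : Fin k → ℂ} {us vs : Fin k → 𝕍 Ix} →
  (∀ j → c j ≈ᶜ d j) → (∀ j → us j ≈ᵛ vs j) → linComb c us ≈ᵛ linComb d vs
linComb-cong h k i = sum-cong (λ j → R.*-cong (h j) (k j i))

linComb-zero : {c : Fin k → ℂ} (vs : Fin k → 𝕍 Ix) → (∀ j → c j ≈ᶜ 0ᶜ) → linComb c vs ≈ᵛ 0ᵛ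
linComb-zero vs h i = sum-zero (λ j → R.trans (R.*-congʳ (h j)) (R.zeroˡ _))

linComb-+ : (c d : Fin k → ℂ) (vs : Fin k → 𝕍 Ix) →
  linComb (λ j → c j +ᶜ d j) vs ≈ᵛ linComb c vs +ᵛ linComb d vs
linComb-+ {k} c d vs i = R.trans (sum-cong (λ j → R.distribʳ (vs j i) (c j) (d j)))
  (∑-distrib-+ {k} (λ j → c j *ᶜ vs j i) (λ j → d j *ᶜ vs j i))

linComb-·ˡ : ∀ a (c : Fin k → ℂ) (vs : Fin k → 𝕍 Ix) →
  linComb (λ j → a *ᶜ c j) vs ≈ᵛ a · linComb c vs
linComb-·ˡ a c vs i = R.trans (sum-cong (λ j → R.*-assoc a (c j) (vs j i)))
  (R.sym (*-distribˡ-sum a (λ j → c j *ᶜ vs j i)))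

sumᵛ-linComb : (d : Fin k → Fin l → ℂ) (vs : Fin l → 𝕍 Ix) →
  sumᵛ (λ j → linComb (d j) vs) ≈ᵛ linComb (λ a → sum (λ j → d j a)) vs
sumᵛ-linComb d vs i = R.trans (∑-comm (λ j a → d j a *ᶜ vs a i))
  (sum-cong (λ a → R.sym (*-distribʳ-sum (vs a i) (λ j → d j a))))

linComb-linComb : (c : Fin k → ℂ) (d : Fin k → Fin l → ℂ) (vs : Fin l → 𝕍 Ix) →
  linComb c (λ j → linComb (d j) vs) ≈ᵛ linComb (λ a → sum (λ j → c j *ᶜ d j a)) vs
linComb-linComb c d vs i = R.trans (sum-cong (λ j → R.sym (linComb-·ˡ (c j) (d j) vs i)))
  (sumᵛ-linComb (λ j a → c j *ᶜ d j a) vs i)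

linComb-δˡ : (i : Fin k) (vs : Fin k → 𝕍 Ix) → linComb (λ j → [ i ≟ᶠ j ]ᶜ) vs ≈ᵛ vs i
linComb-δˡ i vs p = sum-δˡ i (λ j → vs j p)

linComb-single : (c : Fin k → ℂ) (vs : Fin k → 𝕍 Ix) (i : Fin k) →
  (∀ j → j ≢ i → c j ≈ᶜ 0ᶜ ⊎ vs j ≈ᵛ 0ᵛ) → linComb c vs ≈ᵛ c i · vs i
linComb-single c vs i h p = sum-single i _ λ j j≢i → case h j j≢i of λ where
  (inj₁ c≈0) → R.trans (R.*-congʳ c≈0) (R.zeroˡ _)
  (inj₂ v≈0) → R.trans (R.*-congˡ (v≈0 p)) (R.zeroʳ _)

linComb-δ· : (i : Fin k) (c : ℂ) (vs : Fin k → 𝕍 Ix) →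
  linComb (λ j → [ j ≟ᶠ i ]ᶜ *ᶜ c) vs ≈ᵛ c · vs i
linComb-δ· i c vs = ≈ᵛ-trans
  (linComb-single (λ j → [ j ≟ᶠ i ]ᶜ *ᶜ c) vs i (λ j j≢i → inj₁ (R.trans (R.*-congʳ (δ-≢ j≢i)) (R.zeroˡ c))))
  (·-cong {v = vs i} (R.trans (R.*-congʳ (δ-refl i)) (R.*-identityˡ c)) ≈ᵛ-refl)

module _ {W : Pred (𝕍 Ix) 0ℓ} (S : IsSubspace W) where
  open IsSubspace S

  sumᵛ∈ : (vs : Fin k → 𝕍 Ix) → (∀ j → vs j ∈ W) → sumᵛ vs ∈ W
  sumᵛ∈ {k = zero}  vs h = 0∈
  sumᵛ∈ {k = suc k} vs h = +∈ (h zero) (sumᵛ∈ (vs ∘ suc) (h ∘ suc))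

  linComb∈ : (c : Fin k → ℂ) (vs : Fin k → 𝕍 Ix) → (∀ j → vs j ∈ W) → linComb c vs ∈ W
  linComb∈ c vs h = sumᵛ∈ (λ j → c j · vs j) (λ j → ·∈ (c j) (h j))

NonZero-resp : {u v : 𝕍 Ix} → u ≈ᵛ v → NonZero u → NonZero v
NonZero-resp h (i , ui#0) = i , #0-resp (h i) ui#0

NonZero-absurd : {v : 𝕍 Ix} → v ≈ᵛ 0ᵛ → ¬ NonZero v
NonZero-absurd h (i , vi#0) = 0#0-absurd (#0-resp (h i) vi#0)

NonZero-sumᵛ : (vs : Fin k → 𝕍 Ix) → NonZero (sumᵛ vs) → ∃[ j ] NonZero (vs j)
NonZero-sumᵛ vs (i , h) with j , vji#0 ← sum-#0 (λ j → vs j i) h = j , i , vji#0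

NonZero-·⇒invertible : ∀ {c} {v : 𝕍 Ix} → NonZero (c · v) → Invertible c
NonZero-·⇒invertible (i , h) = *-invertibleˡ (#ᶜ⇒invertible h)

NonZero-cancel : ∀ {c} {v : 𝕍 Ix} → NonZero v → c · v ≈ᵛ 0ᵛ → c ≈ᶜ 0ᶜ
NonZero-cancel {c = c} {v} (i , vi#0) h =
  invertible-cancel (#ᶜ⇒invertible vi#0) (R.trans (R.*-comm (v i) c) (h i))

-- Matrices

*ᵛ-cong : {M N : Mat m n} {u v : 𝕍 (Fin n)} → M ≈ᵛ N → u ≈ᵛ v → M *ᵛ u ≈ᵛ N *ᵛ v
*ᵛ-cong h k i = sum-cong (λ j → R.*-cong (h (i , j)) (k j))

*ᵛ-congˡ : (M : Mat m n) {u v : 𝕍 (Fin n)} → u ≈ᵛ v → M *ᵛ u ≈ᵛ M *ᵛ v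
*ᵛ-congˡ M = *ᵛ-cong {M = M} (λ _ → R.refl)

*ᵛ-congʳ : {M N : Mat m n} (v : 𝕍 (Fin n)) → M ≈ᵛ N → M *ᵛ v ≈ᵛ N *ᵛ v
*ᵛ-congʳ v h = *ᵛ-cong {v = v} h (λ _ → R.refl)

*ᵛ-distribʳ-+ᵛ : (M N : Mat m n) (v : 𝕍 (Fin n)) → (M +ᵛ N) *ᵛ v ≈ᵛ M *ᵛ v +ᵛ N *ᵛ v
*ᵛ-distribʳ-+ᵛ M N v i =
  R.trans (sum-cong (λ j → R.distribʳ (v j) (M (i , j)) (N (i , j))))
    (∑-distrib-+ (λ j → M (i , j) *ᶜ v j) (λ j → N (i , j) *ᶜ v j))

*ᵛ-· : (M : Mat m n) (c : ℂ) (v : 𝕍 (Fin n)) → M *ᵛ (c · v) ≈ᵛ c · (M *ᵛ v)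
*ᵛ-· M c v i = R.trans
  (sum-cong {f = λ j → M (i , j) *ᶜ (c *ᶜ v j)} {g = λ j → c *ᶜ (M (i , j) *ᶜ v j)}
    (λ j → solve 3 (λ m c v → m :* (c :* v) := c :* (m :* v)) R.refl (M (i , j)) c (v j)))
  (R.sym (*-distribˡ-sum c (λ j → M (i , j) *ᶜ v j)))
  where open ℂ-Solver

·-*ᵛ : (c : ℂ) (M : Mat m n) (v : 𝕍 (Fin n)) → (c · M) *ᵛ v ≈ᵛ c · (M *ᵛ v)
·-*ᵛ c M v i = R.trans (sum-cong (λ j → R.*-assoc c (M (i , j)) (v j)))
  (R.sym (*-distribˡ-sum c (λ j → M (i , j) *ᶜ v j)))

*ᵛ-zero : (M : Mat m n) {v : 𝕍 (Fin n)} → v ≈ᵛ 0ᵛ → M *ᵛ v ≈ᵛ 0ᵛ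
*ᵛ-zero M h i = sum-zero (λ j → R.trans (R.*-congˡ (h j)) (R.zeroʳ _))

*ᵛ-sumᵛ : (M : Mat m n) (vs : Fin k → 𝕍 (Fin n)) → M *ᵛ sumᵛ vs ≈ᵛ sumᵛ (λ j → M *ᵛ vs j)
*ᵛ-sumᵛ M vs i = R.trans (sum-cong (λ j → *-distribˡ-sum (M (i , j)) (λ a → vs a j)))
  (∑-comm (λ j a → M (i , j) *ᶜ vs a j))

*ᵛ-linComb : (M : Mat m n) (c : Fin k → ℂ) (vs : Fin k → 𝕍 (Fin n)) →
  M *ᵛ linComb c vs ≈ᵛ linComb c (λ j → M *ᵛ vs j)
*ᵛ-linComb M c vs i = R.trans (*ᵛ-sumᵛ M (λ j → c j · vs j) i) (sum-cong (λ j → *ᵛ-· M (c j) (vs j) i))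

sumᵛ-*ᵛ : (Ms : Fin k → Mat m n) (v : 𝕍 (Fin n)) → sumᵛ Ms *ᵛ v ≈ᵛ sumᵛ (λ j → Ms j *ᵛ v)
sumᵛ-*ᵛ Ms v i = R.trans (sum-cong (λ p → *-distribʳ-sum (v p) (λ j → Ms j (i , p))))
  (∑-comm (λ p j → Ms j (i , p) *ᶜ v p))

linComb-*ᵛ : (c : Fin k → ℂ) (Ms : Fin k → Mat m n) (v : 𝕍 (Fin n)) →
  linComb c Ms *ᵛ v ≈ᵛ linComb c (λ j → Ms j *ᵛ v)
linComb-*ᵛ c Ms v i =
  R.trans (sumᵛ-*ᵛ (λ j → c j · Ms j) v i) (sum-cong (λ j → ·-*ᵛ (c j) (Ms j) v i))

*ᵐ-*ᵛ : (M : Mat m n) (N : Mat n k) (v : 𝕍 (Fin k)) → (M *ᵐ N) *ᵛ v ≈ᵛ M *ᵛ N *ᵛ v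
*ᵐ-*ᵛ M N v i = begin
  sum (λ j → sum (λ l → M (i , l) *ᶜ N (l , j)) *ᶜ v j)
    ≈⟨ sum-cong (λ j → *-distribʳ-sum (v j) (λ l → M (i , l) *ᶜ N (l , j))) ⟩
  sum (λ j → sum (λ l → M (i , l) *ᶜ N (l , j) *ᶜ v j))
    ≈⟨ ∑-comm (λ j l → M (i , l) *ᶜ N (l , j) *ᶜ v j) ⟩
  sum (λ l → sum (λ j → M (i , l) *ᶜ N (l , j) *ᶜ v j))
    ≈⟨ sum-cong (λ l → sum-cong (λ j → R.*-assoc (M (i , l)) (N (l , j)) (v j))) ⟩
  sum (λ l → sum (λ j → M (i , l) *ᶜ (N (l , j) *ᶜ v j)))
    ≈⟨ sum-cong (λ l → R.sym (*-distribˡ-sum (M (i , l)) (λ j → N (l , j) *ᶜ v j))) ⟩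
  sum (λ l → M (i , l) *ᶜ sum (λ j → N (l , j) *ᶜ v j)) ∎
  where open ℂ-Reasoning

1ᵐ-*ᵛ : (v : 𝕍 (Fin n)) → 1ᵐ *ᵛ v ≈ᵛ v
1ᵐ-*ᵛ v i = sum-δˡ i v

*ᵛ-faithful : (M N : Mat m n) → (∀ v → M *ᵛ v ≈ᵛ N *ᵛ v) → M ≈ᵛ N
*ᵛ-faithful M N h (i , j) = R.trans (R.sym (sum-δʳ j (λ l → M (i , l))))
  (R.trans (h (λ l → [ l ≟ᶠ j ]ᶜ) i) (sum-δʳ j (λ l → N (i , l))))

-- Pairings

infix 8 _∙_
-- Bilinear, in contrast to `⟨_,_⟩`: members of a dual basis act as row vectors, without
-- conjugation.
_∙_ : 𝕍 (Fin n) → 𝕍 (Fin n) → ℂ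
u ∙ v = sum (λ i → u i *ᶜ v i)

∙-congʳ : (p : 𝕍 (Fin n)) {u v : 𝕍 (Fin n)} → u ≈ᵛ v → p ∙ u ≈ᶜ p ∙ v
∙-congʳ p h = sum-cong (λ i → R.*-congˡ (h i))

∙-· : ∀ (p : 𝕍 (Fin n)) c (v : 𝕍 (Fin n)) → p ∙ (c · v) ≈ᶜ c *ᶜ (p ∙ v)
∙-· p c v = *ᵛ-· {m = 1} (λ (_ , j) → p j) c v zero

∙-linComb : (p : 𝕍 (Fin n)) (c : Fin k → ℂ) (vs : Fin k → 𝕍 (Fin n)) →
  p ∙ linComb c vs ≈ᶜ sum (λ j → c j *ᶜ (p ∙ vs j))
∙-linComb p c vs = *ᵛ-linComb {m = 1} (λ (_ , j) → p j) c vs zero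

⟨⟩-cong : {u u′ v v′ : 𝕍 (Fin n)} → u ≈ᵛ u′ → v ≈ᵛ v′ → ⟨ u , v ⟩ ≈ᶜ ⟨ u′ , v′ ⟩
⟨⟩-cong h k = sum-cong (λ i → R.*-cong (h i) (conj-cong (k i)))

conj-sum : (f : Fin n → ℂ) → conj (sum f) ≈ᶜ sum (λ i → conj (f i))
conj-sum {zero}  f = conj-fromℤ ℤ.0ℤ
conj-sum {suc n} f = R.trans (conj-+ _ _) (R.+-congˡ (conj-sum (f ∘ suc)))

⟨sumᵛ,⟩ : (us : Fin k → 𝕍 (Fin n)) (v : 𝕍 (Fin n)) → ⟨ sumᵛ us , v ⟩ ≈ᶜ sum (λ j → ⟨ us j , v ⟩)
⟨sumᵛ,⟩ us v = R.trans (sum-cong (λ y → *-distribʳ-sum (conj (v y)) (λ j → us j y)))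
  (∑-comm (λ y j → us j y *ᶜ conj (v y)))

⟨·,⟩ : (c : ℂ) (u v : 𝕍 (Fin n)) → ⟨ c · u , v ⟩ ≈ᶜ c *ᶜ ⟨ u , v ⟩
⟨·,⟩ c u v = R.trans (sum-cong (λ y → R.*-assoc c (u y) (conj (v y))))
  (R.sym (*-distribˡ-sum c (λ y → u y *ᶜ conj (v y))))

⟨linComb,⟩ : (c : Fin k → ℂ) (us : Fin k → 𝕍 (Fin n)) (v : 𝕍 (Fin n)) →
  ⟨ linComb c us , v ⟩ ≈ᶜ sum (λ j → c j *ᶜ ⟨ us j , v ⟩)
⟨linComb,⟩ c us v =
  R.trans (⟨sumᵛ,⟩ (λ j → c j · us j) v) (sum-cong (λ j → ⟨·,⟩ (c j) (us j) v))

⟨,linComb⟩ : (u : 𝕍 (Fin n)) (c : Fin k → ℂ) (vs : Fin k → 𝕍 (Fin n)) →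
  ⟨ u , linComb c vs ⟩ ≈ᶜ sum (λ j → conj (c j) *ᶜ ⟨ u , vs j ⟩)
⟨,linComb⟩ u c vs = R.trans
  (sum-cong (λ y → R.*-congˡ (R.trans (conj-sum (λ j → c j *ᶜ vs j y)) (sum-cong (λ j → conj-* (c j) (vs j y))))))
  (∙-linComb u (λ j → conj (c j)) (λ j y → conj (vs j y)))

-- Diagonalisation

-- An eigenbasis together with its dual basis. Spanning is stated by `complete`, with coordinates
-- read off by the dual vectors, so no determinant or dimension count enters.
record Diagonalisation (k : ℕ) (M : Mat n n) : Set where
  field
    θ          : Fin k → ℤ
    u u*       : Fin k → 𝕍 (Fin n)
    eigen      : ∀ j → M *ᵛ u j ≈ᵛ fromℤ (θ j) · u j
    dual       : ∀ i j → u* i ∙ u j ≈ᶜ [ i ≟ᶠ j ]ᶜ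
    complete   : ∀ v → v ≈ᵛ linComb (λ j → u* j ∙ v) u
    nonZero    : ∀ j → NonZero (u j)

  u*-linComb : ∀ c j → u* j ∙ linComb c u ≈ᶜ c j
  u*-linComb c j = R.trans (∙-linComb (u* j) c u) (R.trans (sum-cong (λ i → R.trans (R.*-congˡ (dual j i)) (R.*-comm (c i) _)))
    (sum-δˡ j c))

  -- Expand `v` in eigenvectors, apply `M`, and read off the coordinate at `j`.
  leftEigen : ∀ j v → u* j ∙ (M *ᵛ v) ≈ᶜ fromℤ (θ j) *ᶜ (u* j ∙ v)
  leftEigen j v = begin
    u* j ∙ (M *ᵛ v)
      ≈⟨ ∙-congʳ (u* j) (*ᵛ-congˡ M (complete v)) ⟩
    u* j ∙ (M *ᵛ linComb (λ i → u* i ∙ v) u)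
      ≈⟨ ∙-congʳ (u* j) (*ᵛ-linComb M _ u) ⟩
    u* j ∙ linComb (λ i → u* i ∙ v) (λ i → M *ᵛ u i)
      ≈⟨ ∙-congʳ (u* j) (linComb-cong (λ _ → R.refl) eigen) ⟩
    u* j ∙ linComb (λ i → u* i ∙ v) (λ i → fromℤ (θ i) · u i)
      ≈⟨ ∙-congʳ (u* j) (λ p → sum-cong (λ i → swap (u* i ∙ v) _ (u i p))) ⟩
    u* j ∙ linComb (λ i → fromℤ (θ i) *ᶜ (u* i ∙ v)) u
      ≈⟨ u*-linComb _ j ⟩
    fromℤ (θ j) *ᶜ (u* j ∙ v) ∎
    where
    open ℂ-Reasoning
    swap : ∀ a b c → a *ᶜ (b *ᶜ c) ≈ᶜ b *ᶜ a *ᶜ c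
    swap = solve 3 (λ a b c → a :* (b :* c) := b :* a :* c) R.refl where open ℂ-Solver

  -- Compares two values of `u* j ∙ (M *ᵛ v)`. Hence a coordinate can survive only where the
  -- eigenvalue is `ϑ`.
  coordinate-relation : ∀ {ϑ v} → v ∈ Eigenspace M ϑ → ∀ j →
    (ϑ +ᶜ -ᶜ fromℤ (θ j)) *ᶜ (u* j ∙ v) ≈ᶜ 0ᶜ
  coordinate-relation {ϑ} {v} Mv≈ϑv j = begin
    (ϑ +ᶜ -ᶜ fromℤ (θ j)) *ᶜ (u* j ∙ v)
      ≈⟨ solve 3 (λ a b c → (a :+ :- b) :* c := a :* c :+ :- (b :* c)) R.refl ϑ _ _ ⟩
    ϑ *ᶜ (u* j ∙ v) +ᶜ -ᶜ (fromℤ (θ j) *ᶜ (u* j ∙ v))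
      ≈⟨ R.+-cong (R.sym (∙-· (u* j) ϑ v)) (R.-‿cong (R.sym (leftEigen j v))) ⟩
    u* j ∙ (ϑ · v) +ᶜ -ᶜ (u* j ∙ (M *ᵛ v))
      ≈⟨ R.+-congˡ (R.-‿cong (∙-congʳ (u* j) Mv≈ϑv)) ⟩
    u* j ∙ (ϑ · v) +ᶜ -ᶜ (u* j ∙ (ϑ · v))
      ≈⟨ R.-‿inverseʳ _ ⟩
    0ᶜ ∎
    where
    open ℂ-Reasoning
    open ℂ-Solver

  hasEigenvalues : (ϑs : List ℂ) → (∀ j → Any (fromℤ (θ j) ≈ᶜ_) ϑs) →
    (∀ ϑ → Any (ϑ ≈ᶜ_) ϑs → ∃[ j ] ϑ ≈ᶜ fromℤ (θ j)) → HasEigenvalues M ϑs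
  hasEigenvalues ϑs listed attained ϑ = mk⇔ to from
    where
    Any-resp : ∀ {x y} {zs : List ℂ} → x ≈ᶜ y → Any (x ≈ᶜ_) zs → Any (y ≈ᶜ_) zs
    Any-resp h (here e)  = here (R.trans (R.sym h) e)
    Any-resp h (there p) = there (Any-resp h p)
    to : NonZeroSpace (Eigenspace M ϑ) → Any (ϑ ≈ᶜ_) ϑs
    -- Some term in the eigenvector expansion of `v` is nonzero; its coefficient is invertible and
    -- can be cancelled from the coordinate relation.
    to (v , v∈ , v≢0) with j , pj ← NonZero-sumᵛ (λ j → (u* j ∙ v) · u j) (NonZero-resp (complete v) v≢0) =
      Any-resp (R.sym (x-y≈0⇒x≈y (invertible-cancel (NonZero-·⇒invertible {v = u j} pj)
        (R.trans (R.*-comm _ _) (coordinate-relation v∈ j))))) (listed j)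
    from : Any (ϑ ≈ᶜ_) ϑs → NonZeroSpace (Eigenspace M ϑ)
    from p with j , ϑ≈ ← attained ϑ p =
      u j , ≈ᵛ-trans (eigen j) (λ i → R.*-congʳ (R.sym ϑ≈)) , nonZero j

  -- The map `s` enumerates the eigenvectors for `ϑ`. The coordinates at all others vanish because
  -- the difference of two distinct integer eigenvalues is invertible.
  eigenspaceDimension : (ϑ : ℤ) (s : Fin m → Fin k) → (∀ {a b} → s a ≡ s b → a ≡ b) →
    (∀ a → θ (s a) ≡ ϑ) → (∀ j → θ j ≡ ϑ → ∃[ a ] s a ≡ j) → HasDimension (Eigenspace M (fromℤ ϑ)) m
  eigenspaceDimension ϑ s s-injective sound exhaustive = u ∘ s , record
    { members     = λ a → ≈ᵛ-trans (eigen (s a)) (λ i → R.*-congʳ (≡⇒≈ᶜ (cong fromℤ (sound a))))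
    ; independent = λ c h a → R.trans (R.sym (restrict c a)) (R.trans (∙-congʳ (u* (s a)) h) (sum-zero (λ i → R.zeroʳ (u* (s a) i))))
    ; spanning    = λ {v} v∈ → (λ a → u* (s a) ∙ v) , λ i →
        R.trans (complete v i) (sum-image s s-injective (λ j → (u* j ∙ v) *ᶜ u j i) (λ j → image v∈ i j))
    }
    where
    restrict : ∀ c a → u* (s a) ∙ linComb c (u ∘ s) ≈ᶜ c a
    restrict c a = R.trans (∙-linComb (u* (s a)) c (u ∘ s)) (R.trans
      (sum-single a _ (λ b b≢a → R.trans (R.*-congˡ (R.trans (dual (s a) (s b))
        (δ-≢ (λ e → b≢a (sym (s-injective e)))))) (R.zeroʳ _)))
      (R.trans (R.*-congˡ (R.trans (dual (s a) (s a)) (δ-refl (s a)))) (R.*-identityʳ _)))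
    image : ∀ {v} → v ∈ Eigenspace M (fromℤ ϑ) → ∀ i j → (∃[ a ] s a ≡ j) ⊎ (u* j ∙ v) *ᶜ u j i ≈ᶜ 0ᶜ
    image {v} v∈ i j with θ j ℤ.≟ ϑ
    ... | yes e = inj₁ (exhaustive j e)
    ... | no θ≢ϑ = inj₂ (R.trans (R.*-congʳ (invertible-cancel difference-invertible (coordinate-relation v∈ j))) (R.zeroˡ _))
      where
      difference-invertible : Invertible (fromℤ ϑ +ᶜ -ᶜ fromℤ (θ j))
      difference-invertible
        with w , e ← fromℤ-invertible {ϑ ℤ.- θ j} (λ e → θ≢ϑ (sym (ℤ.i-j≡0⇒i≡j ϑ (θ j) e))) =
        w , R.trans (R.*-congʳ (R.sym (R.trans (fromℤ-+ ϑ (ℤ.- θ j)) (R.+-congˡ (fromℤ-neg (θ j)))))) e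

-- Integer sums that evaluate, and their images in the complex numbers

sumℤ : (Fin n → ℤ) → ℤ
sumℤ {zero}  f = ℤ.0ℤ
sumℤ {suc n} f = f zero ℤ.+ sumℤ (f ∘ suc)

fromℤ-sum : (f : Fin n → ℤ) → fromℤ (sumℤ f) ≈ᶜ sum (λ i → fromℤ (f i))
fromℤ-sum {zero}  f = R.refl
fromℤ-sum {suc n} f = R.trans (fromℤ-+ (f zero) _) (R.+-congˡ (fromℤ-sum (f ∘ suc)))

δℤ : {P : Set} → Dec P → ℤ
δℤ P? = if does P? then ℤ.1ℤ else ℤ.0ℤ

fromℤ-δ : {P : Set} (P? : Dec P) → fromℤ (δℤ P?) ≡ [ P? ]ᶜ
fromℤ-δ (yes _) = refl
fromℤ-δ (no _)  = refl

-- The algebra M₃(ℂ) ⊕ M₂(ℂ) ⊕ ℂ ⊕ ℂ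

dim endpoint : SummandType → ℕ
dim t = TypeData.dimension (typeData t)
endpoint t = TypeData.endpoint (typeData t)

-- One square block per type. Integer entries serve for evaluation, complex ones for elements of
-- `T`.
Coefficients : Set → Set
Coefficients C = ∀ t → Fin (dim t) → Fin (dim t) → C

row₀ : ∀ t → Fin (dim t)
row₀ I   = 0F
row₀ II  = 0F
row₀ III = 0F
row₀ IV  = 0F

_≟ᵗ_ : DecidableEquality SummandType
I   ≟ᵗ I   = yes refl
I   ≟ᵗ II  = no λ ()
I   ≟ᵗ III = no λ ()
I   ≟ᵗ IV  = no λ ()
II  ≟ᵗ I   = no λ ()
II  ≟ᵗ II  = yes refl
II  ≟ᵗ III = no λ ()
II  ≟ᵗ IV  = no λ ()
III ≟ᵗ I   = no λ ()
III ≟ᵗ II  = no λ ()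
III ≟ᵗ III = yes refl
III ≟ᵗ IV  = no λ ()
IV  ≟ᵗ I   = no λ ()
IV  ≟ᵗ II  = no λ ()
IV  ≟ᵗ III = no λ ()
IV  ≟ᵗ IV  = yes refl

allTypes? : {P : SummandType → Set} → (∀ t → Dec (P t)) → Dec (∀ t → P t)
allTypes? {P} P? with P? I | P? II | P? III | P? IV
... | yes p | yes q | yes r | yes s = yes λ { I → p ; II → q ; III → r ; IV → s }
... | no ¬p | _     | _     | _     = no λ h → ¬p (h I)
... | yes _ | no ¬p | _     | _     = no λ h → ¬p (h II)
... | yes _ | yes _ | no ¬p | _     = no λ h → ¬p (h III)
... | yes _ | yes _ | yes _ | no ¬p = no λ h → ¬p (h IV)

-- A basis of T is indexed by a type together with a row and a column.
Unit : Set
Unit = Σ SummandType λ t → Fin (dim t) × Fin (dim t)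

index : Unit → Fin 15
index (I , 0F , b) = b Fin.↑ˡ 12
index (I , 1F , b) = 3 Fin.↑ʳ (b Fin.↑ˡ 9)
index (I , 2F , b) = 6 Fin.↑ʳ (b Fin.↑ˡ 6)
index (II , 0F , b) = 9 Fin.↑ʳ (b Fin.↑ˡ 4)
index (II , 1F , b) = 11 Fin.↑ʳ (b Fin.↑ˡ 2)
index (III , _) = 13 Fin.↑ʳ 0F
index (IV , _)  = 14 Fin.↑ʳ 0F

units : Vec Unit 15
units =
  (I , 0F , 0F) ∷ (I , 0F , 1F) ∷ (I , 0F , 2F) ∷
  (I , 1F , 0F) ∷ (I , 1F , 1F) ∷ (I , 1F , 2F) ∷
  (I , 2F , 0F) ∷ (I , 2F , 1F) ∷ (I , 2F , 2F) ∷
  (II , 0F , 0F) ∷ (II , 0F , 1F) ∷ (II , 1F , 0F) ∷ (II , 1F , 1F) ∷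
  (III , 0F , 0F) ∷ (IV , 0F , 0F) ∷ []

unit : Fin 15 → Unit
unit = lookup units

unit-index : ∀ p → unit (index p) ≡ p
unit-index (I , 0F , 0F) = refl
unit-index (I , 0F , 1F) = refl
unit-index (I , 0F , 2F) = refl
unit-index (I , 1F , 0F) = refl
unit-index (I , 1F , 1F) = refl
unit-index (I , 1F , 2F) = refl
unit-index (I , 2F , 0F) = refl
unit-index (I , 2F , 1F) = refl
unit-index (I , 2F , 2F) = refl
unit-index (II , 0F , 0F) = refl
unit-index (II , 0F , 1F) = refl
unit-index (II , 1F , 0F) = refl
unit-index (II , 1F , 1F) = refl
unit-index (III , 0F , 0F) = refl
unit-index (IV , 0F , 0F) = refl

index-unit : ∀ i → index (unit i) ≡ i
index-unit = from-yes (all? (λ i → index (unit i) ≟ᶠ i))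

index-injective : ∀ {p q} → index p ≡ index q → p ≡ q
index-injective {p} {q} e = trans (sym (unit-index p)) (trans (cong unit e) (unit-index q))

-- The coefficients of the matrix unit e p.
𝟙 : Unit → Coefficients ℂ
𝟙 p t a b = [ index p ≟ᶠ index (t , a , b) ]ᶜ

𝟙-≢ : ∀ {t s a b c d} → t ≢ s → 𝟙 (t , a , b) s c d ≡ 0ᶜ
𝟙-≢ {t} {s} {a} {b} {c} {d} t≢s =
  [ index (t , a , b) ≟ᶠ index (s , c , d) ]-no (λ e → t≢s (cong proj₁ (index-injective e)))

𝟙-≡ : ∀ t a b c d → 𝟙 (t , a , b) t c d ≈ᶜ [ b ≟ᶠ d ]ᶜ *ᶜ [ a ≟ᶠ c ]ᶜ
𝟙-≡ t a b c d with a ≟ᶠ c | b ≟ᶠ d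
... | yes refl | yes refl = R.trans (δ-refl (index (t , a , b))) (R.sym (R.*-identityˡ _))
... | yes _ | no b≢d = R.trans (≡⇒≈ᶜ ([ index (t , a , b) ≟ᶠ index (t , c , d) ]-no
  (λ e → case index-injective {t , a , b} {t , c , d} e of λ { refl → b≢d refl }))) (R.sym (R.zeroˡ _))
... | no a≢c | _ = R.trans (≡⇒≈ᶜ ([ index (t , a , b) ≟ᶠ index (t , c , d) ]-no
  (λ e → case index-injective {t , a , b} {t , c , d} e of λ { refl → a≢c refl }))) (R.sym (R.zeroʳ _))

-- Integer copy of the four listed matrices, whose complex entries are opaque and do not evaluate.
Bℤ : Coefficients ℤ
Bℤ I   0F 1F = ℤ.+ 3
Bℤ I   1F 0F = ℤ.+ 1
Bℤ I   1F 2F = ℤ.+ 2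
Bℤ I   2F 1F = ℤ.+ 1
Bℤ I   2F 2F = ℤ.+ 2
Bℤ II  0F 1F = ℤ.+ 2
Bℤ II  1F 0F = ℤ.+ 1
Bℤ II  1F 1F = ℤ.-[1+ 0 ]
Bℤ III 0F 0F = ℤ.+ 1
Bℤ IV  0F 0F = ℤ.-[1+ 1 ]
Bℤ _   _  _  = ℤ.0ℤ

matrixOfA≡ : ∀ t a b → TypeData.matrixOfA (typeData t) (a , b) ≡ fromℤ (Bℤ t a b)
matrixOfA≡ I 0F 0F = refl
matrixOfA≡ I 0F 1F = refl
matrixOfA≡ I 0F 2F = refl
matrixOfA≡ I 1F 0F = refl
matrixOfA≡ I 1F 1F = refl
matrixOfA≡ I 1F 2F = refl
matrixOfA≡ I 2F 0F = refl
matrixOfA≡ I 2F 1F = refl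
matrixOfA≡ I 2F 2F = refl
matrixOfA≡ II 0F 0F = refl
matrixOfA≡ II 0F 1F = refl
matrixOfA≡ II 1F 0F = refl
matrixOfA≡ II 1F 1F = refl
matrixOfA≡ III 0F 0F = refl
matrixOfA≡ IV 0F 0F = refl

-- Polynomials in A and the E*ᵢ, and the integer coefficients of their action

infixl 6 _⊕_
infixl 7 _⊗_
infixr 7 _⊙_

data Expr : Set where
  `A      : Expr
  `E      : Fin 3 → Expr
  _⊕_ _⊗_ : Expr → Expr → Expr
  _⊙_     : ℤ → Expr → Expr

coefficient : Expr → Coefficients ℤ
coefficient `A       t a b = Bℤ t a b
-- Row `b` of a summand of type `t` lies at distance `endpoint t + b` from the base vertex.
coefficient (`E h)   t a b = δℤ (a ≟ᶠ b) ℤ.* δℤ (endpoint t ℕ.+ toℕ b ℕ.≟ toℕ h)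
coefficient (e ⊕ f)  t a b = coefficient e t a b ℤ.+ coefficient f t a b
-- A matrix product; its factors stand in the order that `linComb-linComb` yields.
coefficient (e ⊗ f)  t a b = sumℤ (λ c → coefficient f t c b ℤ.* coefficient e t a c)
coefficient (i ⊙ e)  t a b = i ℤ.* coefficient e t a b

-- In terms of matrix units, `E 0F is e₀₀ of type I and B has entries B₁₀ = 1,
-- B₀₁ = 3 in type I, so A E₀* A is 3 e₁₁; subtracting it from 3 E₁* leaves three
-- times e₀₀ of type II.  On the complement of types I and II in E₂*V the matrix
-- E₂* A E₂* has eigenvalue 1 or -2, and it is 2 or -1 on types I and II.
sixUnit : Unit → Expr
sixUnit (I , a , b) = column a ⊗ row b
  where
  column row : Fin 3 → Expr
  column 0F = `E 0F
  column 1F = `A ⊗ `E 0F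
  column 2F = `E 2F ⊗ (`A ⊗ (`A ⊗ `E 0F))
  row 0F = ℤ.+ 6 ⊙ `E 0F
  row 1F = ℤ.+ 2 ⊙ (`E 0F ⊗ `A)
  row 2F = ((`E 0F ⊗ `A) ⊗ `A) ⊗ `E 2F
sixUnit (II , a , b) = column a (row b (ℤ.+ 3 ⊙ `E 1F ⊕ ℤ.-[1+ 0 ] ⊙ (`A ⊗ `E 0F ⊗ `A)))
  where
  column row : Fin 2 → Expr → Expr
  column 0F e = e
  column 1F e = `A ⊗ e
  row 0F e = ℤ.+ 2 ⊙ e
  row 1F e = e ⊗ `A
sixUnit (III , _) = (ℤ.+ 2 ⊙ `E 2F ⊕ ℤ.-[1+ 0 ] ⊙ C) ⊗ ((C ⊕ `E 2F) ⊗ (C ⊕ ℤ.+ 2 ⊙ `E 2F))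
  where
  C : Expr
  C = `E 2F ⊗ `A ⊗ `E 2F
sixUnit (IV , _) = ℤ.+ 6 ⊙ `E 2F ⊕ ℤ.-[1+ 0 ] ⊙
  (sixUnit (I , 2F , 2F) ⊕ sixUnit (II , 1F , 1F) ⊕ sixUnit (III , 0F , 0F))

-- The factor 6 clears all denominators. In type I the entries of `A` and `A²` from the last two
-- columns into row 0 are 3 and 6; in type II, 3 times the entry 2 gives 6; in type III the three
-- factors at eigenvalue 1 are 1, 2 and 3.
sixUnit-coefficient : ∀ t a b s c d →
  coefficient (sixUnit (t , a , b)) s c d ≡ ℤ.+ 6 ℤ.* δℤ (index (t , a , b) ≟ᶠ index (s , c , d))
sixUnit-coefficient = from-yes (allTypes? λ t → all? λ a → all? λ b → allTypes? λ s → all? λ c → all? λ d →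
  coefficient (sixUnit (t , a , b)) s c d ℤ.≟ ℤ.+ 6 ℤ.* δℤ (index (t , a , b) ≟ᶠ index (s , c , d)))

summandTypes : Vec SummandType 6
summandTypes = I ∷ II ∷ II ∷ III ∷ III ∷ IV ∷ []

typeOf : Fin 6 → SummandType
typeOf = lookup summandTypes

-- Everything about Γ that the theory of T depends on; w i is a basis of the i-th
-- summand.
record Model (Γ : Graph n) (x : Fin n) : Set where
  open Terwilliger Γ 2 x
  field
    w              : ∀ i → Fin (dim (typeOf i)) → V
    A-action       : ∀ i k → A *ᵛ w i k ≈ᵛ linComb (λ a → fromℤ (Bℤ (typeOf i) a k)) (w i)
    E*-action      : ∀ h i k → E* h *ᵛ w i k ≈ᵛ [ endpoint (typeOf i) ℕ.+ toℕ k ℕ.≟ h ]ᶜ · w i k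
    w-spanning     : ∀ v → Σ (∀ i → Fin (dim (typeOf i)) → ℂ) λ c → v ≈ᵛ sumᵛ (λ i → linComb (c i) (w i))
    orthogonal     : ∀ {i j} a b → i ≢ j → ⟨ w i a , w j b ⟩ ≈ᶜ 0ᶜ
    orthogonal-row : ∀ i {a b} → a ≢ b → ⟨ w i a , w i b ⟩ ≈ᶜ 0ᶜ
    norm           : ∀ i a → Invertible ⟨ w i a , w i a ⟩
    w-nonZero      : ∀ i a → NonZero (w i a)

module Theory {Γ : Graph n} {x : Fin n} (M : Model Γ x) where
  open Terwilliger Γ 2 x
  open Model M

  Family : Set
  Family = ∀ i → Fin (dim (typeOf i)) → ℂ

  combination : Family → V
  combination c = sumᵛ (λ i → linComb (c i) (w i))

  ⟨combination,w⟩ : ∀ c j b → ⟨ combination c , w j b ⟩ ≈ᶜ c j b *ᶜ ⟨ w j b , w j b ⟩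
  ⟨combination,w⟩ c j b = begin
    ⟨ combination c , w j b ⟩
      ≈⟨ ⟨sumᵛ,⟩ (λ i → linComb (c i) (w i)) (w j b) ⟩
    sum (λ i → ⟨ linComb (c i) (w i) , w j b ⟩)
      ≈⟨ sum-cong (λ i → ⟨linComb,⟩ (c i) (w i) (w j b)) ⟩
    sum (λ i → sum (λ a → c i a *ᶜ ⟨ w i a , w j b ⟩))
      ≈⟨ sum-single j (λ i → sum (λ a → c i a *ᶜ ⟨ w i a , w j b ⟩)) (λ i i≢j → sum-zero (λ a → R.trans (R.*-congˡ (orthogonal a b i≢j)) (R.zeroʳ _))) ⟩
    sum (λ a → c j a *ᶜ ⟨ w j a , w j b ⟩)
      ≈⟨ sum-single b _ (λ a a≢b → R.trans (R.*-congˡ (orthogonal-row j a≢b)) (R.zeroʳ _)) ⟩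
    c j b *ᶜ ⟨ w j b , w j b ⟩ ∎
    where open ℂ-Reasoning

  -- Pairing with `w i a` leaves one coefficient times an invertible norm.
  combination-injective : ∀ c d → combination c ≈ᵛ combination d → ∀ i a → c i a ≈ᶜ d i a
  combination-injective c d h i a = x-y≈0⇒x≈y (invertible-cancel (norm i a) (begin
    N *ᶜ (c i a +ᶜ -ᶜ d i a)
      ≈⟨ solve 3 (λ n c d → n :* (c :+ :- d) := c :* n :+ :- (d :* n)) R.refl N _ _ ⟩
    c i a *ᶜ N +ᶜ -ᶜ (d i a *ᶜ N)
      ≈⟨ R.+-cong (⟨combination,w⟩ c i a) (R.-‿cong (⟨combination,w⟩ d i a)) ⟨
    ⟨ combination c , w i a ⟩ +ᶜ
      -ᶜ ⟨ combination d , w i a ⟩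
        ≈⟨ R.+-congʳ (⟨⟩-cong {v = w i a} h ≈ᵛ-refl) ⟩
    ⟨ combination d , w i a ⟩ +ᶜ
      -ᶜ ⟨ combination d , w i a ⟩
        ≈⟨ R.-‿inverseʳ _ ⟩
    0ᶜ ∎))
    where
    open ℂ-Reasoning
    open ℂ-Solver
    N : ℂ
    N = ⟨ w i a , w i a ⟩

  private
    only : ∀ i → (Fin (dim (typeOf i)) → ℂ) → Family
    only i c j with i ≟ᶠ j
    ... | yes refl = c
    ... | no _     = λ _ → 0ᶜ

    only-≡ : ∀ i c a → only i c i a ≡ c a
    only-≡ i c a with i ≟ᶠ i
    ... | yes refl = refl
    ... | no i≢i   = contradiction refl i≢i

    only-≢ : ∀ {i j} c a → i ≢ j → only i c j a ≡ 0ᶜ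
    only-≢ {i} {j} c a i≢j with i ≟ᶠ j
    ... | yes i≡j = contradiction i≡j i≢j
    ... | no _    = refl

    combination-only : ∀ i c → combination (only i c) ≈ᵛ linComb c (w i)
    combination-only i c y = R.trans
      (sum-single i (λ j → linComb (only i c j) (w j) y)
        (λ j j≢i → linComb-zero (w j) (λ a → ≡⇒≈ᶜ (only-≢ c a (λ e → j≢i (sym e)))) y))
      (sum-cong (λ a → R.*-congʳ (≡⇒≈ᶜ (only-≡ i c a))))

  w-independent : ∀ i c d → linComb c (w i) ≈ᵛ linComb d (w i) → ∀ a → c a ≈ᶜ d a
  w-independent i c d h a = R.trans (≡⇒≈ᶜ (sym (only-≡ i c a))) (R.trans
    (combination-injective (only i c) (only i d)
      (≈ᵛ-trans (combination-only i c) (≈ᵛ-trans h (≈ᵛ-sym (combination-only i d)))) i a)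
    (≡⇒≈ᶜ (only-≡ i d a)))

  -- The coefficients depend on the type of a summand and not on the summand: this uniformity makes
  -- summands of one type isomorphic.
  record Acts (B : Mat n n) (m : Coefficients ℂ) : Set where
    constructor acts
    field
      action : ∀ i k → B *ᵛ w i k ≈ᵛ linComb (λ a → m (typeOf i) a k) (w i)

  open Acts

  _≈ᵏ_ : Coefficients ℂ → Coefficients ℂ → Set
  m ≈ᵏ m′ = ∀ t a b → m t a b ≈ᶜ m′ t a b

  acts-cong : ∀ {B m m′} → m ≈ᵏ m′ → Acts B m → Acts B m′
  acts-cong h act = acts λ i k → ≈ᵛ-trans (action act i k)
    (linComb-cong {us = w i} (λ a → h (typeOf i) a k) (λ _ → ≈ᵛ-refl))

  acts-resp : ∀ {B C m} → B ≈ᵛ C → Acts B m → Acts C m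
  acts-resp h act = acts λ i k → ≈ᵛ-trans (*ᵛ-congʳ (w i k) (≈ᵛ-sym h)) (action act i k)

  acts-0 : Acts 0ᵛ (λ _ _ _ → 0ᶜ)
  acts-0 = acts λ i k → ≈ᵛ-trans (λ y → sum-zero (λ z → R.zeroˡ (w i k z)))
    (≈ᵛ-sym (linComb-zero (w i) (λ _ → R.refl)))

  acts-A : Acts A (λ t a b → fromℤ (Bℤ t a b))
  acts-A = acts A-action

  acts-1 : Acts 1ᵐ (λ _ a b → [ b ≟ᶠ a ]ᶜ)
  acts-1 = acts λ i k → ≈ᵛ-trans (1ᵐ-*ᵛ (w i k)) (≈ᵛ-sym (linComb-δˡ k (w i)))

  acts-E* : ∀ h → Acts (E* h) (λ t a b → [ a ≟ᶠ b ]ᶜ *ᶜ [ endpoint t ℕ.+ toℕ b ℕ.≟ h ]ᶜ)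
  acts-E* h = acts λ i k → ≈ᵛ-trans (E*-action h i k)
    (≈ᵛ-sym (linComb-δ· k [ endpoint (typeOf i) ℕ.+ toℕ k ℕ.≟ h ]ᶜ (w i)))

  acts-+ : ∀ {B C m m′} → Acts B m → Acts C m′ → Acts (B +ᵛ C) (λ t a b → m t a b +ᶜ m′ t a b)
  acts-+ {B} {C} act act′ = acts λ i k → ≈ᵛ-trans (*ᵛ-distribʳ-+ᵛ B C (w i k))
    (≈ᵛ-trans (+ᵛ-cong (action act i k) (action act′ i k)) (≈ᵛ-sym (linComb-+ _ _ (w i))))

  acts-· : ∀ c {B m} → Acts B m → Acts (c · B) (λ t a b → c *ᶜ m t a b)
  acts-· c {B} act = acts λ i k → ≈ᵛ-trans (·-*ᵛ c B (w i k))
    (≈ᵛ-trans (·-cong {c = c} R.refl (action act i k)) (≈ᵛ-sym (linComb-·ˡ c _ (w i))))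

  acts-* : ∀ {B C m m′} → Acts B m → Acts C m′ →
    Acts (B *ᵐ C) (λ t a b → sum (λ c → m′ t c b *ᶜ m t a c))
  acts-* {B} {C} {m} {m′} act act′ = acts λ i k → begin
    (B *ᵐ C) *ᵛ w i k
      ≈⟨ *ᵐ-*ᵛ B C (w i k) ⟩
    B *ᵛ C *ᵛ w i k
      ≈⟨ *ᵛ-congˡ B (action act′ i k) ⟩
    B *ᵛ linComb (λ c → m′ (typeOf i) c k) (w i)
      ≈⟨ *ᵛ-linComb B _ (w i) ⟩
    linComb (λ c → m′ (typeOf i) c k) (λ c → B *ᵛ w i c)
      ≈⟨ linComb-cong (λ _ → R.refl) (λ c → action act i c) ⟩
    linComb (λ c → m′ (typeOf i) c k)
      (λ c → linComb (λ a → m (typeOf i) a c) (w i))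
        ≈⟨ linComb-linComb _ (λ c a → m (typeOf i) a c) (w i) ⟩
    linComb (λ a → sum (λ c → m′ (typeOf i) c k *ᶜ m (typeOf i) a c)) (w i) ∎
    where open 𝕍-Reasoning

  acts-sum : {Bs : Fin l → Mat n n} {ms : Fin l → Coefficients ℂ} → (∀ j → Acts (Bs j) (ms j)) →
    Acts (sumᵛ Bs) (λ t a b → sum (λ j → ms j t a b))
  acts-sum {l} {Bs} {ms} hs = acts λ i k → begin
    sumᵛ Bs *ᵛ w i k
      ≈⟨ sumᵛ-*ᵛ Bs (w i k) ⟩
    sumᵛ (λ j → Bs j *ᵛ w i k)
      ≈⟨ (λ y → sum-cong (λ j → action (hs j) i k y)) ⟩
    sumᵛ (λ j → linComb (λ a → ms j (typeOf i) a k) (w i))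
      ≈⟨ sumᵛ-linComb (λ j a → ms j (typeOf i) a k) (w i) ⟩
    linComb (λ a → sum (λ j → ms j (typeOf i) a k)) (w i) ∎
    where open 𝕍-Reasoning

  -- The representation of `T` in the block algebra, by induction on how `B` is generated.
  acts-∈T : ∀ {B} → B ∈ T → ∃[ m ] Acts B m
  acts-∈T A∈ = _ , acts-A
  acts-∈T (E*∈ h _) = _ , acts-E* h
  acts-∈T 1∈ = _ , acts-1
  acts-∈T (+∈ p q) = let _ , f = acts-∈T p ; _ , g = acts-∈T q in _ , acts-+ f g
  acts-∈T (·∈ c p) = let _ , f = acts-∈T p in _ , acts-· c f
  acts-∈T (*∈ p q) = let _ , f = acts-∈T p ; _ , g = acts-∈T q in _ , acts-* f g
  acts-∈T (resp h p) = let _ , f = acts-∈T p in _ , acts-resp h f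

  -- Faithfulness: the vectors `w i k` span `V`. It reduces identities between matrices, such as
  -- `*ᵐ-e` and `unity`, to identities between coefficients.
  acts⇒≈ : ∀ {B C m m′} → Acts B m → Acts C m′ → m ≈ᵏ m′ → B ≈ᵛ C
  acts⇒≈ {B} {C} {m} {m′} act act′ h = *ᵛ-faithful B C λ v → let c , v≈ = w-spanning v in begin
    B *ᵛ v
      ≈⟨ *ᵛ-congˡ B v≈ ⟩
    B *ᵛ combination c
      ≈⟨ *ᵛ-sumᵛ B (λ i → linComb (c i) (w i)) ⟩
    sumᵛ (λ i → B *ᵛ linComb (c i) (w i))
      ≈⟨ (λ y → sum-cong (λ i → agree c i y)) ⟩
    sumᵛ (λ i → C *ᵛ linComb (c i) (w i))
      ≈⟨ *ᵛ-sumᵛ C (λ i → linComb (c i) (w i)) ⟨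
    C *ᵛ combination c
      ≈⟨ *ᵛ-congˡ C v≈ ⟨
    C *ᵛ v ∎
    where
    open 𝕍-Reasoning
    agree : ∀ c i → B *ᵛ linComb (c i) (w i) ≈ᵛ C *ᵛ linComb (c i) (w i)
    agree c i = ≈ᵛ-trans (*ᵛ-linComb B (c i) (w i)) (≈ᵛ-trans
      (linComb-cong {c = c i} (λ _ → R.refl) (λ k → ≈ᵛ-trans (action (acts-cong h act) i k) (≈ᵛ-sym (action act′ i k))))
      (≈ᵛ-sym (*ᵛ-linComb C (c i) (w i))))

  ≈⇒≈ᵏ : ∀ {B m m′} → Acts B m → Acts B m′ → m ≈ᵏ m′
  ≈⇒≈ᵏ {B} {m} {m′} act act′ = λ where
      -- The first summand of each type determines the block of that type.
      I   → same 0F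
      II  → same 1F
      III → same 3F
      IV  → same 5F
    where
    same : ∀ i a b → m (typeOf i) a b ≈ᶜ m′ (typeOf i) a b
    same i a b = w-independent i _ _ (≈ᵛ-trans (≈ᵛ-sym (action act i b)) (action act′ i b)) a

  -- The matrix units of T

  ⟦_⟧ : Expr → Mat n n
  ⟦ `A ⟧     = A
  ⟦ `E h ⟧   = E* (toℕ h)
  ⟦ e ⊕ f ⟧  = ⟦ e ⟧ +ᵛ ⟦ f ⟧
  ⟦ e ⊗ f ⟧  = ⟦ e ⟧ *ᵐ ⟦ f ⟧
  ⟦ i ⊙ e ⟧  = fromℤ i · ⟦ e ⟧

  ⟦⟧∈T : ∀ e → ⟦ e ⟧ ∈ T
  ⟦⟧∈T `A      = A∈
  ⟦⟧∈T (`E h)  = E*∈ (toℕ h) (ℕ.≤-pred (Fin.toℕ<n h))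
  ⟦⟧∈T (e ⊕ f) = +∈ (⟦⟧∈T e) (⟦⟧∈T f)
  ⟦⟧∈T (e ⊗ f) = *∈ (⟦⟧∈T e) (⟦⟧∈T f)
  ⟦⟧∈T (i ⊙ e) = ·∈ (fromℤ i) (⟦⟧∈T e)

  acts-⟦⟧ : ∀ e → Acts ⟦ e ⟧ (λ t a b → fromℤ (coefficient e t a b))
  acts-⟦⟧ `A      = acts-A
  acts-⟦⟧ (`E h)  = acts-cong (λ t a b → R.sym (R.trans
      (fromℤ-* (δℤ (a ≟ᶠ b)) (δℤ (endpoint t ℕ.+ toℕ b ℕ.≟ toℕ h)))
      (R.*-cong (≡⇒≈ᶜ (fromℤ-δ (a ≟ᶠ b))) (≡⇒≈ᶜ (fromℤ-δ (endpoint t ℕ.+ toℕ b ℕ.≟ toℕ h))))))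
    (acts-E* (toℕ h))
  acts-⟦⟧ (e ⊕ f) = acts-cong
    (λ t a b → R.sym (fromℤ-+ (coefficient e t a b) (coefficient f t a b))) (acts-+ (acts-⟦⟧ e) (acts-⟦⟧ f))
  acts-⟦⟧ (e ⊗ f) = acts-cong
    (λ t a b → R.sym (R.trans (fromℤ-sum (λ c → coefficient f t c b ℤ.* coefficient e t a c))
      (sum-cong (λ c → fromℤ-* (coefficient f t c b) (coefficient e t a c)))))
    (acts-* (acts-⟦⟧ e) (acts-⟦⟧ f))
  acts-⟦⟧ (i ⊙ e) = acts-cong
    (λ t a b → R.sym (fromℤ-* i (coefficient e t a b))) (acts-· (fromℤ i) (acts-⟦⟧ e))

  private
    sixth : ∃[ c ] fromℤ (ℤ.+ 6) *ᶜ c ≈ᶜ 1ᶜ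
    sixth = fromℤ-invertible (λ ())

  opaque
    -- Opaque, so that only membership in `T` and the action remain visible, and not the polynomial
    -- behind the unit.
    e : Unit → Mat n n
    e p = proj₁ sixth · ⟦ sixUnit p ⟧

    e∈T : ∀ p → e p ∈ T
    e∈T p = ·∈ (proj₁ sixth) (⟦⟧∈T (sixUnit p))

    acts-e : ∀ p → Acts (e p) (𝟙 p)
    acts-e p = acts-cong (λ t a b → begin
        proj₁ sixth *ᶜ fromℤ (coefficient (sixUnit p) t a b)
          ≈⟨ R.*-congˡ (≡⇒≈ᶜ (cong fromℤ (sixUnit-coefficient (proj₁ p) (proj₁ (proj₂ p)) (proj₂ (proj₂ p)) t a b))) ⟩
        proj₁ sixth *ᶜ fromℤ (ℤ.+ 6 ℤ.* δℤ (index p ≟ᶠ index (t , a , b)))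
            ≈⟨ R.*-congˡ (fromℤ-* (ℤ.+ 6) _) ⟩
        proj₁ sixth *ᶜ (fromℤ (ℤ.+ 6) *ᶜ fromℤ (δℤ (index p ≟ᶠ index (t , a , b))))
            ≈⟨ R.*-assoc _ _ _ ⟨
        proj₁ sixth *ᶜ fromℤ (ℤ.+ 6) *ᶜ fromℤ (δℤ (index p ≟ᶠ index (t , a , b)))
            ≈⟨ R.*-cong (R.trans (R.*-comm _ _) (proj₂ sixth)) (≡⇒≈ᶜ (fromℤ-δ (index p ≟ᶠ index (t , a , b)))) ⟩
        1ᶜ *ᶜ 𝟙 p t a b
          ≈⟨ R.*-identityˡ _ ⟩
        𝟙 p t a b ∎)
      (acts-· (proj₁ sixth) (acts-⟦⟧ (sixUnit p)))
      where open ℂ-Reasoning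

  -- Left multiplication recombines the units of one column with the entries of `m`. Therefore the
  -- images of any vector under a column of units transform like a listed basis.
  *ᵐ-e : ∀ {B m} → Acts B m → ∀ t k l → B *ᵐ e (t , k , l) ≈ᵛ linComb (λ a → m t a k) (λ a → e (t , a , l))
  *ᵐ-e {B} {m} act t k l = acts⇒≈ (acts-* act (acts-e (t , k , l)))
      (acts-sum (λ a′ → acts-· (m t a′ k) (acts-e (t , a′ , l)))) agree
    where
    open ℂ-Reasoning
    agree : ∀ s a b → sum (λ c → 𝟙 (t , k , l) s c b *ᶜ m s a c) ≈ᶜ sum (λ a′ → m t a′ k *ᶜ 𝟙 (t , a′ , l) s a b)
    agree s a b with t ≟ᵗ s
    ... | no t≢s = R.trans
      (sum-zero (λ c → R.trans (R.*-congʳ (≡⇒≈ᶜ (𝟙-≢ {a = k} {l} {c} {b} t≢s))) (R.zeroˡ _)))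
      (R.sym (sum-zero (λ a′ → R.trans (R.*-congˡ (≡⇒≈ᶜ (𝟙-≢ {a = a′} {l} {a} {b} t≢s))) (R.zeroʳ _))))
    ... | yes refl = begin
      sum (λ c → 𝟙 (t , k , l) t c b *ᶜ m t a c)
        ≈⟨ sum-cong (λ c → R.trans (R.*-congʳ (𝟙-≡ t k l c b))
             (solve 3 (λ p q r → p :* q :* r := q :* (p :* r)) R.refl [ l ≟ᶠ b ]ᶜ [ k ≟ᶠ c ]ᶜ (m t a c))) ⟩
      sum (λ c → [ k ≟ᶠ c ]ᶜ *ᶜ ([ l ≟ᶠ b ]ᶜ *ᶜ m t a c))
        ≈⟨ sum-δˡ k (λ c → [ l ≟ᶠ b ]ᶜ *ᶜ m t a c) ⟩
      [ l ≟ᶠ b ]ᶜ *ᶜ m t a k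
        ≈⟨ R.*-comm _ _ ⟩
      m t a k *ᶜ [ l ≟ᶠ b ]ᶜ
        ≈⟨ sum-δʳ a (λ a′ → m t a′ k *ᶜ [ l ≟ᶠ b ]ᶜ) ⟨
      sum (λ a′ → m t a′ k *ᶜ [ l ≟ᶠ b ]ᶜ *ᶜ [ a′ ≟ᶠ a ]ᶜ)
        ≈⟨ sum-cong (λ a′ → R.trans (R.*-assoc (m t a′ k) [ l ≟ᶠ b ]ᶜ [ a′ ≟ᶠ a ]ᶜ) (R.*-congˡ (R.sym (𝟙-≡ t a′ l a b)))) ⟩
      sum (λ a′ → m t a′ k *ᶜ 𝟙 (t , a′ , l) t a b) ∎
      where open ℂ-Solver

  allTypes : Fin 4 → SummandType
  allTypes = lookup (I ∷ II ∷ III ∷ IV ∷ [])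

  private
    position : SummandType → Fin 4
    position I   = 0F
    position II  = 1F
    position III = 2F
    position IV  = 3F

    allTypes-position : ∀ t → allTypes (position t) ≡ t
    allTypes-position I   = refl
    allTypes-position II  = refl
    allTypes-position III = refl
    allTypes-position IV  = refl

    position-allTypes : ∀ q → position (allTypes q) ≡ q
    position-allTypes 0F = refl
    position-allTypes 1F = refl
    position-allTypes 2F = refl
    position-allTypes 3F = refl

  unity : 1ᵐ ≈ᵛ sumᵛ (λ q → sumᵛ (λ a → e (allTypes q , a , a)))
  unity = acts⇒≈ acts-1 (acts-sum (λ q → acts-sum (λ a → acts-e (allTypes q , a , a)))) agree
    where
    diagonal : ∀ t s c d → t ≡ s → sum (λ a → 𝟙 (t , a , a) s c d) ≈ᶜ [ d ≟ᶠ c ]ᶜ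
    diagonal t .t c d refl = R.trans (sum-cong (λ a → 𝟙-≡ t a a c d)) (R.trans
      (sum-single d _ (λ a a≢d → R.trans (R.*-congʳ (δ-≢ a≢d)) (R.zeroˡ _)))
      (R.trans (R.*-congʳ (δ-refl d)) (R.*-identityˡ _)))
    agree : ∀ t c d → [ d ≟ᶠ c ]ᶜ ≈ᶜ sum (λ q → sum (λ a → 𝟙 (allTypes q , a , a) t c d))
    agree t c d = R.sym (R.trans
      (sum-single (position t) (λ q → sum (λ a → 𝟙 (allTypes q , a , a) t c d)) (λ q q≢ → sum-zero (λ a → ≡⇒≈ᶜ (𝟙-≢ {a = a} {a} {c} {d}
        (λ e → q≢ (trans (sym (position-allTypes q)) (cong position e)))))))
      (diagonal (allTypes (position t)) t c d (allTypes-position t)))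

  -- By `unity`, `v` is the sum of its images under the diagonal units, and a nonzero sum has a
  -- nonzero term.
  nonZero-row : ∀ {v} → NonZero v → ∃[ t ] ∃[ a ] NonZero (e (t , a , a) *ᵛ v)
  nonZero-row {v} v≢0 =
    let q , h = NonZero-sumᵛ (λ q → sumᵛ (λ a → e (allTypes q , a , a)) *ᵛ v) (NonZero-resp (≈ᵛ-trans (≈ᵛ-sym (1ᵐ-*ᵛ v)) (≈ᵛ-trans (*ᵛ-congʳ v unity)
          (sumᵛ-*ᵛ (λ q → sumᵛ (λ a → e (allTypes q , a , a))) v))) v≢0)
        a , h′ = NonZero-sumᵛ (λ a → e (allTypes q , a , a) *ᵛ v) (NonZero-resp (sumᵛ-*ᵛ (λ a → e (allTypes q , a , a)) v) h)
    in allTypes q , a , h′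

  -- The coordinates of `B` in the units are its coefficients: that the coefficients are determined
  -- by the matrix gives independence, that they determine it gives spanning.
  T-dimension : HasDimension T 15
  T-dimension = e ∘ unit , record
    { members     = λ j → e∈T (unit j)
    ; independent = λ c h j → R.trans (R.sym (collapse c (unit j) j (index-unit j)))
        (≈⇒≈ᵏ {B = 0ᵛ} (acts-resp h (acts-sum (λ j → acts-· (c j) (acts-e (unit j)))))
          acts-0
          (proj₁ (unit j)) (proj₁ (proj₂ (unit j))) (proj₂ (proj₂ (unit j))))
    ; spanning    = λ B∈ → let m , act = acts-∈T B∈ in
        family m , acts⇒≈ act (acts-sum (λ j → acts-· (family m j) (acts-e (unit j)))) (λ t a b →
          R.sym (R.trans (collapse (family m) (t , a , b) (index (t , a , b)) refl)
            (≡⇒≈ᶜ (cong (λ (s , c , d) → m s c d) (unit-index (t , a , b))))))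
    }
    where
    family : Coefficients ℂ → Fin 15 → ℂ
    family m j = m (proj₁ (unit j)) (proj₁ (proj₂ (unit j))) (proj₂ (proj₂ (unit j)))
    collapse : ∀ (c : Fin 15 → ℂ) p j → index p ≡ j →
      sum (λ k → c k *ᶜ 𝟙 (unit k) (proj₁ p) (proj₁ (proj₂ p)) (proj₂ (proj₂ p))) ≈ᶜ c j
    collapse c p j refl = R.trans
      (sum-cong (λ k → R.*-congˡ {c k} (≡⇒≈ᶜ (cong (λ q → [ q ≟ᶠ index p ]ᶜ) (index-unit k)))))
      (sum-δʳ (index p) c)

-- Cardinalities of decidable sets

∣_∣? : {P : Fin n → Set} → (∀ i → Dec (P i)) → ℕ
∣ P? ∣? = ∣ tabulate (λ i → does (P? i)) ∣

∈-tabulate : {P : Fin n → Set} (P? : ∀ i → Dec (P i)) → ∀ i → i ∈ˢ tabulate (λ i → does (P? i)) ⇔ P i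
∈-tabulate {P = P} P? i = mk⇔ to from
  where
  to : i ∈ˢ tabulate (λ i → does (P? i)) → P i
  to i∈ with P? i | trans (sym (Vec.lookup∘tabulate (λ i → does (P? i)) i)) (Vec.[]=⇒lookup i∈)
  ... | yes p | _ = p
  from : P i → i ∈ˢ tabulate (λ i → does (P? i))
  from p = Vec.lookup⇒[]= i _ (trans (Vec.lookup∘tabulate (λ i → does (P? i)) i) (dec-true (P? i) p))

decidable⇒cardinality : {P Q : Fin n → Set} (P? : ∀ i → Dec (P i)) → (∀ i → P i ⇔ Q i) →
  HasCardinality Q ∣ P? ∣?
decidable⇒cardinality P? P⇔Q =
  tabulate (λ i → does (P? i)) ,
  (λ i → mk⇔ (to (P⇔Q i) ∘ to (∈-tabulate P? i)) (from (∈-tabulate P? i) ∘ from (P⇔Q i))) , refl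
  where open Equivalence using (to; from)

-- Turns a count into a sum of diagonal entries, that is, into a trace.
sum-[]ᶜ : {P : Fin n → Set} (P? : ∀ i → Dec (P i)) → sum (λ i → [ P? i ]ᶜ) ≈ᶜ fromℤ (ℤ.+ ∣ P? ∣?)
sum-[]ᶜ {zero}  P? = R.refl
sum-[]ᶜ {suc n} P? with P? zero
... | yes _ = R.trans (R.+-congˡ (sum-[]ᶜ (λ i → P? (suc i)))) (R.sym (fromℤ-+ ℤ.1ℤ (ℤ.+ ∣ (λ i → P? (suc i)) ∣?)))
... | no _  = R.trans (R.+-identityˡ _) (sum-[]ᶜ (λ i → P? (suc i)))

support? : ∀ t (i : Fin 3) → Dec (∃[ a ] endpoint t ℕ.+ toℕ {dim t} a ≡ toℕ i)
support? t i = any? (λ a → endpoint t ℕ.+ toℕ a ℕ.≟ toℕ i)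

module Modules {Γ : Graph n} {x : Fin n} (M : Model Γ x) where
  open Terwilliger Γ 2 x
  open Model M
  open Theory M
  open Acts

  -- A frame consists of the images of one vector under a column of matrix units.

  record IsFrame (t : SummandType) (b : Fin (dim t) → V) : Set where
    field
      e-action : ∀ a c k → e (t , a , c) *ᵛ b k ≈ᵛ [ c ≟ᶠ k ]ᶜ · b a
      someNonZero : ∃[ a ] NonZero (b a)

    -- The diagonal unit at `k` fixes `b k`, so `B` may be replaced by its product with that unit,
    -- which is a combination of units in column `k`.
    action-frame : ∀ {B m} → Acts B m → ∀ k → B *ᵛ b k ≈ᵛ linComb (λ a → m t a k) b
    action-frame {B} {m} act k = begin
      B *ᵛ b k
        ≈⟨ *ᵛ-congˡ B (diagonal k k) ⟨
      B *ᵛ e (t , k , k) *ᵛ b k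
        ≈⟨ *ᵐ-*ᵛ B (e (t , k , k)) (b k) ⟨
      (B *ᵐ e (t , k , k)) *ᵛ b k
        ≈⟨ *ᵛ-congʳ (b k) (*ᵐ-e act t k k) ⟩
      linComb (λ a → m t a k) (λ a → e (t , a , k)) *ᵛ b k
        ≈⟨ linComb-*ᵛ (λ a → m t a k) (λ a → e (t , a , k)) (b k) ⟩
      linComb (λ a → m t a k) (λ a → e (t , a , k) *ᵛ b k)
        ≈⟨ linComb-cong {c = λ a → m t a k} (λ _ → R.refl) (λ a → diagonal a k) ⟩
      linComb (λ a → m t a k) b ∎
      where
      open 𝕍-Reasoning
      diagonal : ∀ a k → e (t , a , k) *ᵛ b k ≈ᵛ b a
      diagonal a k = ≈ᵛ-trans (e-action a k k)
        (≈ᵛ-trans (·-cong {v = b a} (δ-refl k) ≈ᵛ-refl) (·-identity (b a)))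

    e-combination : ∀ a c (d : Fin (dim t) → ℂ) → e (t , a , c) *ᵛ linComb d b ≈ᵛ d c · b a
    e-combination a c d = begin
      e (t , a , c) *ᵛ linComb d b
        ≈⟨ *ᵛ-linComb (e (t , a , c)) d b ⟩
      linComb d (λ k → e (t , a , c) *ᵛ b k)
        ≈⟨ linComb-cong {c = d} (λ _ → R.refl) (e-action a c) ⟩
      linComb d (λ k → [ c ≟ᶠ k ]ᶜ · b a)
        ≈⟨ linComb-single d _ c (λ k k≢c → inj₂ (·-zeroˡ (b a) (δ-≢ (λ e → k≢c (sym e))))) ⟩
      d c · ([ c ≟ᶠ c ]ᶜ · b a)
        ≈⟨ ·-cong {c = d c} R.refl (≈ᵛ-trans (·-cong {v = b a} (δ-refl c) ≈ᵛ-refl) (·-identity (b a))) ⟩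
      d c · b a ∎
      where open 𝕍-Reasoning

    fixed : ∀ a → e (t , a , a) *ᵛ b a ≈ᵛ b a
    fixed a = ≈ᵛ-trans (e-action a a a)
      (≈ᵛ-trans (·-cong {v = b a} (δ-refl a) ≈ᵛ-refl) (·-identity (b a)))

    apply-combination : ∀ {B m} → Acts B m → ∀ c →
      B *ᵛ linComb c b ≈ᵛ linComb (λ a → sum (λ j → c j *ᶜ m t a j)) b
    apply-combination {B} {m} act c = ≈ᵛ-trans (*ᵛ-linComb B c b)
      (≈ᵛ-trans (linComb-cong {c = c} (λ _ → R.refl) (action-frame act)) (linComb-linComb c (λ j a → m t a j) b))

    e-other : ∀ {s} → s ≢ t → ∀ a c (d : Fin (dim t) → ℂ) → e (s , a , c) *ᵛ linComb d b ≈ᵛ 0ᵛ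
    e-other {s} s≢t a c d = begin
      e (s , a , c) *ᵛ linComb d b
        ≈⟨ *ᵛ-linComb (e (s , a , c)) d b ⟩
      linComb d (λ k → e (s , a , c) *ᵛ b k)
        ≈⟨ linComb-cong {c = d} (λ _ → R.refl) (λ k → ≈ᵛ-trans (action-frame (acts-e (s , a , c)) k)
           (linComb-zero b (λ a′ → ≡⇒≈ᶜ (𝟙-≢ {a = a} {c} {a′} {k} s≢t)))) ⟩
      linComb d (λ _ → 0ᵛ)
        ≈⟨ (λ y → sum-zero (λ k → R.zeroʳ (d k))) ⟩
      0ᵛ ∎
      where open 𝕍-Reasoning

    -- The unit in row `a` and column `j` moves the coefficient at `j` onto `b a`, so a single
    -- nonzero member detects all coefficients.
    independent-≈ : ∀ c d → linComb c b ≈ᵛ linComb d b → ∀ j → c j ≈ᶜ d j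
    independent-≈ c d h j = let a , ba≢0 = someNonZero in
      x-y≈0⇒x≈y (NonZero-cancel {v = b a} ba≢0 (λ y → begin
        (c j +ᶜ -ᶜ d j) *ᶜ b a y
          ≈⟨ solve 3 (λ c d v → (c :+ :- d) :* v := c :* v :+ :- (d :* v)) R.refl (c j) (d j) (b a y) ⟩
        c j *ᶜ b a y +ᶜ -ᶜ (d j *ᶜ b a y)
          ≈⟨ R.+-congʳ (≈ᵛ-trans (≈ᵛ-sym (e-combination a j c))
             (≈ᵛ-trans (*ᵛ-congˡ (e (t , a , j)) h) (e-combination a j d)) y) ⟩
        d j *ᶜ b a y +ᶜ -ᶜ (d j *ᶜ b a y)
          ≈⟨ R.-‿inverseʳ _ ⟩
        0ᶜ ∎))
      where
      open ℂ-Reasoning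
      open ℂ-Solver

    independent : ∀ c → linComb c b ≈ᵛ 0ᵛ → ∀ j → c j ≈ᶜ 0ᶜ
    independent c h = independent-≈ c (λ _ → 0ᶜ) (≈ᵛ-trans h (≈ᵛ-sym (linComb-zero b (λ _ → R.refl))))

    -- A frame names only one nonzero member; cancelling an arbitrary `b a` goes through
    -- independence instead.
    row-cancel : ∀ a {c d} → c · b a ≈ᵛ d · b a → c ≈ᶜ d
    row-cancel a {c} {d} h = begin
      c
        ≈⟨ R.*-identityʳ c ⟨
      c *ᶜ 1ᶜ
        ≈⟨ R.*-congˡ δ ⟨
      c *ᶜ [ a ≟ᶠ a ]ᶜ
        ≈⟨ independent-≈ (λ j → c *ᶜ [ a ≟ᶠ j ]ᶜ) (λ j → d *ᶜ [ a ≟ᶠ j ]ᶜ)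
           (≈ᵛ-trans (scaled c) (≈ᵛ-trans h (≈ᵛ-sym (scaled d)))) a ⟩
      d *ᶜ [ a ≟ᶠ a ]ᶜ
        ≈⟨ R.*-congˡ δ ⟩
      d *ᶜ 1ᶜ
        ≈⟨ R.*-identityʳ d ⟩
      d ∎
      where
      open ℂ-Reasoning
      δ : [ a ≟ᶠ a ]ᶜ ≈ᶜ 1ᶜ
      δ = ≡⇒≈ᶜ ([ a ≟ᶠ a ]-yes refl)
      scaled : ∀ c → linComb (λ j → c *ᶜ [ a ≟ᶠ j ]ᶜ) b ≈ᵛ c · b a
      scaled c = ≈ᵛ-trans (linComb-·ˡ c (λ j → [ a ≟ᶠ j ]ᶜ) b) (·-cong {c = c} R.refl (linComb-δˡ a b))

  w-frame : ∀ i → IsFrame (typeOf i) (w i)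
  w-frame i = record
    { e-action = λ a c k → ≈ᵛ-trans (action (acts-e (typeOf i , a , c)) i k) (≈ᵛ-trans
        (linComb-cong {us = w i} (λ a′ → R.trans (𝟙-≡ (typeOf i) a c a′ k) (R.*-comm _ _)) (λ _ → ≈ᵛ-refl))
        (≈ᵛ-trans (linComb-single (λ a′ → [ a ≟ᶠ a′ ]ᶜ *ᶜ [ c ≟ᶠ k ]ᶜ) (w i) a
          (λ j j≢a → inj₁ (R.trans (R.*-congʳ (δ-≢ (λ e → j≢a (sym e)))) (R.zeroˡ _))))
          (·-cong {v = w i a} (R.trans (R.*-congʳ (δ-refl a)) (R.*-identityˡ _)) ≈ᵛ-refl)))
    ; someNonZero = row₀ (typeOf i) , w-nonZero i (row₀ (typeOf i)) }

  -- The multiplication rule of matrix units: a product of two units is nonzero only if the inner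
  -- indices agree, and then it keeps the outer ones.
  column-frame : ∀ {t a v} → NonZero (e (t , a , a) *ᵛ v) → IsFrame t (λ k → e (t , k , a) *ᵛ v)
  column-frame {t} {a} {v} h = record { someNonZero = a , h ; e-action = λ a′ c k → begin
      e (t , a′ , c) *ᵛ e (t , k , a) *ᵛ v
        ≈⟨ *ᵐ-*ᵛ (e (t , a′ , c)) (e (t , k , a)) v ⟨
      (e (t , a′ , c) *ᵐ e (t , k , a)) *ᵛ v
        ≈⟨ *ᵛ-congʳ v (*ᵐ-e (acts-e (t , a′ , c)) t k a) ⟩
      linComb (λ l → 𝟙 (t , a′ , c) t l k) (λ l → e (t , l , a)) *ᵛ v
        ≈⟨ linComb-*ᵛ (λ l → 𝟙 (t , a′ , c) t l k) (λ l → e (t , l , a)) v ⟩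
      linComb (λ l → 𝟙 (t , a′ , c) t l k) (λ l → e (t , l , a) *ᵛ v)
        ≈⟨ linComb-single _ _ a′ (λ l l≢a′ → inj₁ (R.trans (𝟙-≡ t a′ c l k)
             (R.trans (R.*-congˡ (δ-≢ (λ e → l≢a′ (sym e)))) (R.zeroʳ _)))) ⟩
      𝟙 (t , a′ , c) t a′ k · (e (t , a′ , a) *ᵛ v)
        ≈⟨ ·-cong (R.trans (𝟙-≡ t a′ c a′ k) (R.trans (R.*-congˡ (δ-refl a′)) (R.*-identityʳ _))) ≈ᵛ-refl ⟩
      [ c ≟ᶠ k ]ᶜ · (e (t , a′ , a) *ᵛ v) ∎ }
    where open 𝕍-Reasoning

  record Framed (W : TModule) (t : SummandType) (b : Fin (dim t) → V) : Set where
    field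
      isFrame : IsFrame t b
      members : ∀ k → b k ∈ Carrier W
      spans   : ∀ {v} → v ∈ Carrier W → ∃[ c ] v ≈ᵛ linComb c b
    open IsFrame isFrame public

    isBasis : IsBasis (Carrier W) b
    isBasis = record { members = members ; independent = independent ; spanning = spans }

  Span : ∀ {t b} → IsFrame t b → TModule
  Span {t} {b} F = record
    { Carrier = λ v → ∃[ c ] v ≈ᵛ linComb c b
    ; isSubspace = record
      { resp = λ { u≈v (c , h) → c , ≈ᵛ-trans (≈ᵛ-sym u≈v) h }
      ; 0∈   = (λ _ → 0ᶜ) , ≈ᵛ-sym (linComb-zero b (λ _ → R.refl))
      ; +∈   = λ { (c , h) (d , k) → (λ j → c j +ᶜ d j) , ≈ᵛ-trans (+ᵛ-cong h k) (≈ᵛ-sym (linComb-+ c d b)) }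
      ; ·∈   = λ { a (c , h) → (λ j → a *ᶜ c j) , ≈ᵛ-trans (·-cong {c = a} R.refl h) (≈ᵛ-sym (linComb-·ˡ a c b)) }
      }
    ; closed = λ { {B} B∈ (c , h) → let m , act = acts-∈T B∈ in
        (λ a → sum (λ j → c j *ᶜ m t a j)) , ≈ᵛ-trans (*ᵛ-congˡ B h) (IsFrame.apply-combination F act c) }
    }

  Span-framed : ∀ {t b} (F : IsFrame t b) → Framed (Span F) t b
  Span-framed {b = b} F = record
    { isFrame = F
    ; members = λ k → (λ j → [ k ≟ᶠ j ]ᶜ) , ≈ᵛ-sym (linComb-δˡ k b)
    ; spans   = λ h → h }

  -- A nonzero vector of a submodule has an invertible coordinate, say at `j`. The units in column
  -- `j`, divided by that coordinate, carry the vector to every member of the frame.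
  framed⇒irreducible : ∀ {W t b} → Framed W t b → Irreducible W
  framed⇒irreducible {W} {t} {b} F =
      (let a , ba≢0 = someNonZero in b a , members a , ba≢0) ,
      λ U U⊆W (u , u∈U , u≢0) {v} v∈W →
        let module U = TModule U
            module US = IsSubspace U.isSubspace
            c , u≈ = spans (U⊆W u∈U)
            j , cbj≢0 = NonZero-sumᵛ (λ j → c j · b j) (NonZero-resp u≈ u≢0)
            d , cd≈1 = NonZero-·⇒invertible {v = b j} cbj≢0
            b∈U : ∀ a → b a ∈ Carrier U
            b∈U a = US.resp (≈ᵛ-trans (·-cong {c = d} R.refl (≈ᵛ-trans (*ᵛ-congˡ (e (t , a , j)) u≈) (e-combination a j c)))
              (≈ᵛ-trans (·-· d (c j) (b a)) (≈ᵛ-trans (·-cong {v = b a} (R.trans (R.*-comm d (c j)) cd≈1) ≈ᵛ-refl) (·-identity (b a)))))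
              (US.·∈ d (U.closed (e∈T (t , a , j)) u∈U))
            c′ , v≈ = spans v∈W
        in US.resp (≈ᵛ-sym v≈) (linComb∈ U.isSubspace c′ b b∈U)
    where open Framed F

  irreducible⇒framed : ∀ U → Irreducible U → Σ SummandType λ t → Σ (Fin (dim t) → V) λ b → Framed U t b
  irreducible⇒framed U ((v , v∈U , v≢0) , minimal) =
    let t , a , h = nonZero-row v≢0
        F = column-frame {t} {a} {v} h
        module U = TModule U
        b∈U : ∀ k → (e (t , k , a) *ᵛ v) ∈ Carrier U
        b∈U k = U.closed (e∈T (t , k , a)) v∈U
    in t , (λ k → e (t , k , a) *ᵛ v) , record
      { isFrame = F
      ; members = b∈U
      ; spans   = λ u∈U → minimal (Span F)
          (λ { (c , u≈) → IsSubspace.resp U.isSubspace (≈ᵛ-sym u≈) (linComb∈ U.isSubspace c _ b∈U) })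
          (e (t , a , a) *ᵛ v , Framed.members (Span-framed F) a , h) u∈U }

  -- Vectors with equal coordinates correspond; every element of `T` transforms both sets of
  -- coordinates by the same block.
  framed⇒≅ : ∀ {U W t b b′} → Framed U t b → Framed W t b′ → U ≅ W
  framed⇒≅ {U} {W} {t} {b} {b′} F G = record
    { to = to
    ; isIsomorphism = record
      { isLeftModuleMonomorphism = record
        { isLeftModuleHomomorphism = record
          { +ᴹ-isGroupHomomorphism = record
            { isMonoidHomomorphism = record
              { isMagmaHomomorphism = record
                { isRelHomomorphism = record { cong = λ {u} {v} h → to-≈ u (coords v) (≈ᵛ-trans h (coords-≈ v)) }
                ; homo = λ u v → ≈ᵛ-trans (to-≈ _ (λ j → coords u j +ᶜ coords v j)
                    (≈ᵛ-trans (+ᵛ-cong (coords-≈ u) (coords-≈ v)) (≈ᵛ-sym (linComb-+ (coords u) (coords v) b))))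
                    (linComb-+ (coords u) (coords v) b′) }
              ; ε-homo = ≈ᵛ-trans (to-≈ _ (λ _ → 0ᶜ) (≈ᵛ-sym (linComb-zero b (λ _ → R.refl))))
                  (linComb-zero b′ (λ _ → R.refl)) }
            ; ⁻¹-homo = scale (-ᶜ 1ᶜ) }
          ; *ₗ-homo = scale }
        ; injective = λ {u} {v} h → ≈ᵛ-trans (coords-≈ u) (≈ᵛ-trans
            (linComb-cong {us = b} (G.independent-≈ (coords u) (coords v) h) (λ _ → ≈ᵛ-refl)) (≈ᵛ-sym (coords-≈ v))) }
      ; surjective = λ { (v , v∈W) → let c , v≈ = G.spans v∈W in
          (linComb c b , linComb∈ U.isSubspace c b F.members) ,
          λ {z} z≈ → ≈ᵛ-trans (to-≈ z c z≈) (≈ᵛ-sym v≈) } }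
    ; commutes = λ {B} B∈T u → let m , act = acts-∈T B∈T in
        ≈ᵛ-trans (to-≈ _ _ (≈ᵛ-trans (*ᵛ-congˡ B (coords-≈ u)) (F.apply-combination act (coords u))))
          (≈ᵛ-sym (G.apply-combination act (coords u)))
    }
    where
    module U = TModule U
    module W = TModule W
    module F = Framed F
    module G = Framed G
    coords : ∃ (Carrier U) → Fin (dim t) → ℂ
    coords (_ , u∈) = proj₁ (F.spans u∈)
    coords-≈ : ∀ u → proj₁ u ≈ᵛ linComb (coords u) b
    coords-≈ (_ , u∈) = proj₂ (F.spans u∈)
    to : ∃ (Carrier U) → ∃ (Carrier W)
    to u = linComb (coords u) b′ , linComb∈ W.isSubspace (coords u) b′ G.members
    to-≈ : ∀ u c → proj₁ u ≈ᵛ linComb c b → proj₁ (to u) ≈ᵛ linComb c b′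
    to-≈ u c h = linComb-cong {us = b′}
      (F.independent-≈ (coords u) c (≈ᵛ-trans (≈ᵛ-sym (coords-≈ u)) h)) (λ _ → ≈ᵛ-refl)
    scale : ∀ a (u : ∃ (Carrier U)) →
      proj₁ (to (a · proj₁ u , IsSubspace.·∈ U.isSubspace a (proj₂ u))) ≈ᵛ a · proj₁ (to u)
    scale a u = ≈ᵛ-trans
      (to-≈ _ (λ j → a *ᶜ coords u j) (≈ᵛ-trans (·-cong {c = a} R.refl (coords-≈ u)) (≈ᵛ-sym (linComb-·ˡ a (coords u) b))))
      (linComb-·ˡ a (coords u) b′)

  -- An isomorphism commutes with the matrix units of the type of U, which
  -- annihilate a module of another type.
  ≅⇒same-type : ∀ {U W t s b b′} → Framed U t b → Framed W s b′ → U ≅ W → t ≡ s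
  ≅⇒same-type {U} {W} {t} {s} {b} {b′} F G U≅W with t ≟ᵗ s
  ... | yes t≡s = t≡s
  ... | no t≢s = let a , ba≢0 = F.someNonZero in contradiction ba≢0 (NonZero-absurd (vanish a))
    where
    module F = Framed F
    module G = Framed G
    module U = TModule U
    module W = TModule W
    open _≅_ U≅W
    open LeftModuleMorphisms U.rawLeftModule W.rawLeftModule
    open IsLeftModuleIsomorphism isIsomorphism
    vanish : ∀ a → b a ≈ᵛ 0ᵛ
    vanish a = injective {b a , F.members a} {0ᵛ , IsSubspace.0∈ U.isSubspace} (begin
      proj₁ (to (b a , F.members a))
        ≈⟨ ⟦⟧-cong (≈ᵛ-sym (F.fixed a)) ⟩
      proj₁ (to (e (t , a , a) *ᵛ b a , U.closed (e∈T (t , a , a)) (F.members a)))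
        ≈⟨ commutes (e∈T (t , a , a)) (b a , F.members a) ⟩
      e (t , a , a) *ᵛ proj₁ (to (b a , F.members a))
        ≈⟨ *ᵛ-congˡ (e (t , a , a)) (proj₂ (G.spans (proj₂ (to (b a , F.members a))))) ⟩
      e (t , a , a) *ᵛ linComb (proj₁ (G.spans (proj₂ (to (b a , F.members a))))) b′
        ≈⟨ G.e-other t≢s a a _ ⟩
      0ᵛ
        ≈⟨ 0ᴹ-homo ⟨
      proj₁ (to (0ᵛ , IsSubspace.0∈ U.isSubspace)) ∎)
      where open 𝕍-Reasoning

  framed⇒≅⇔ : ∀ {U W t s b b′} → Framed U t b → Framed W s b′ → (t ≡ s) ⇔ (U ≅ W)
  framed⇒≅⇔ F G = mk⇔ (λ { refl → framed⇒≅ F G }) (≅⇒same-type F G)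

  -- The number of summands of a given type

  module Count {k : ℕ} {U : Fin k → TModule} (dec : IsOrthogonalDecomposition U)
    {τ : Fin k → SummandType} {b : ∀ j → Fin (dim (τ j)) → V} (F : ∀ j → Framed (U j) (τ j) (b j))
    (t : SummandType) where
    open IsOrthogonalDecomposition dec

    ε : Mat n n
    ε = e (t , row₀ t , row₀ t)

    -- A spanning vector of ε U j.
    seedOf : ∀ {s} → Dec (s ≡ t) → (Fin (dim s) → V) → V
    seedOf (yes refl) b = b (row₀ t)
    seedOf (no _)     b = 0ᵛ

    seed : Fin k → V
    seed j = seedOf (τ j ≟ᵗ t) (b j)

    module _ {W : TModule} where
      seedOf∈ : ∀ {s b} (d : Dec (s ≡ t)) → Framed W s b → seedOf d b ∈ Carrier W
      seedOf∈ (yes refl) F = Framed.members F (row₀ t)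
      seedOf∈ (no _)     F = IsSubspace.0∈ (TModule.isSubspace W)

      seedOf-fixed : ∀ {s b} (d : Dec (s ≡ t)) → Framed W s b → ε *ᵛ seedOf d b ≈ᵛ seedOf d b
      seedOf-fixed (yes refl) F = Framed.fixed F (row₀ t)
      seedOf-fixed (no _)     F = *ᵛ-zero ε ≈ᵛ-refl

      seedOf-cancel : ∀ {s b x y} (d : Dec (s ≡ t)) → Framed W s b → s ≡ t →
        x · seedOf d b ≈ᵛ y · seedOf d b → x ≈ᶜ y
      seedOf-cancel (yes refl) F _   h = Framed.row-cancel F (row₀ t) h
      seedOf-cancel (no s≢t)   F s≡t h = contradiction s≡t s≢t

      project : ∀ {s b} (d : Dec (s ≡ t)) → Framed W s b → ∀ {u} → u ∈ Carrier W →
        ∃[ c ] ε *ᵛ u ≈ᵛ c · seedOf d b × (s ≢ t → c ≈ᶜ 0ᶜ)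
      project (yes refl) F u∈ = let c , u≈ = Framed.spans F u∈ in
        c (row₀ t) , ≈ᵛ-trans (*ᵛ-congˡ ε u≈) (Framed.e-combination F (row₀ t) (row₀ t) c) ,
        λ t≢t → contradiction refl t≢t
      project (no s≢t) F u∈ = let c , u≈ = Framed.spans F u∈ in
        0ᶜ , ≈ᵛ-trans (*ᵛ-congˡ ε u≈)
          (≈ᵛ-trans (Framed.e-other F (λ e → s≢t (sym e)) (row₀ t) (row₀ t) c) (≈ᵛ-sym (·-zeroˡ 0ᵛ R.refl))) ,
        λ _ → R.refl

    seed∈ : ∀ j → seed j ∈ Carrier (U j)
    seed∈ j = seedOf∈ (τ j ≟ᵗ t) (F j)

    seed-fixed : ∀ j → ε *ᵛ seed j ≈ᵛ seed j
    seed-fixed j = seedOf-fixed (τ j ≟ᵗ t) (F j)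

    -- Decompose `v` along the summands and apply `ε` to each component.
    expand : ∀ v → ε *ᵛ v ≈ᵛ v → Σ (Fin k → ℂ) λ c → v ≈ᵛ linComb c seed × (∀ j → τ j ≢ t → c j ≈ᶜ 0ᶜ)
    expand v fixed =
      let u , u∈ , v≈ = spanning v in
      (λ j → proj₁ (project (τ j ≟ᵗ t) (F j) (u∈ j))) ,
      ≈ᵛ-trans (≈ᵛ-sym fixed) (≈ᵛ-trans (*ᵛ-congˡ ε v≈) (≈ᵛ-trans (*ᵛ-sumᵛ ε u)
        (λ y → sum-cong (λ j → proj₁ (proj₂ (project (τ j ≟ᵗ t) (F j) (u∈ j))) y)))) ,
      λ j → proj₂ (proj₂ (project (τ j ≟ᵗ t) (F j) (u∈ j)))

    -- Directness of the sum compares components one by one; at a summand of type `t` the seed can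
    -- be cancelled.
    unique : ∀ c j → linComb c seed ≈ᵛ seed j → τ j ≡ t → c j ≈ᶜ 1ᶜ
    unique c j h τ≡t = seedOf-cancel (τ j ≟ᵗ t) (F j) τ≡t (≈ᵛ-trans
      (direct (λ i → c i · seed i) (λ i → [ j ≟ᶠ i ]ᶜ · seed i)
        (λ i → IsSubspace.·∈ (TModule.isSubspace (U i)) (c i) (seed∈ i))
        (λ i → IsSubspace.·∈ (TModule.isSubspace (U i)) [ j ≟ᶠ i ]ᶜ (seed∈ i))
        (≈ᵛ-trans h (≈ᵛ-sym (linComb-δˡ j seed))) j)
      (·-cong {v = seed j} (δ-refl j) ≈ᵛ-refl))

    -- The diagonal of the product of the two transition matrices: expanding a seed of type `t` in
    -- the vectors `s` and these again in seeds returns it, which gives 1, and elsewhere `D` is 0.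
    diagonal : ∀ {l} (s : Fin l → V) (C : Fin k → Fin l → ℂ) (D : Fin l → Fin k → ℂ) →
      (∀ j → seed j ≈ᵛ linComb (C j) s) → (∀ i → s i ≈ᵛ linComb (D i) seed) →
      (∀ i j → τ j ≢ t → D i j ≈ᶜ 0ᶜ) →
      ∀ j → sum (λ i → C j i *ᶜ D i j) ≈ᶜ [ τ j ≟ᵗ t ]ᶜ
    diagonal s C D seed≈ s≈ D≈0 j with τ j ≟ᵗ t in e
    ... | no τ≢t  = sum-zero (λ i → R.trans (R.*-congˡ (D≈0 i j τ≢t)) (R.zeroʳ (C j i)))
    ... | yes τ≡t = unique (λ a → sum (λ i → C j i *ᶜ D i a)) j (begin
        linComb (λ a → sum (λ i → C j i *ᶜ D i a)) seed
          ≈⟨ linComb-linComb (C j) D seed ⟨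
        linComb (C j) (λ i → linComb (D i) seed)
          ≈⟨ linComb-cong {c = C j} (λ _ → R.refl) s≈ ⟨
        linComb (C j) s
          ≈⟨ seed≈ j ⟨
        seed j ∎) τ≡t
      where open 𝕍-Reasoning

  -- If one decomposition has seeds sᵢ = Σ Dᵢⱼ s′ⱼ and another s′ⱼ = Σ Cⱼᵢ sᵢ, the
  -- numbers of seeds are the traces of DC and of CD.
  count-unique : ∀ {k l} {U : Fin k → TModule} {W : Fin l → TModule}
    (dec : IsOrthogonalDecomposition U) (dec′ : IsOrthogonalDecomposition W)
    {τ : Fin k → SummandType} {b : ∀ j → Fin (dim (τ j)) → V} (F : ∀ j → Framed (U j) (τ j) (b j))
    {τ′ : Fin l → SummandType} {b′ : ∀ j → Fin (dim (τ′ j)) → V} (G : ∀ j → Framed (W j) (τ′ j) (b′ j)) →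
    ∀ t → ∣ (λ j → τ j ≟ᵗ t) ∣? ≡ ∣ (λ j → τ′ j ≟ᵗ t) ∣?
  count-unique dec dec′ {τ} F {τ′} G t = ℤ.+-injective (fromℤ-injective (begin
      fromℤ (ℤ.+ ∣ (λ j → τ j ≟ᵗ t) ∣?)
        ≈⟨ sum-[]ᶜ (λ j → τ j ≟ᵗ t) ⟨
      sum (λ j → [ τ j ≟ᵗ t ]ᶜ)
        ≈⟨ sum-cong (U.diagonal W.seed C D C-spec D-spec D≈0) ⟨
      sum (λ j → sum (λ i → C j i *ᶜ D i j))
        ≈⟨ ∑-comm (λ j i → C j i *ᶜ D i j) ⟩
      sum (λ i → sum (λ j → C j i *ᶜ D i j))
        ≈⟨ sum-cong (λ i → sum-cong (λ j → R.*-comm (C j i) (D i j))) ⟩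
      sum (λ i → sum (λ j → D i j *ᶜ C j i))
        ≈⟨ sum-cong (W.diagonal U.seed D C D-spec C-spec C≈0) ⟩
      sum (λ i → [ τ′ i ≟ᵗ t ]ᶜ)
        ≈⟨ sum-[]ᶜ (λ j → τ′ j ≟ᵗ t) ⟩
      fromℤ (ℤ.+ ∣ (λ j → τ′ j ≟ᵗ t) ∣?) ∎))
    where
    open ℂ-Reasoning
    module U = Count dec F t
    module W = Count dec′ G t
    C = λ j → proj₁ (W.expand (U.seed j) (U.seed-fixed j))
    D = λ i → proj₁ (U.expand (W.seed i) (W.seed-fixed i))
    C-spec = λ j → proj₁ (proj₂ (W.expand (U.seed j) (U.seed-fixed j)))
    D-spec = λ i → proj₁ (proj₂ (U.expand (W.seed i) (W.seed-fixed i)))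
    C≈0 = λ j i → proj₂ (proj₂ (W.expand (U.seed j) (U.seed-fixed j))) i
    D≈0 = λ i j → proj₂ (proj₂ (U.expand (W.seed i) (W.seed-fixed i))) j

  -- The decomposition given by the model

  module _ (W : Fin 6 → TModule) (F : ∀ i → Framed (W i) (typeOf i) (w i)) where

    isOrthogonalDecomposition : IsOrthogonalDecomposition W
    isOrthogonalDecomposition = record
      { irreducible = λ i → framed⇒irreducible (F i)
      ; spanning    = λ v → let c , v≈ = w-spanning v in
          (λ i → linComb (c i) (w i)) ,
          (λ i → linComb∈ (TModule.isSubspace (W i)) (c i) (w i) (Framed.members (F i))) , v≈
      ; direct      = λ u u′ u∈ u′∈ h i →
          let c = λ i → proj₁ (Framed.spans (F i) (u∈ i))
              d = λ i → proj₁ (Framed.spans (F i) (u′∈ i))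
              u≈ : ∀ i → u i ≈ᵛ linComb (c i) (w i)
              u≈ i = proj₂ (Framed.spans (F i) (u∈ i))
              u′≈ : ∀ i → u′ i ≈ᵛ linComb (d i) (w i)
              u′≈ i = proj₂ (Framed.spans (F i) (u′∈ i))
          in ≈ᵛ-trans (u≈ i) (≈ᵛ-trans
               (linComb-cong {us = w i} (combination-injective c d
                 (≈ᵛ-trans (λ y → sum-cong (λ i → R.sym (u≈ i y))) (≈ᵛ-trans h (λ y → sum-cong (λ i → u′≈ i y)))) i)
                 (λ _ → ≈ᵛ-refl))
               (≈ᵛ-sym (u′≈ i)))
      ; orthogonal  = λ {i} {j} {u} {v} i≢j u∈ v∈ →
          let c , u≈ = Framed.spans (F i) u∈
              d , v≈ = Framed.spans (F j) v∈
          in R.trans (⟨⟩-cong u≈ v≈) (R.trans (⟨linComb,⟩ c (w i) (linComb d (w j)))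
               (sum-zero (λ a → R.trans (R.*-congˡ (R.trans (⟨,linComb⟩ (w i a) d (w j))
                 (sum-zero (λ b → R.trans (R.*-congˡ (orthogonal a b i≢j)) (R.zeroʳ (conj (d b))))))) (R.zeroʳ (c a)))))
      }

    isomorphic⇔same-type : ∀ i j → (W i ≅ W j) ⇔ (typeOf i ≡ typeOf j)
    isomorphic⇔same-type i j = let h = framed⇒≅⇔ (F i) (F j) in mk⇔ (Equivalence.from h) (Equivalence.to h)

    -- Each irreducible summand of `U` is framed and so has a type, which decides isomorphism with
    -- `W i`; the count is then compared with the explicit decomposition.
    hasMultiplicity : ∀ i → HasMultiplicity (W i) ∣ (λ j → typeOf j ≟ᵗ typeOf i) ∣?
    hasMultiplicity i {k} U dec =
      subst (HasCardinality (λ j → U j ≅ W i))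
        (count-unique dec isOrthogonalDecomposition framed F (typeOf i))
        (decidable⇒cardinality (λ j → τ j ≟ᵗ typeOf i) (λ j → framed⇒≅⇔ (framed j) (F i)))
      where
      decompose : ∀ j → Σ SummandType λ t → Σ (Fin (dim t) → V) λ b → Framed (U j) t b
      decompose j = irreducible⇒framed (U j) (IsOrthogonalDecomposition.irreducible dec j)
      τ : Fin k → SummandType
      τ j = proj₁ (decompose j)
      framed : ∀ j → Framed (U j) (τ j) (proj₁ (proj₂ (decompose j)))
      framed j = proj₂ (proj₂ (decompose j))

  module Rows {W : TModule} {t : SummandType} {b : Fin (dim t) → V} (F : Framed W t b)
    (b-nonZero : ∀ a → NonZero (b a)) where
    open Framed F

    E*-row : ∀ h k → E* h *ᵛ b k ≈ᵛ [ endpoint t ℕ.+ toℕ k ℕ.≟ h ]ᶜ · b k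
    E*-row h k = ≈ᵛ-trans (action-frame (acts-E* h) k)
      (linComb-δ· k [ endpoint t ℕ.+ toℕ k ℕ.≟ h ]ᶜ b)

    E*-fixed : ∀ {h} k → endpoint t ℕ.+ toℕ k ≡ h → E* h *ᵛ b k ≈ᵛ b k
    E*-fixed {h} k e = ≈ᵛ-trans (E*-row h k)
      (≈ᵛ-trans (·-cong {v = b k} (≡⇒≈ᶜ ([ _ ℕ.≟ h ]-yes e)) ≈ᵛ-refl) (·-identity (b k)))

    E*-killed : ∀ {h} k → endpoint t ℕ.+ toℕ k ≢ h → E* h *ᵛ b k ≈ᵛ 0ᵛ
    E*-killed {h} k e = ≈ᵛ-trans (E*-row h k) (·-zeroˡ (b k) (≡⇒≈ᶜ ([ _ ℕ.≟ h ]-no e)))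

    E*-combination : ∀ h c → E* h *ᵛ linComb c b ≈ᵛ linComb c (λ k → E* h *ᵛ b k)
    E*-combination h c = *ᵛ-linComb (E* h) c b

    -- The members of the frame lie at the distinct distances `endpoint t + a`, so one dual
    -- idempotent keeps one member and annihilates the others.
    row-basis : ∀ a → IsBasis {k = 1} (E*[ endpoint t ℕ.+ toℕ a ] (Carrier W)) (λ _ → b a)
    row-basis a = record
      { members     = λ _ → b a , members a , ≈ᵛ-sym (E*-fixed a refl)
      ; independent = λ { c h 0F → NonZero-cancel {v = b a} (b-nonZero a) (λ y → R.trans (R.sym (R.+-identityʳ _)) (h y)) }
      ; spanning    = λ { (u , u∈ , v≈) → let c , u≈ = spans u∈ in (λ _ → c a) , (begin
          _
            ≈⟨ v≈ ⟩
          E* h *ᵛ u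
            ≈⟨ *ᵛ-congˡ (E* h) u≈ ⟩
          E* h *ᵛ linComb c b
            ≈⟨ E*-combination h c ⟩
          linComb c (λ k → E* h *ᵛ b k)
            ≈⟨ linComb-single c _ a (λ k k≢a → inj₂ (E*-killed k (λ e →
               k≢a (Fin.toℕ-injective (ℕ.+-cancelˡ-≡ (endpoint t) (toℕ k) (toℕ a) e))))) ⟩
          c a · (E* h *ᵛ b a)
            ≈⟨ ·-cong {c = c a} R.refl (E*-fixed a refl) ⟩
          c a · b a
            -- A linear combination of a single vector ends in a summand 0.
            ≈⟨ (λ y → R.sym (R.+-identityʳ _)) ⟩
          linComb {k = 1} (λ _ → c a) (λ _ → b a) ∎) }
      }
      where
      open 𝕍-Reasoning
      h : ℕ
      h = endpoint t ℕ.+ toℕ a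

    row⇔nonZero : ∀ h → (∃[ a ] endpoint t ℕ.+ toℕ a ≡ h) ⇔ NonZeroSpace (E*[ h ] (Carrier W))
    row⇔nonZero h = mk⇔
      (λ { (a , e) → b a , (b a , members a , ≈ᵛ-sym (E*-fixed a e)) , b-nonZero a })
      (λ { (v , (u , u∈ , v≈) , v≢0) →
        let c , u≈ = spans u∈
            k , h≢0 = NonZero-sumᵛ (λ k → c k · (E* h *ᵛ b k))
              (NonZero-resp (≈ᵛ-trans v≈ (≈ᵛ-trans (*ᵛ-congˡ (E* h) u≈) (E*-combination h c))) v≢0)
        in k , decide k (endpoint t ℕ.+ toℕ k ℕ.≟ h) (λ e → NonZero-absurd (·-zeroʳ (c k) (E*-killed k e)) h≢0) })
      where
      decide : ∀ k → Dec (endpoint t ℕ.+ toℕ k ≡ h) → ¬ ¬ (endpoint t ℕ.+ toℕ k ≡ h) → endpoint t ℕ.+ toℕ k ≡ h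
      decide k (yes e) _ = e
      decide k (no ¬e) h = contradiction ¬e h

    isEndpoint : (∃[ a ] toℕ {dim t} a ≡ 0) → IsEndpoint W (endpoint t)
    isEndpoint (a , a≡0) =
      Equivalence.to (row⇔nonZero (endpoint t)) (a , trans (cong (endpoint t ℕ.+_) a≡0) (ℕ.+-identityʳ (endpoint t))) ,
      λ i i<r h → let a , e = Equivalence.from (row⇔nonZero i) h in
        ℕ.<-irrefl refl (ℕ.≤-<-trans (ℕ.≤-trans (ℕ.m≤m+n (endpoint t) (toℕ a)) (ℕ.≤-reflexive e)) i<r)

    supportSize : HasCardinality {3} (λ i → NonZeroSpace (E*[ toℕ i ] (Carrier W))) ∣ support? t ∣?
    supportSize = decidable⇒cardinality (support? t) (λ i → row⇔nonZero (toℕ i))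

    isPureBasis : (∀ (a : Fin (dim t)) → endpoint t ℕ.+ toℕ a ℕ.< 3) → IsPureBasis W b
    isPureBasis bound = isBasis , (λ a → Fin.fromℕ< (bound a)) ,
      (λ a → b-nonZero a , b a , ≈ᵛ-sym (E*-fixed a (sym (Fin.toℕ-fromℕ< (bound a))))) ,
      λ i j i≤j → subst₂ ℕ._≤_ (sym (Fin.toℕ-fromℕ< (bound i))) (sym (Fin.toℕ-fromℕ< (bound j))) (ℕ.+-monoʳ-≤ (endpoint t) i≤j)

    represents : Represents (TypeData.matrixOfA (typeData t)) b
    represents j = ≈ᵛ-trans (action-frame acts-A j)
      (linComb-cong {us = b} (λ a → ≡⇒≈ᶜ (sym (matrixOfA≡ t a j))) (λ _ → ≈ᵛ-refl))

-- Enumerating finite sets of vertices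

record Enumeration (P : Fin n → Set) (k : ℕ) : Set where
  field
    at        : Fin k → Fin n
    injective : ∀ {s t} → at s ≡ at t → s ≡ t
    sound     : ∀ t → P (at t)
    position  : ∀ {y} → P y → Fin k
    at-position : ∀ {y} (p : P y) → at (position p) ≡ y

  -- Pigeonhole: the positions of distinct members are distinct.
  no-more : (v : Fin (suc k) → Fin n) → (∀ {s t} → v s ≡ v t → s ≡ t) → (∀ s → P (v s)) → ⊥
  no-more v v-injective v∈ = ℕ.<-irrefl refl (Fin.injective⇒≤ {f = λ s → position (v∈ s)}
    (λ {s} {t} e → v-injective (trans (sym (at-position (v∈ s))) (trans (cong at e) (at-position (v∈ t))))))

lookup-injective : ∀ {A : Set} {xs : List A} → Unique xs → ∀ s t → List.lookup xs s ≡ List.lookup xs t → s ≡ t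
lookup-injective (_ ∷ _)    zero    zero    e = refl
lookup-injective (x≢ ∷ _)   zero    (suc t) e = contradiction e (All.lookup x≢ (List∈.∈-lookup t))
lookup-injective (x≢ ∷ _)   (suc s) zero    e = contradiction (sym e) (All.lookup x≢ (List∈.∈-lookup s))
lookup-injective (_ ∷ uniq) (suc s) (suc t) e = cong suc (lookup-injective uniq s t e)

-- Intersection numbers are lengths of filtered lists; this turns such a length into an explicit
-- list of vertices.
enumerate : {P : Fin n → Set} (P? : ∀ i → Dec (P i)) → length (filter P? (allFin n)) ≡ k → Enumeration P k
enumerate {n} {P = P} P? refl = record
  { at          = List.lookup xs
  ; injective   = λ {s} {t} e → lookup-injective (Unique.filter⁺ P? (Unique.allFin⁺ n)) s t e
  ; sound       = λ t → proj₂ (List∈.∈-filter⁻ P? {xs = allFin n} (List∈.∈-lookup t))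
  ; position    = λ p → Any.index (List∈.∈-filter⁺ P? (List∈.∈-allFin _) p)
  ; at-position = λ p → sym (Any.lookup-index (List∈.∈-filter⁺ P? (List∈.∈-allFin _) p))
  }
  where
  xs : List (Fin n)
  xs = filter P? (allFin n)

∷-injective : ∀ {A : Set} {a : A} {f : Fin k → A} → (∀ t → a ≢ f t) →
  (∀ {s t} → f s ≡ f t → s ≡ t) → ∀ {s t} → (a Vector.∷ f) s ≡ (a Vector.∷ f) t → s ≡ t
∷-injective a≢f f-inj {zero}  {zero}  e = refl
∷-injective a≢f f-inj {zero}  {suc t} e = contradiction e (a≢f t)
∷-injective a≢f f-inj {suc s} {zero}  e = contradiction (sym e) (a≢f s)
∷-injective a≢f f-inj {suc s} {suc t} e = cong suc (f-inj e)

-- Distances 0, 1 and at least 2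

module Distance {n : ℕ} (Γ : Graph n) (2≤n : 2 ℕ.≤ n) where
  open Graph Γ

  data DistanceView (x y : Fin n) : ℕ → Set where
    equal    : x ≡ y → DistanceView x y 0
    adjacent : x ∼ y → DistanceView x y 1
    distant  : ∀ {d} → x ≢ y → ¬ x ∼ y → DistanceView x y (suc (suc d))

  -- A search bound of at least 2 guarantees that the lengths 0 and 1 are both tested.
  least-view : ∀ {P : ℕ → Set} (P? : ∀ k → Dec (P k)) {m} → 2 ℕ.≤ m →
    (P 0 × least P? m ≡ 0) ⊎ (¬ P 0 × P 1 × least P? m ≡ 1) ⊎
    (¬ P 0 × ¬ P 1 × ∃[ d ] least P? m ≡ suc (suc d))
  least-view P? (ℕ.s≤s (ℕ.s≤s _)) with P? 0 | P? 1
  ... | yes p | _     = inj₁ (p , refl)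
  ... | no ¬p | yes q = inj₂ (inj₁ (¬p , q , refl))
  ... | no ¬p | no ¬q = inj₂ (inj₂ (¬p , ¬q , _ , refl))

  view : ∀ x y → DistanceView x y (dist Γ x y)
  view x y = case least-view (λ k → walk? Γ k x y) 2≤n of λ where
    (inj₁ (x≡y , e)) → subst (DistanceView x y) (sym e) (equal x≡y)
    (inj₂ (inj₁ (x≢y , (z , x∼z , z≡y) , e))) →
      subst (DistanceView x y) (sym e) (adjacent (subst (x ∼_) z≡y x∼z))
    (inj₂ (inj₂ (x≢y , ¬walk , _ , e))) →
      subst (DistanceView x y) (sym e) (distant x≢y (λ x∼y → ¬walk (y , x∼y , refl)))

  opaque
    dist≡1⇒∼ : ∀ {x y} → dist Γ x y ≡ 1 → x ∼ y
    dist≡1⇒∼ {x} {y} e with dist Γ x y | view x y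
    ... | _ | adjacent x∼y = x∼y

    ≡⇒dist≡0 : ∀ {x y} → x ≡ y → dist Γ x y ≡ 0
    ≡⇒dist≡0 {x} {y} x≡y with dist Γ x y | view x y
    ... | _ | equal _        = refl
    ... | _ | adjacent x∼y   = contradiction x∼y (irrefl x≡y)
    ... | _ | distant x≢y _  = contradiction x≡y x≢y

    ∼⇒dist≡1 : ∀ {x y} → x ∼ y → dist Γ x y ≡ 1
    ∼⇒dist≡1 {x} {y} x∼y with dist Γ x y | view x y
    ... | _ | equal x≡y     = contradiction x∼y (irrefl x≡y)
    ... | _ | adjacent _    = refl
    ... | _ | distant _ x≁y = contradiction x∼y x≁y

-- A model of the Petersen graph: ρ i is the inner vertex adjacent to the i-th
-- pair of outer vertices.

data Label : Set where
  centre : Label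
  inner  : Fin 3 → Label
  outer  : Fin 6 → Label

level : Label → ℕ
level centre    = 0
level (inner _) = 1
level (outer _) = 2

pair : Fin 6 → Fin 3
pair j = proj₁ (Fin.remQuot {3} 2 j)

bit : Fin 6 → Fin 2
bit j = proj₂ (Fin.remQuot {3} 2 j)

outerIndex : Fin 3 → Fin 2 → Fin 6
outerIndex i b = Fin.combine i b

outerIndex-pair-bit : ∀ j → outerIndex (pair j) (bit j) ≡ j
outerIndex-pair-bit = Fin.combine-remQuot {3} 2

outerIndex-injective : ∀ i b j c → outerIndex i b ≡ outerIndex j c → i ≡ j × b ≡ c
outerIndex-injective = Fin.combine-injective

Consecutive : Fin 6 → Fin 6 → Set
Consecutive s t = suc (toℕ s) ℕ.% 6 ≡ toℕ t ⊎ suc (toℕ t) ℕ.% 6 ≡ toℕ s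

consecutive? : ∀ s t → Dec (Consecutive s t)
consecutive? s t = (suc (toℕ s) ℕ.% 6 ℕ.≟ toℕ t) ⊎-dec (suc (toℕ t) ℕ.% 6 ℕ.≟ toℕ s)

-- Inverse of the arrangement y₁, y₃, y₅, y₂, y₄, y₆, with indices shifted by one.
cyclePosition : Fin 6 → Fin 6
cyclePosition = lookup (0F ∷ 3F ∷ 1F ∷ 4F ∷ 2F ∷ 5F ∷ [])

adjacent? : (Fin 3 → Fin 3) → Label → Label → Bool
adjacent? ρ centre    (inner _) = true
adjacent? ρ (inner _) centre    = true
adjacent? ρ (inner k) (outer j) = does (ρ (pair j) ≟ᶠ k)
adjacent? ρ (outer j) (inner k) = does (ρ (pair j) ≟ᶠ k)
adjacent? ρ (outer i) (outer j) = does (consecutive? (cyclePosition i) (cyclePosition j))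
adjacent? ρ _         _         = false

-- Consequences of the intersection array {3,2;1,1}

module Petersen {n : ℕ} (Γ : Graph n) (2≤n : 2 ℕ.≤ n) (dr : DistanceRegular Γ 2)
  (ia : HasIntersectionArray Γ (3 ∷ 2 ∷ []) (1 ∷ 1 ∷ [])) where
  open Graph Γ
  open Distance Γ 2≤n
  open DistanceRegular dr

  opaque
    distant⇒dist≡2 : ∀ {x y} → x ≢ y → ¬ x ∼ y → dist Γ x y ≡ 2
    distant⇒dist≡2 {x} {y} x≢y x≁y with dist Γ x y | view x y | proj₁ diameter x y
    ... | _ | equal x≡y             | _ = contradiction x≡y x≢y
    ... | _ | adjacent x∼y          | _ = contradiction x∼y x≁y
    ... | _ | distant {zero} _ _    | _ = refl
    ... | _ | distant {suc _} _ _   | ℕ.s≤s (ℕ.s≤s ())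

  trichotomy : ∀ x y → x ≡ y ⊎ x ∼ y ⊎ dist Γ x y ≡ 2
  trichotomy x y with x ≟ᶠ y | x ∼? y
  ... | yes x≡y | _       = inj₁ x≡y
  ... | no _    | yes x∼y = inj₂ (inj₁ x∼y)
  ... | no x≢y  | no x≁y  = inj₂ (inj₂ (distant⇒dist≡2 x≢y x≁y))

  dist≡2⇒≢ : ∀ {x y} → dist Γ x y ≡ 2 → x ≢ y
  dist≡2⇒≢ e x≡y = case trans (sym e) (≡⇒dist≡0 x≡y) of λ ()

  dist≡2⇒≁ : ∀ {x y} → dist Γ x y ≡ 2 → ¬ x ∼ y
  dist≡2⇒≁ e x∼y = case trans (sym e) (∼⇒dist≡1 x∼y) of λ ()

  Meet : ℕ → ℕ → Fin n → Fin n → Fin n → Set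
  Meet i j y z w = dist Γ y w ≡ i × dist Γ z w ≡ j

  meet-enumeration : ∀ {h i j p} → IsIntersectionNumber Γ h i j p → ∀ {y z} → dist Γ y z ≡ h →
    Enumeration (Meet i j y z) p
  meet-enumeration {i = i} {j} number {y} {z} e =
    enumerate (λ w → (dist Γ y w ℕ.≟ i) ×-dec (dist Γ z w ℕ.≟ j)) (number y z e)

  opaque
    -- This and the next two are b₀ = 3, b₁ = 2 and c₂ = 1, read as enumerations.
    neighbours : ∀ x → Enumeration (Meet 1 1 x x) 3
    neighbours x = meet-enumeration (proj₁ (ia 0F)) (≡⇒dist≡0 refl)

    away : ∀ {x z} → x ∼ z → Enumeration (Meet 1 2 z x) 2
    away x∼z = meet-enumeration (proj₁ (ia 1F)) (∼⇒dist≡1 (∼-sym x∼z))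

    common : ∀ {x y} → dist Γ x y ≡ 2 → Enumeration (Meet 1 1 x y) 1
    common e = meet-enumeration (proj₂ (ia 1F)) e

  commonNeighbour : ∀ {x y} → dist Γ x y ≡ 2 → ∃[ w ] x ∼ w × y ∼ w
  commonNeighbour e = at 0F , dist≡1⇒∼ (proj₁ (sound 0F)) , dist≡1⇒∼ (proj₂ (sound 0F))
    where open Enumeration (common e)

  commonNeighbour-unique : ∀ {x y v w} → dist Γ x y ≡ 2 → x ∼ v → y ∼ v → x ∼ w → y ∼ w → v ≡ w
  commonNeighbour-unique e xv yv xw yw = trans (sym (at-position p)) (trans (cong at (unique _ _)) (at-position q))
    where
    open Enumeration (common e)
    p = ∼⇒dist≡1 xv , ∼⇒dist≡1 yv
    q = ∼⇒dist≡1 xw , ∼⇒dist≡1 yw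
    unique : (i j : Fin 1) → i ≡ j
    unique 0F 0F = refl

  -- Of the three neighbours of `y`, two are at distance 2 from `x`; with `x` itself and the third
  -- corner of a triangle there would be four.
  triangleFree : ∀ {x y z} → x ∼ y → y ∼ z → x ∼ z → ⊥
  triangleFree {x} {y} {z} x∼y y∼z x∼z =
    no-more (x Vector.∷ z Vector.∷ Y.at)
      (∷-injective x≢ (∷-injective z≢ Y.injective))
      (λ { 0F → near (∼-sym x∼y) ; 1F → near y∼z ; (suc (suc t)) → near (dist≡1⇒∼ (proj₁ (Y.sound t))) })
    where
    open Enumeration (neighbours y)
    module Y = Enumeration (away x∼y)
    near : ∀ {w} → y ∼ w → Meet 1 1 y y w
    near y∼w = ∼⇒dist≡1 y∼w , ∼⇒dist≡1 y∼w
    z≢ : ∀ t → z ≢ Y.at t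
    z≢ t refl = dist≡2⇒≁ (proj₂ (Y.sound t)) x∼z
    x≢ : ∀ t → x ≢ (z Vector.∷ Y.at) t
    x≢ zero    refl = irrefl refl x∼z
    x≢ (suc t) e    = dist≡2⇒≢ (proj₂ (Y.sound t)) e

  -- Labels for the vertices, relative to a base vertex

  module Labelling (x : Fin n) (o₁ : Ordering Γ x 1 3) (o₂ : Ordering Γ x 2 6)
    (admissible : Admissible o₂) where
    private
      module O₁ = Ordering o₁
      module O₂ = Ordering o₂
      z = O₁.at
      y = O₂.at

    x∼z : ∀ k → x ∼ z k
    x∼z k = dist≡1⇒∼ (Equivalence.from (O₁.exact (z k)) (k , refl))

    x-y : ∀ j → dist Γ x (y j) ≡ 2
    x-y j = Equivalence.from (O₂.exact (y j)) (j , refl)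

    z-position : ∀ {w} → dist Γ x w ≡ 1 → ∃[ k ] z k ≡ w
    z-position {w} = Equivalence.to (O₁.exact w)

    centreOf : ∀ i → ∃[ k ] (∀ b → z k ∼ y (outerIndex i b))
    centreOf i = let w , x-w , adj = pairs i ; k , zk≡w = z-position x-w in
      k , λ b → subst (_∼ y (outerIndex i b)) (sym zk≡w) (adj b)
      where
      bits : ∀ {w i} → w ∼ y (outerIndex i 0F) → w ∼ y (outerIndex i 1F) →
        ∀ b → w ∼ y (outerIndex i b)
      bits h h′ 0F = h
      bits h h′ 1F = h′
      pairs : ∀ i → ∃[ w ] dist Γ x w ≡ 1 × (∀ b → w ∼ y (outerIndex i b))
      pairs 0F = let w , x-w , h , h′ = proj₁ admissible in w , x-w , bits {i = 0F} h h′
      pairs 1F = let w , x-w , h , h′ = proj₁ (proj₂ admissible) in w , x-w , bits {i = 1F} h h′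
      pairs 2F = let w , x-w , h , h′ = proj₁ (proj₂ (proj₂ admissible)) in w , x-w , bits {i = 2F} h h′

    ρ : Fin 3 → Fin 3
    ρ i = proj₁ (centreOf i)

    z∼y : ∀ j → z (ρ (pair j)) ∼ y j
    z∼y j = subst (λ m → z (ρ (pair j)) ∼ y m) (outerIndex-pair-bit j) (proj₂ (centreOf (pair j)) (bit j))

    z∼y⇒≡ : ∀ k j → z k ∼ y j → ρ (pair j) ≡ k
    z∼y⇒≡ k j h = O₁.injective (commonNeighbour-unique (x-y j) (x∼z _) (∼-sym (z∼y j)) (x∼z k) (∼-sym h))

    -- If two pairs shared their inner vertex, it would have three neighbours at distance 2 from
    -- `x`, against b₁ = 2.
    ρ-injective : ∀ i j → ρ i ≡ ρ j → i ≡ j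
    ρ-injective i j e with i ≟ᶠ j
    ... | yes i≡j = i≡j
    ... | no i≢j = ⊥-elim (no-more
        (y (outerIndex i 0F) Vector.∷ y (outerIndex i 1F) Vector.∷ y (outerIndex j 0F) Vector.∷ Vector.[])
        (∷-injective
          (λ { 0F e → case proj₂ (outerIndex-injective i 0F i 1F (O₂.injective e)) of λ ()
             ; 1F e → i≢j (proj₁ (outerIndex-injective i 0F j 0F (O₂.injective e)))
             ; (suc (suc ())) })
          (∷-injective (λ { 0F e → i≢j (proj₁ (outerIndex-injective i 1F j 0F (O₂.injective e))) ; (suc ()) })
            (∷-injective (λ ()) (λ { {()} }))))
        λ { 0F → near (proj₂ (centreOf i) 0F)
          ; 1F → near (proj₂ (centreOf i) 1F)
          ; 2F → near (subst (λ k → z k ∼ y (outerIndex j 0F)) (sym e) (proj₂ (centreOf j) 0F)) })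
      where
      open Enumeration (away (x∼z (ρ i)))
      near : ∀ {m} → z (ρ i) ∼ y m → Meet 1 2 (z (ρ i)) x (y m)
      near {m} h = ∼⇒dist≡1 h , x-y m

    place : Label → Fin n
    place centre    = x
    place (inner k) = z k
    place (outer j) = y j

    place-level : ∀ l → dist Γ x (place l) ≡ level l
    place-level centre    = ≡⇒dist≡0 refl
    place-level (inner k) = ∼⇒dist≡1 (x∼z k)
    place-level (outer j) = x-y j

    place-injective : ∀ l m → place l ≡ place m → l ≡ m
    place-injective l m e = go l m e (trans (sym (place-level l)) (trans (cong (dist Γ x) e) (place-level m)))
      where
      go : ∀ l m → place l ≡ place m → level l ≡ level m → l ≡ m
      go centre    centre    _ _ = refl
      go (inner k) (inner l) e _ = cong inner (O₁.injective e)
      go (outer i) (outer j) e _ = cong outer (O₂.injective e)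

    place-surjective : ∀ v → ∃[ l ] place l ≡ v
    place-surjective v = case trichotomy x v of λ where
      (inj₁ x≡v)         → centre , x≡v
      (inj₂ (inj₁ x∼v))  → let k , zk≡v = z-position (∼⇒dist≡1 x∼v) in inner k , zk≡v
      (inj₂ (inj₂ e))    → let j , yj≡v = Equivalence.to (O₂.exact v) e in outer j , yj≡v

    -- Two inner vertices are not adjacent because there are no triangles; an outer vertex is
    -- adjacent only to the inner vertex of its pair because c₂ = 1; the outer vertices are governed
    -- by the given cycle.
    place-adjacency : ∀ l m → does (place l ∼? place m) ≡ adjacent? ρ l m
    place-adjacency centre    centre    = dec-false (x ∼? x) (irrefl refl)
    place-adjacency centre    (inner k) = dec-true (x ∼? z k) (x∼z k)
    place-adjacency centre    (outer j) = dec-false (x ∼? y j) (dist≡2⇒≁ (x-y j))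
    place-adjacency (inner k) centre    = dec-true (z k ∼? x) (∼-sym (x∼z k))
    place-adjacency (inner k) (inner l) = dec-false (z k ∼? z l) (λ h → triangleFree (x∼z k) h (x∼z l))
    place-adjacency (inner k) (outer j) with ρ (pair j) ≟ᶠ k
    ... | yes refl = dec-true (z k ∼? y j) (z∼y j)
    ... | no ρ≢k   = dec-false (z k ∼? y j) (λ h → ρ≢k (z∼y⇒≡ k j h))
    place-adjacency (outer j) centre    = dec-false (y j ∼? x) (λ h → dist≡2⇒≁ (x-y j) (∼-sym h))
    place-adjacency (outer j) (inner k) with ρ (pair j) ≟ᶠ k
    ... | yes refl = dec-true (y j ∼? z k) (∼-sym (z∼y j))
    ... | no ρ≢k   = dec-false (y j ∼? z k) (λ h → ρ≢k (z∼y⇒≡ k j (∼-sym h)))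
    place-adjacency (outer i) (outer j) =
      does-⇔ (subst (λ (u , v) → u ∼ v ⇔ Consecutive (cyclePosition i) (cyclePosition j))
        (cong₂ _,_ (inCycle i) (inCycle j))
        (proj₂ (proj₂ (proj₂ admissible)) (cyclePosition i) (cyclePosition j)))
        (y i ∼? y j) (consecutive? (cyclePosition i) (cyclePosition j))
      where
      inCycle : ∀ j → lookup (y 0F ∷ y 2F ∷ y 4F ∷ y 1F ∷ y 3F ∷ y 5F ∷ []) (cyclePosition j) ≡ y j
      inCycle 0F = refl
      inCycle 1F = refl
      inCycle 2F = refl
      inCycle 3F = refl
      inCycle 4F = refl
      inCycle 5F = refl

  -- Existence of an admissible ordering

  module Existence (x : Fin n) where
    private
      module Z = Enumeration (neighbours x)
      z = Z.at

    x∼z : ∀ k → x ∼ z k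
    x∼z k = dist≡1⇒∼ (proj₁ (Z.sound k))

    z-position : ∀ {w} → x ∼ w → ∃[ k ] z k ≡ w
    z-position x∼w = Z.position p , Z.at-position p
      where p = ∼⇒dist≡1 x∼w , ∼⇒dist≡1 x∼w

    ordering₁ : Ordering Γ x 1 3
    ordering₁ = record
      { at        = z
      ; injective = Z.injective
      ; exact     = λ y → mk⇔ (λ e → z-position (dist≡1⇒∼ e)) (λ { (k , refl) → ∼⇒dist≡1 (x∼z k) }) }

    private
      module Y k = Enumeration (away (x∼z k))
      Y = Y.at

    z∼Y : ∀ k s → z k ∼ Y k s
    z∼Y k s = dist≡1⇒∼ (proj₁ (Y.sound k s))

    x-Y : ∀ k s → dist Γ x (Y k s) ≡ 2
    x-Y k s = proj₂ (Y.sound k s)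

    Y-position : ∀ {k w} → z k ∼ w → dist Γ x w ≡ 2 → ∃[ s ] Y k s ≡ w
    Y-position {k} z∼w x-w = Y.position k p , Y.at-position k p
      where p = ∼⇒dist≡1 z∼w , x-w

    Y≡⇒≡ : ∀ {k l s t} → Y k s ≡ Y l t → k ≡ l
    Y≡⇒≡ {k} {l} {s} {t} e = Z.injective (commonNeighbour-unique (x-Y k s)
      (x∼z k) (∼-sym (z∼Y k s)) (x∼z l) (∼-sym (subst (z l ∼_) (sym e) (z∼Y l t))))

    Y-z : ∀ {k l} s → k ≢ l → dist Γ (Y k s) (z l) ≡ 2
    Y-z {k} {l} s k≢l = distant⇒dist≡2
      (λ e → dist≡2⇒≁ (x-Y k s) (subst (x ∼_) (sym e) (x∼z l)))
      (λ h → k≢l (Z.injective (commonNeighbour-unique (x-Y k s) (x∼z k) (∼-sym (z∼Y k s)) (x∼z l) h)))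

    -- The common neighbour of `Y k s` and `z l` is not `x`, which is at distance 2 from `Y k s`,
    -- and not adjacent to `x`, which would close a triangle with `z l`. So it lies beyond `z l`.
    link : ∀ k s l → k ≢ l → ∃[ t ] Y k s ∼ Y l t
    link k s l k≢l =
      let w , Y∼w , z∼w = commonNeighbour (Y-z s k≢l) in
      case trichotomy x w of λ where
        (inj₁ x≡w)         → contradiction (∼-sym (subst (Y k s ∼_) (sym x≡w) Y∼w)) (dist≡2⇒≁ (x-Y k s))
        (inj₂ (inj₁ x∼w))  → ⊥-elim (triangleFree (x∼z l) z∼w x∼w)
        (inj₂ (inj₂ e))    → let t , Yt≡w = Y-position z∼w e in t , subst (Y k s ∼_) (sym Yt≡w) Y∼w

    -- Both are common neighbours of `Y k s` and `z l`, which are at distance 2.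
    link-unique : ∀ {k s l t t′} → k ≢ l → Y k s ∼ Y l t → Y k s ∼ Y l t′ → t ≡ t′
    link-unique {k} {s} {l} {t} {t′} k≢l h h′ =
      Y.injective l (commonNeighbour-unique (Y-z s k≢l) h (z∼Y l t) h′ (z∼Y l t′))

    -- The names of the two vertices beyond z k are exchanged when τ k is 1, so
    -- that y₁, y₃, y₅ becomes a path.
    twist : Fin 2 → Fin 2 → Fin 2
    twist 0F b  = b
    twist 1F 0F = 1F
    twist 1F 1F = 0F

    twist-involutive : ∀ c b → twist c (twist c b) ≡ b
    twist-involutive 0F b  = refl
    twist-involutive 1F 0F = refl
    twist-involutive 1F 1F = refl

    twist-0 : ∀ c → twist c 0F ≡ c
    twist-0 0F = refl
    twist-0 1F = refl

    τ : Fin 3 → Fin 2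
    τ 0F = 0F
    τ 1F = proj₁ (link 0F 0F 1F (λ ()))
    τ 2F = proj₁ (link 1F (τ 1F) 2F (λ ()))

    y′ : Fin 3 → Fin 2 → Fin n
    y′ k b = Y k (twist (τ k) b)

    y : Fin 6 → Fin n
    y j = y′ (pair j) (bit j)

    y′-link : ∀ k b l → k ≢ l → y′ k b ∼ y′ l 0F ⊎ y′ k b ∼ y′ l 1F
    y′-link k b l k≢l with link k (twist (τ k) b) l k≢l
    ... | t , h with twist (τ l) t in e
    ...   | 0F = inj₁ (subst (λ s → y′ k b ∼ Y l s) (trans (sym (twist-involutive (τ l) t)) (cong (twist (τ l)) e)) h)
    ...   | 1F = inj₂ (subst (λ s → y′ k b ∼ Y l s) (trans (sym (twist-involutive (τ l) t)) (cong (twist (τ l)) e)) h)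

    y′-link-unique : ∀ k b l {c d} → k ≢ l → c ≢ d → y′ k b ∼ y′ l c → ¬ y′ k b ∼ y′ l d
    y′-link-unique k b l {c} {d} k≢l c≢d h h′ = c≢d (trans (sym (twist-involutive (τ l) c))
      (trans (cong (twist (τ l)) (link-unique k≢l h h′)) (twist-involutive (τ l) d)))

    y′-unpaired : ∀ k b c → ¬ y′ k b ∼ y′ k c
    y′-unpaired k b c h = triangleFree (z∼Y k _) h (z∼Y k _)

    ordering₂ : Ordering Γ x 2 6
    ordering₂ = record
      { at        = y
      ; injective = λ {i} {j} e → injective i j e
      ; exact     = λ v → mk⇔ position (λ { (j , refl) → x-Y (pair j) _ }) }
      where
      injective : ∀ i j → y i ≡ y j → i ≡ j
      injective i j e = trans (sym (outerIndex-pair-bit i)) (trans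
        (same (pair i) (pair j) (Y≡⇒≡ e) e) (outerIndex-pair-bit j))
        where
        same : ∀ k l {b c} → k ≡ l → y′ k b ≡ y′ l c → outerIndex k b ≡ outerIndex l c
        same k .k {b} {c} refl e = cong (outerIndex k) (trans (sym (twist-involutive (τ k) b))
          (trans (cong (twist (τ k)) (Y.injective k e)) (twist-involutive (τ k) c)))
      position : ∀ {v} → dist Γ x v ≡ 2 → ∃[ j ] y j ≡ v
      position e with commonNeighbour e
      ... | w , x∼w , v∼w with z-position x∼w
      ...   | k , refl with Y-position (∼-sym v∼w) e
      ...     | s , refl = outerIndex k (twist (τ k) s) ,
        trans (cong (λ (l , c) → y′ l c) (Fin.remQuot-combine k (twist (τ k) s)))
          (cong (Y k) (twist-involutive (τ k) s))

    -- This and the next edge hold by the choice of `τ`. Each outer vertex has exactly one neighbour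
    -- in each other pair, so an edge excludes one candidate and a missing edge forces the other;
    -- the rest of the cycle follows once `0≁4` starts the comparison of the first and third pairs.
    0∼2 : y 0F ∼ y 2F
    0∼2 = subst (λ s → Y 0F 0F ∼ Y 1F s) (sym (twist-0 (τ 1F))) (proj₂ (link 0F 0F 1F (λ ())))

    2∼4 : y 2F ∼ y 4F
    2∼4 = subst₂ (λ s t → Y 1F s ∼ Y 2F t) (sym (twist-0 (τ 1F))) (sym (twist-0 (τ 2F)))
      (proj₂ (link 1F (τ 1F) 2F (λ ())))

    1≁2 : ¬ y 1F ∼ y 2F
    1≁2 h = y′-link-unique 1F 0F 0F {0F} {1F} (λ ()) (λ ()) (∼-sym 0∼2) (∼-sym h)

    0≁3 : ¬ y 0F ∼ y 3F
    0≁3 = y′-link-unique 0F 0F 1F {0F} {1F} (λ ()) (λ ()) 0∼2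

    1∼3 : y 1F ∼ y 3F
    1∼3 = case y′-link 0F 1F 1F (λ ()) of λ { (inj₁ h) → contradiction h 1≁2 ; (inj₂ h) → h }

    2≁5 : ¬ y 2F ∼ y 5F
    2≁5 = y′-link-unique 1F 0F 2F {0F} {1F} (λ ()) (λ ()) 2∼4

    3≁4 : ¬ y 3F ∼ y 4F
    3≁4 h = y′-link-unique 2F 0F 1F {0F} {1F} (λ ()) (λ ()) (∼-sym 2∼4) (∼-sym h)

    3∼5 : y 3F ∼ y 5F
    3∼5 = case y′-link 1F 1F 2F (λ ()) of λ { (inj₁ h) → contradiction h 3≁4 ; (inj₂ h) → h }

    0≁4 : ¬ y 0F ∼ y 4F
    0≁4 = triangleFree 0∼2 2∼4

    0∼5 : y 0F ∼ y 5F
    0∼5 = case y′-link 0F 0F 2F (λ ()) of λ { (inj₁ h) → contradiction h 0≁4 ; (inj₂ h) → h }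

    1≁5 : ¬ y 1F ∼ y 5F
    1≁5 h = y′-link-unique 2F 1F 0F {0F} {1F} (λ ()) (λ ()) (∼-sym 0∼5) (∼-sym h)

    1∼4 : y 1F ∼ y 4F
    1∼4 = case y′-link 0F 1F 2F (λ ()) of λ { (inj₁ h) → h ; (inj₂ h) → contradiction h 1≁5 }

    cycle : Fin 6 → Fin n
    cycle = lookup (y 0F ∷ y 2F ∷ y 4F ∷ y 1F ∷ y 3F ∷ y 5F ∷ [])

    flip : ∀ {u v b} → Reflects (u ∼ v) b → Reflects (v ∼ u) b
    flip (ofʸ h)  = ofʸ (∼-sym h)
    flip (ofⁿ ¬h) = ofⁿ (λ h → ¬h (∼-sym h))

    -- Positions three apart hold two vertices beyond one inner vertex, which `y′-unpaired` keeps
    -- apart; the other entries are the edges and non-edges found above.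
    reflects : ∀ s t → Reflects (cycle s ∼ cycle t) (does (consecutive? s t))
    reflects 0F 0F = ofⁿ (irrefl refl)
    reflects 0F 1F = ofʸ 0∼2
    reflects 0F 2F = ofⁿ 0≁4
    reflects 0F 3F = ofⁿ (y′-unpaired 0F 0F 1F)
    reflects 0F 4F = ofⁿ 0≁3
    reflects 0F 5F = ofʸ 0∼5
    reflects 1F 0F = flip (reflects 0F 1F)
    reflects 1F 1F = ofⁿ (irrefl refl)
    reflects 1F 2F = ofʸ 2∼4
    reflects 1F 3F = ofⁿ (1≁2 ∘ ∼-sym)
    reflects 1F 4F = ofⁿ (y′-unpaired 1F 0F 1F)
    reflects 1F 5F = ofⁿ 2≁5
    reflects 2F 0F = flip (reflects 0F 2F)
    reflects 2F 1F = flip (reflects 1F 2F)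
    reflects 2F 2F = ofⁿ (irrefl refl)
    reflects 2F 3F = ofʸ (∼-sym 1∼4)
    reflects 2F 4F = ofⁿ (3≁4 ∘ ∼-sym)
    reflects 2F 5F = ofⁿ (y′-unpaired 2F 0F 1F)
    reflects 3F 0F = flip (reflects 0F 3F)
    reflects 3F 1F = flip (reflects 1F 3F)
    reflects 3F 2F = flip (reflects 2F 3F)
    reflects 3F 3F = ofⁿ (irrefl refl)
    reflects 3F 4F = ofʸ 1∼3
    reflects 3F 5F = ofⁿ 1≁5
    reflects 4F 0F = flip (reflects 0F 4F)
    reflects 4F 1F = flip (reflects 1F 4F)
    reflects 4F 2F = flip (reflects 2F 4F)
    reflects 4F 3F = flip (reflects 3F 4F)
    reflects 4F 4F = ofⁿ (irrefl refl)
    reflects 4F 5F = ofʸ 3∼5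
    reflects 5F 0F = flip (reflects 0F 5F)
    reflects 5F 1F = flip (reflects 1F 5F)
    reflects 5F 2F = flip (reflects 2F 5F)
    reflects 5F 3F = flip (reflects 3F 5F)
    reflects 5F 4F = flip (reflects 4F 5F)
    reflects 5F 5F = ofⁿ (irrefl refl)

    admissible : Admissible ordering₂
    admissible = shared 0F , shared 1F , shared 2F , λ s t →
      reflects⇒⇔ (reflects s t) (proof (consecutive? s t))
      where
      shared : ∀ k → CommonNeighbourIn Γ x 1 (y′ k 0F) (y′ k 1F)
      shared k = z k , ∼⇒dist≡1 (x∼z k) , z∼Y k _ , z∼Y k _
      reflects⇒⇔ : ∀ {P Q : Set} {v} → Reflects P v → Reflects Q v → P ⇔ Q
      reflects⇒⇔ (ofʸ p)  (ofʸ q)  = mk⇔ (λ _ → q) (λ _ → p)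
      reflects⇒⇔ (ofⁿ ¬p) (ofⁿ ¬q) = mk⇔ (λ p → contradiction p ¬p) (λ q → contradiction q ¬q)

-- Vectors with integer coordinates, in terms of a relabelling of the indices

module Table (π : Permutation m n) where

  σ : Fin m → Fin n
  σ = π ⟨$⟩ʳ_

  infix 4 _≋_
  _≋_ : 𝕍 (Fin n) → (Fin m → ℤ) → Set
  v ≋ f = ∀ p → v (σ p) ≈ᶜ fromℤ (f p)

  σ-elim : (P : Fin n → Set) → (∀ p → P (σ p)) → ∀ y → P y
  σ-elim P h y = subst P (inverseʳ π) (h (π ⟨$⟩ˡ y))

  ≋⇒≈ᵛ : ∀ {u v f g} → u ≋ f → v ≋ g → (∀ p → f p ≡ g p) → u ≈ᵛ v
  ≋⇒≈ᵛ {u} {v} u≋f v≋g f≡g = σ-elim (λ y → u y ≈ᶜ v y)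
    (λ p → R.trans (u≋f p) (R.trans (≡⇒≈ᶜ (cong fromℤ (f≡g p))) (R.sym (v≋g p))))

  sum-σ : (f : Fin n → ℂ) → sum f ≈ᶜ sum (λ p → f (σ p))
  sum-σ f = ∑-permute f π

  ∙-≋ : ∀ {u v f g} → u ≋ f → v ≋ g → u ∙ v ≈ᶜ fromℤ (sumℤ (λ p → f p ℤ.* g p))
  ∙-≋ {u} {v} {f} {g} u≋f v≋g = R.trans (sum-σ (λ y → u y *ᶜ v y)) (R.trans
    (sum-cong (λ p → R.trans (R.*-cong (u≋f p) (v≋g p)) (R.sym (fromℤ-* (f p) (g p)))))
    (R.sym (fromℤ-sum (λ p → f p ℤ.* g p))))

  ⟨⟩-≋ : ∀ {u v f g} → u ≋ f → v ≋ g → ⟨ u , v ⟩ ≈ᶜ fromℤ (sumℤ (λ p → f p ℤ.* g p))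
  ⟨⟩-≋ {g = g} u≋f v≋g = ∙-≋ u≋f (λ p → R.trans (conj-cong (v≋g p)) (conj-fromℤ (g p)))

  *ᵛ-≋ : ∀ {M : Mat n n} {N : Fin m → Fin m → ℤ} {v f} → (∀ p q → M (σ p , σ q) ≈ᶜ fromℤ (N p q)) →
    v ≋ f → M *ᵛ v ≋ λ p → sumℤ (λ q → N p q ℤ.* f q)
  *ᵛ-≋ M≋N v≋f p = ∙-≋ (M≋N p) v≋f

  linComb-≋ : {c : Fin k → ℤ} {vs : Fin k → 𝕍 (Fin n)} {f : Fin k → Fin m → ℤ} →
    (∀ j → vs j ≋ f j) → linComb (λ j → fromℤ (c j)) vs ≋ λ p → sumℤ (λ j → c j ℤ.* f j p)
  linComb-≋ {c = c} {f = f} vs≋f p = R.trans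
    (sum-cong (λ j → R.trans (R.*-congˡ (vs≋f j p)) (R.sym (fromℤ-* (c j) (f j p)))))
    (R.sym (fromℤ-sum (λ j → c j ℤ.* f j p)))

  ≋⇒NonZero : ∀ {v f} → v ≋ f → ∃[ p ] f p ≢ ℤ.0ℤ → NonZero v
  ≋⇒NonZero v≋f (p , fp≢0) = σ p , #0-resp (R.sym (v≋f p)) (fromℤ-#0 fp≢0)

  realise : (Fin m → ℤ) → 𝕍 (Fin n)
  realise f y = fromℤ (f (π ⟨$⟩ˡ y))

  realise-≋ : ∀ f → realise f ≋ f
  realise-≋ f p = ≡⇒≈ᶜ (cong (fromℤ ∘ f) (inverseˡ π))

  sum-δ-scaled : ∀ N (v : 𝕍 (Fin n)) (K : Fin m → ℤ) p → (∀ q → K q ≡ N ℤ.* δℤ (q ≟ᶠ p)) →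
    sum (λ q → v (σ q) *ᶜ fromℤ (K q)) ≈ᶜ fromℤ N *ᶜ v (σ p)
  sum-δ-scaled N v K p K≡ = begin
    sum (λ q → v (σ q) *ᶜ fromℤ (K q))
      ≈⟨ sum-cong (λ q → R.trans (R.*-congˡ (R.trans (≡⇒≈ᶜ (cong fromℤ (K≡ q)))
           (R.trans (fromℤ-* N _) (R.*-congˡ (≡⇒≈ᶜ (fromℤ-δ (q ≟ᶠ p))))))) (R.sym (R.*-assoc _ _ _))) ⟩
    sum (λ q → v (σ q) *ᶜ fromℤ N *ᶜ [ q ≟ᶠ p ]ᶜ)
      ≈⟨ sum-δʳ p (λ q → v (σ q) *ᶜ fromℤ N) ⟩
    v (σ p) *ᶜ fromℤ N
      ≈⟨ R.*-comm _ _ ⟩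
    fromℤ N *ᶜ v (σ p) ∎
    where open ℂ-Reasoning

-- A diagonalisation over ℤ, where the dual basis is scaled by a common
-- denominator N.

record IntegerDiagonalisation (M : Fin m → Fin m → ℤ) : Set where
  field
    N         : ℤ
    N≢0       : N ≢ ℤ.0ℤ
    θ         : Fin m → ℤ
    u u*      : Fin m → Fin m → ℤ
    eigen     : ∀ j p → sumℤ (λ q → M p q ℤ.* u j q) ≡ θ j ℤ.* u j p
    dual      : ∀ i j → sumℤ (λ p → u* i p ℤ.* u j p) ≡ N ℤ.* δℤ (i ≟ᶠ j)
    complete  : ∀ p q → sumℤ (λ j → u* j q ℤ.* u j p) ≡ N ℤ.* δℤ (q ≟ᶠ p)
    nonZero   : ∀ j → ∃[ p ] u j p ≢ ℤ.0ℤ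

diagonalise : (π : Permutation m n) {M : Mat n n} {M̂ : Fin m → Fin m → ℤ} →
  (∀ p q → M (π ⟨$⟩ʳ p , π ⟨$⟩ʳ q) ≈ᶜ fromℤ (M̂ p q)) → IntegerDiagonalisation M̂ → Diagonalisation m M
diagonalise {m} {n} π {M} {M̂} M≋M̂ D = record
  { θ        = D.θ
  ; u        = λ j → realise (D.u j)
  ; u*       = λ j → N⁻¹ · realise (D.u* j)
  ; eigen    = λ j → ≋⇒≈ᵛ (*ᵛ-≋ {M = M} {N = M̂} M≋M̂ (realise-≋ (D.u j)))
      (λ p → R.trans (R.*-congˡ (realise-≋ (D.u j) p)) (R.sym (fromℤ-* (D.θ j) (D.u j p)))) (D.eigen j)
  ; dual     = λ i j → begin
      (N⁻¹ · realise (D.u* i)) ∙ realise (D.u j)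
        ≈⟨ ·-∙ (realise (D.u* i)) (realise (D.u j)) ⟩
      N⁻¹ *ᶜ (realise (D.u* i) ∙ realise (D.u j))
        ≈⟨ R.*-congˡ (∙-≋ (realise-≋ (D.u* i)) (realise-≋ (D.u j))) ⟩
      N⁻¹ *ᶜ fromℤ (sumℤ (λ p → D.u* i p ℤ.* D.u j p))
        ≈⟨ R.*-congˡ (R.trans (≡⇒≈ᶜ (cong fromℤ (D.dual i j)))
           (R.trans (fromℤ-* D.N _) (R.*-congˡ (≡⇒≈ᶜ (fromℤ-δ (i ≟ᶠ j)))))) ⟩
      N⁻¹ *ᶜ (fromℤ D.N *ᶜ [ i ≟ᶠ j ]ᶜ)
        ≈⟨ cancel [ i ≟ᶠ j ]ᶜ ⟩
      [ i ≟ᶠ j ]ᶜ ∎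
  ; complete = λ v → σ-elim _ (λ p → R.sym (begin
      sum (λ j → ((N⁻¹ · realise (D.u* j)) ∙ v) *ᶜ realise (D.u j) (σ p))
        ≈⟨ sum-cong (λ j → R.trans (R.*-cong (·-∙ (realise (D.u* j)) v) (realise-≋ (D.u j) p)) (R.*-assoc _ _ _)) ⟩
      sum (λ j → N⁻¹ *ᶜ (realise (D.u* j) ∙ v *ᶜ fromℤ (D.u j p)))
        ≈⟨ *-distribˡ-sum N⁻¹ (λ j → realise (D.u* j) ∙ v *ᶜ fromℤ (D.u j p)) ⟨
      N⁻¹ *ᶜ sum (λ j → realise (D.u* j) ∙ v *ᶜ fromℤ (D.u j p))
        ≈⟨ R.*-congˡ (sum-cong (λ j → expand v p j)) ⟩
      N⁻¹ *ᶜ sum (λ j → sum (λ q → v (σ q) *ᶜ fromℤ (D.u* j q ℤ.* D.u j p)))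
        ≈⟨ R.*-congˡ (∑-comm (λ j q → v (σ q) *ᶜ fromℤ (D.u* j q ℤ.* D.u j p))) ⟩
      N⁻¹ *ᶜ sum (λ q → sum (λ j → v (σ q) *ᶜ fromℤ (D.u* j q ℤ.* D.u j p)))
        ≈⟨ R.*-congˡ (sum-cong (λ q → R.trans (R.sym (*-distribˡ-sum (v (σ q)) (λ j → fromℤ (D.u* j q ℤ.* D.u j p))))
             (R.*-congˡ (R.sym (fromℤ-sum (λ j → D.u* j q ℤ.* D.u j p)))))) ⟩
      N⁻¹ *ᶜ sum (λ q → v (σ q) *ᶜ fromℤ (sumℤ (λ j → D.u* j q ℤ.* D.u j p)))
        ≈⟨ R.*-congˡ (sum-δ-scaled D.N v _ p (D.complete p)) ⟩
      N⁻¹ *ᶜ (fromℤ D.N *ᶜ v (σ p))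
        ≈⟨ cancel (v (σ p)) ⟩
      v (σ p) ∎))
  ; nonZero  = λ j → ≋⇒NonZero (realise-≋ (D.u j)) (D.nonZero j)
  }
  where
  module D = IntegerDiagonalisation D
  open Table π
  open ℂ-Reasoning
  N⁻¹ : ℂ
  N⁻¹ = proj₁ (fromℤ-invertible D.N≢0)
  cancel : ∀ z → N⁻¹ *ᶜ (fromℤ D.N *ᶜ z) ≈ᶜ z
  cancel z = R.trans (R.sym (R.*-assoc _ _ _)) (R.trans
    (R.*-congʳ (R.trans (R.*-comm _ _) (proj₂ (fromℤ-invertible D.N≢0)))) (R.*-identityˡ z))
  ·-∙ : ∀ (u v : 𝕍 (Fin n)) → (N⁻¹ · u) ∙ v ≈ᶜ N⁻¹ *ᶜ (u ∙ v)
  ·-∙ u v = R.trans (sum-cong (λ i → R.*-assoc N⁻¹ (u i) (v i))) (R.sym (*-distribˡ-sum N⁻¹ (λ i → u i *ᶜ v i)))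
  expand : ∀ v p j → realise (D.u* j) ∙ v *ᶜ fromℤ (D.u j p) ≈ᶜ sum (λ q → v (σ q) *ᶜ fromℤ (D.u* j q ℤ.* D.u j p))
  expand v p j = R.trans (R.*-congʳ (sum-σ (λ y → realise (D.u* j) y *ᶜ v y))) (R.trans
    (*-distribʳ-sum (fromℤ (D.u j p)) (λ q → realise (D.u* j) (σ q) *ᶜ v (σ q)))
    (sum-cong (λ q → R.trans (R.*-congʳ (R.trans (R.*-congʳ (realise-≋ (D.u* j) q)) (R.*-comm _ _)))
      (R.trans (R.*-assoc _ _ _) (R.*-congˡ (R.sym (fromℤ-* (D.u* j q) (D.u j p))))))))

-- Eigenvalues of the matrices of the four types

eigenTable : ∀ t → IntegerDiagonalisation (Bℤ t)
eigenTable I = record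
  { N = ℤ.+ 90 ; N≢0 = λ () ; θ = θ
  ; u = u ; u* = u*
  ; eigen    = from-yes (all? λ j → all? λ p → sumℤ (λ q → Bℤ I p q ℤ.* u j q) ℤ.≟ θ j ℤ.* u j p)
  ; dual     = from-yes (all? λ i → all? λ j → sumℤ (λ p → u* i p ℤ.* u j p) ℤ.≟ ℤ.+ 90 ℤ.* δℤ (i ≟ᶠ j))
  ; complete = from-yes (all? λ p → all? λ q → sumℤ (λ j → u* j q ℤ.* u j p) ℤ.≟ ℤ.+ 90 ℤ.* δℤ (q ≟ᶠ p))
  ; nonZero  = from-yes (all? λ j → any? λ p → ¬? (u j p ℤ.≟ ℤ.0ℤ))
  }
  where
  θ : Fin 3 → ℤ
  θ = lookup (ℤ.+ 3 ∷ ℤ.+ 1 ∷ ℤ.-[1+ 1 ] ∷ [])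
  u u* : Fin 3 → Fin 3 → ℤ
  u j = lookup (lookup
    ( (ℤ.+ 1 ∷ ℤ.+ 1 ∷ ℤ.+ 1 ∷ [])
    ∷ (ℤ.+ 3 ∷ ℤ.+ 1 ∷ ℤ.-[1+ 0 ] ∷ [])
    ∷ (ℤ.+ 6 ∷ ℤ.-[1+ 3 ] ∷ ℤ.+ 1 ∷ [])
    ∷ []) j)
  -- Bℤ I is symmetric for the form with weights 1, 3, 6, in which the three
  -- eigenvectors have norms 10, 18 and 90; the dual basis is obtained from it.
  u* j p = lookup (ℤ.+ 9 ∷ ℤ.+ 5 ∷ ℤ.+ 1 ∷ []) j ℤ.* (lookup (ℤ.+ 1 ∷ ℤ.+ 3 ∷ ℤ.+ 6 ∷ []) p ℤ.* u j p)
eigenTable II = record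
  -- This matrix is symmetric for the form with weights 1 and 2; its eigenvectors have norms 6 and
  -- 3, with least common multiple 6.
  { N = ℤ.+ 6 ; N≢0 = λ () ; θ = θ
  ; u = u ; u* = u*
  ; eigen    = from-yes (all? λ j → all? λ p → sumℤ (λ q → Bℤ II p q ℤ.* u j q) ℤ.≟ θ j ℤ.* u j p)
  ; dual     = from-yes (all? λ i → all? λ j → sumℤ (λ p → u* i p ℤ.* u j p) ℤ.≟ ℤ.+ 6 ℤ.* δℤ (i ≟ᶠ j))
  ; complete = from-yes (all? λ p → all? λ q → sumℤ (λ j → u* j q ℤ.* u j p) ℤ.≟ ℤ.+ 6 ℤ.* δℤ (q ≟ᶠ p))
  ; nonZero  = from-yes (all? λ j → any? λ p → ¬? (u j p ℤ.≟ ℤ.0ℤ))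
  }
  where
  θ : Fin 2 → ℤ
  θ = lookup (ℤ.+ 1 ∷ ℤ.-[1+ 1 ] ∷ [])
  u u* : Fin 2 → Fin 2 → ℤ
  u j = lookup (lookup ((ℤ.+ 2 ∷ ℤ.+ 1 ∷ []) ∷ (ℤ.+ 1 ∷ ℤ.-[1+ 0 ] ∷ []) ∷ []) j)
  u* j p = lookup (ℤ.+ 1 ∷ ℤ.+ 2 ∷ []) j ℤ.* (lookup (ℤ.+ 1 ∷ ℤ.+ 2 ∷ []) p ℤ.* u j p)
eigenTable III = record
  { N = ℤ.+ 1 ; N≢0 = λ () ; θ = λ _ → ℤ.+ 1 ; u = λ _ _ → ℤ.+ 1 ; u* = λ _ _ → ℤ.+ 1
  ; eigen = λ { 0F 0F → refl } ; dual = λ { 0F 0F → refl } ; complete = λ { 0F 0F → refl }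
  ; nonZero = λ _ → 0F , λ () }
eigenTable IV = record
  { N = ℤ.+ 1 ; N≢0 = λ () ; θ = λ _ → ℤ.-[1+ 1 ] ; u = λ _ _ → ℤ.+ 1 ; u* = λ _ _ → ℤ.+ 1
  ; eigen = λ { 0F 0F → refl } ; dual = λ { 0F 0F → refl } ; complete = λ { 0F 0F → refl }
  ; nonZero = λ _ → 0F , λ () }

eigenvaluesOfType : ∀ t → HasEigenvalues (TypeData.matrixOfA (typeData t)) (TypeData.eigenvalues (typeData t))
eigenvaluesOfType t = hasEigenvalues _ (listed t) (attained t)
  where
  open Diagonalisation (diagonalise Perm.id (λ p q → ≡⇒≈ᶜ (matrixOfA≡ t p q)) (eigenTable t))
  listed : ∀ t j → Any (fromℤ (IntegerDiagonalisation.θ (eigenTable t) j) ≈ᶜ_) (TypeData.eigenvalues (typeData t))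
  listed I   0F = here R.refl
  listed I   1F = there (here R.refl)
  listed I   2F = there (there (here R.refl))
  listed II  0F = here R.refl
  listed II  1F = there (here R.refl)
  listed III 0F = here R.refl
  listed IV  0F = here R.refl
  attained : ∀ t ϑ → Any (ϑ ≈ᶜ_) (TypeData.eigenvalues (typeData t)) →
    ∃[ j ] ϑ ≈ᶜ fromℤ (IntegerDiagonalisation.θ (eigenTable t) j)
  attained I   ϑ (here e)                 = 0F , e
  attained I   ϑ (there (here e))         = 1F , e
  attained I   ϑ (there (there (here e))) = 2F , e
  attained II  ϑ (here e)                 = 0F , e
  attained II  ϑ (there (here e))         = 1F , e
  attained III ϑ (here e)                 = 0F , e
  attained IV  ϑ (here e)                 = 0F , e

-- Integer tables for the Petersen graph

label : Fin 10 → Label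
label = lookup (centre ∷ inner 0F ∷ inner 1F ∷ inner 2F ∷
  outer 0F ∷ outer 1F ∷ outer 2F ∷ outer 3F ∷ outer 4F ∷ outer 5F ∷ [])

code : Label → Fin 10
code centre    = 0F
code (inner k) = 1 Fin.↑ʳ (k Fin.↑ˡ 6)
code (outer j) = 4 Fin.↑ʳ j

code-label : ∀ p → code (label p) ≡ p
code-label = from-yes (all? (λ p → code (label p) ≟ᶠ p))

label-code : ∀ l → label (code l) ≡ l
label-code centre     = refl
label-code (inner 0F) = refl
label-code (inner 1F) = refl
label-code (inner 2F) = refl
label-code (outer 0F) = refl
label-code (outer 1F) = refl
label-code (outer 2F) = refl
label-code (outer 3F) = refl
label-code (outer 4F) = refl
label-code (outer 5F) = refl

onInner : (Fin 3 → ℤ) → Label → ℤ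
onInner f (inner k) = f k
onInner f _         = ℤ.0ℤ

onOuter : (Fin 6 → ℤ) → Label → ℤ
onOuter f (outer j) = f j
onOuter f _         = ℤ.0ℤ

seedℤ₁ₐ seedℤ₁ᵦ : Vec ℤ 3
seedℤ₁ₐ = ℤ.+ 1 ∷ ℤ.-[1+ 0 ] ∷ ℤ.+ 0 ∷ []
seedℤ₁ᵦ = ℤ.+ 1 ∷ ℤ.+ 1 ∷ ℤ.-[1+ 1 ] ∷ []

seedℤ₂ₐ seedℤ₂ᵦ seedℤ₂ᵪ : Vec ℤ 6
seedℤ₂ₐ = ℤ.+ 1 ∷ ℤ.-[1+ 0 ] ∷ ℤ.+ 1 ∷ ℤ.-[1+ 0 ] ∷ ℤ.+ 0 ∷ ℤ.+ 0 ∷ []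
seedℤ₂ᵦ = ℤ.+ 1 ∷ ℤ.-[1+ 0 ] ∷ ℤ.-[1+ 0 ] ∷ ℤ.+ 1 ∷ ℤ.-[1+ 1 ] ∷ ℤ.+ 2 ∷ []
seedℤ₂ᵪ = ℤ.+ 1 ∷ ℤ.-[1+ 0 ] ∷ ℤ.-[1+ 0 ] ∷ ℤ.+ 1 ∷ ℤ.+ 1 ∷ ℤ.-[1+ 0 ] ∷ []

eigenvalue : Fin 10 → ℤ
eigenvalue = lookup (ℤ.+ 3 ∷ ℤ.+ 1 ∷ ℤ.+ 1 ∷ ℤ.+ 1 ∷ ℤ.+ 1 ∷ ℤ.+ 1 ∷
  ℤ.-[1+ 1 ] ∷ ℤ.-[1+ 1 ] ∷ ℤ.-[1+ 1 ] ∷ ℤ.-[1+ 1 ] ∷ [])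

module Tables (ρ : Fin 3 → Fin 3) where

  -- A takes a vector on the inner vertices with sum 0 to its pullback along ρ.
  wℤ : ∀ i → Fin (dim (typeOf i)) → Label → ℤ
  wℤ 0F k l  = δℤ (level l ℕ.≟ toℕ k)
  wℤ 1F 0F   = onInner (lookup seedℤ₁ₐ)
  wℤ 1F 1F   = onOuter (λ j → lookup seedℤ₁ₐ (ρ (pair j)))
  wℤ 2F 0F   = onInner (lookup seedℤ₁ᵦ)
  wℤ 2F 1F   = onOuter (λ j → lookup seedℤ₁ᵦ (ρ (pair j)))
  wℤ 3F _    = onOuter (lookup seedℤ₂ₐ)
  wℤ 4F _    = onOuter (lookup seedℤ₂ᵦ)
  wℤ 5F _    = onOuter (lookup seedℤ₂ᵪ)

  Aℤ : Fin 10 → Fin 10 → ℤ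
  Aℤ p q = if adjacent? ρ (label p) (label q) then ℤ.1ℤ else ℤ.0ℤ

  gram : ∀ i j → Fin (dim (typeOf i)) → Fin (dim (typeOf j)) → ℤ
  gram i j a b = sumℤ (λ p → wℤ i a (label p) ℤ.* wℤ j b (label p))

  -- 12 divided by the norm of wℤ i a.
  weight : ∀ i → Fin (dim (typeOf i)) → ℤ
  weight 0F = lookup (ℤ.+ 12 ∷ ℤ.+ 4 ∷ ℤ.+ 2 ∷ [])
  weight 1F = lookup (ℤ.+ 6 ∷ ℤ.+ 3 ∷ [])
  weight 2F = lookup (ℤ.+ 2 ∷ ℤ.+ 1 ∷ [])
  weight 3F = lookup (ℤ.+ 3 ∷ [])
  weight 4F = lookup (ℤ.+ 1 ∷ [])
  weight 5F = lookup (ℤ.+ 2 ∷ [])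

  -- The eigenvectors in the single summands, and 180 divided by their norms.
  eigenvector : Fin 10 → Fin 10 → ℤ
  eigenvector j p = lookup
    ( at 0F (λ a → IntegerDiagonalisation.u (eigenTable I) 0F a)
    ∷ at 0F (λ a → IntegerDiagonalisation.u (eigenTable I) 1F a)
    ∷ at 1F (λ a → IntegerDiagonalisation.u (eigenTable II) 0F a)
    ∷ at 2F (λ a → IntegerDiagonalisation.u (eigenTable II) 0F a)
    ∷ at 3F (λ _ → ℤ.+ 1)
    ∷ at 4F (λ _ → ℤ.+ 1)
    ∷ at 0F (λ a → IntegerDiagonalisation.u (eigenTable I) 2F a)
    ∷ at 1F (λ a → IntegerDiagonalisation.u (eigenTable II) 1F a)
    ∷ at 2F (λ a → IntegerDiagonalisation.u (eigenTable II) 1F a)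
    ∷ at 5F (λ _ → ℤ.+ 1)
    ∷ []) j
    where
    at : ∀ i → (Fin (dim (typeOf i)) → ℤ) → ℤ
    at i c = sumℤ (λ a → c a ℤ.* wℤ i a (label p))

  dualEigenvector : Fin 10 → Fin 10 → ℤ
  dualEigenvector j p = lookup (ℤ.+ 18 ∷ ℤ.+ 10 ∷ ℤ.+ 15 ∷ ℤ.+ 5 ∷ ℤ.+ 45 ∷ ℤ.+ 15 ∷
    ℤ.+ 2 ∷ ℤ.+ 30 ∷ ℤ.+ 10 ∷ ℤ.+ 30 ∷ []) j ℤ.* eigenvector j p

open Tables

-- Verification of the tables for all six labellings

perm : Fin 3 → Fin 3 → Fin 3 → Fin 3 → Fin 3
perm a b c = lookup (a ∷ b ∷ c ∷ [])

-- Evaluation needs closed functions, so a bijection is represented by the triple of its values.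
forPermutations? : {P : (Fin 3 → Fin 3) → Set} → (∀ ρ → Dec (P ρ)) →
  Dec (∀ a b c → a ≢ b → a ≢ c → b ≢ c → P (perm a b c))
forPermutations? P? = all? λ a → all? λ b → all? λ c →
  ¬? (a ≟ᶠ b) →-dec (¬? (a ≟ᶠ c) →-dec (¬? (b ≟ᶠ c) →-dec P? (perm a b c)))

-- The fields `complete-table` and `eigenComplete-table` are the resolutions of the identity by two
-- orthogonal bases, scaled by 12 and 180; they supply spanning without a dimension count.
record IsTable (ρ : Fin 3 → Fin 3) : Set where
  field
    A-table        : ∀ i k p → sumℤ (λ q → Aℤ ρ p q ℤ.* wℤ ρ i k (label q)) ≡
                       sumℤ (λ a → Bℤ (typeOf i) a k ℤ.* wℤ ρ i a (label p))
    level-table    : ∀ i k p → wℤ ρ i k (label p) ≡ ℤ.0ℤ ⊎ level (label p) ≡ endpoint (typeOf i) ℕ.+ toℕ k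
    gram-table     : ∀ i j a b → i ≢ j → gram ρ i j a b ≡ ℤ.0ℤ
    gram-row-table : ∀ i a b → a ≢ b → gram ρ i i a b ≡ ℤ.0ℤ
    norm-table     : ∀ i a → gram ρ i i a a ≢ ℤ.0ℤ
    nonZero-table  : ∀ i a → ∃[ p ] wℤ ρ i a (label p) ≢ ℤ.0ℤ
    complete-table : ∀ p q → sumℤ (λ i → sumℤ (λ a → weight ρ i a ℤ.* (wℤ ρ i a (label q) ℤ.* wℤ ρ i a (label p)))) ≡
                       ℤ.+ 12 ℤ.* δℤ (q ≟ᶠ p)
    eigen-table    : ∀ j p → sumℤ (λ q → Aℤ ρ p q ℤ.* eigenvector ρ j q) ≡ eigenvalue j ℤ.* eigenvector ρ j p
    dual-table     : ∀ i j → sumℤ (λ p → dualEigenvector ρ i p ℤ.* eigenvector ρ j p) ≡ ℤ.+ 180 ℤ.* δℤ (i ≟ᶠ j)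
    eigenComplete-table : ∀ p q → sumℤ (λ j → dualEigenvector ρ j q ℤ.* eigenvector ρ j p) ≡ ℤ.+ 180 ℤ.* δℤ (q ≟ᶠ p)
    eigenNonZero-table  : ∀ j → ∃[ p ] eigenvector ρ j p ≢ ℤ.0ℤ

isTable? : ∀ ρ → Dec (IsTable ρ)
isTable? ρ = map′
  (λ (p₁ , p₂ , p₃ , p₄ , p₅ , p₆ , p₇ , p₈ , p₉ , p₁₀ , p₁₁) → record
    { A-table = p₁ ; level-table = p₂ ; gram-table = p₃ ; gram-row-table = p₄ ; norm-table = p₅
    ; nonZero-table = p₆ ; complete-table = p₇ ; eigen-table = p₈ ; dual-table = p₉
    ; eigenComplete-table = p₁₀ ; eigenNonZero-table = p₁₁ })
  (λ t → let open IsTable t in A-table , level-table , gram-table , gram-row-table , norm-table ,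
    nonZero-table , complete-table , eigen-table , dual-table , eigenComplete-table , eigenNonZero-table)
  ( (all? λ i → all? λ k → all? λ p → _ ℤ.≟ _)
  ×-dec (all? λ i → all? λ k → all? λ p → (_ ℤ.≟ _) ⊎-dec (_ ℕ.≟ _))
  ×-dec (all? λ i → all? λ j → all? λ a → all? λ b → ¬? (i ≟ᶠ j) →-dec (_ ℤ.≟ _))
  ×-dec (all? λ i → all? λ a → all? λ b → ¬? (a ≟ᶠ b) →-dec (_ ℤ.≟ _))
  ×-dec (all? λ i → all? λ a → ¬? (_ ℤ.≟ _))
  ×-dec (all? λ i → all? λ a → any? λ p → ¬? (_ ℤ.≟ _))
  ×-dec (all? λ p → all? λ q → _ ℤ.≟ _)
  ×-dec (all? λ j → all? λ p → _ ℤ.≟ _)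
  ×-dec (all? λ i → all? λ j → _ ℤ.≟ _)
  ×-dec (all? λ p → all? λ q → _ ℤ.≟ _)
  ×-dec (all? λ j → any? λ p → ¬? (_ ℤ.≟ _)))

opaque
  perm-isTable : ∀ a b c → a ≢ b → a ≢ c → b ≢ c → IsTable (perm a b c)
  perm-isTable = from-yes (forPermutations? isTable?)

eigenTableOfA : ∀ {ρ} → IsTable ρ → IntegerDiagonalisation (Aℤ ρ)
eigenTableOfA {ρ} t = record
  { N = ℤ.+ 180 ; N≢0 = λ () ; θ = eigenvalue ; u = eigenvector ρ ; u* = dualEigenvector ρ
  ; eigen = eigen-table ; dual = dual-table ; complete = eigenComplete-table ; nonZero = eigenNonZero-table }
  where open IsTable t

module _ {Γ : Graph n} {x : Fin n} {i : ℕ} (o : Ordering Γ x i k) where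
  open Ordering o

  fromEssential-at : ∀ e t → fromEssential o e (at t) ≡ lookup e t
  fromEssential-at e t with any? (λ s → at s ≟ᶠ at t)
  ... | yes (s , e′) = cong (lookup e) (injective e′)
  ... | no ∄         = contradiction (t , refl) ∄

  fromEssential-off : ∀ e {y} → (∀ t → at t ≢ y) → fromEssential o e y ≡ 0ᶜ
  fromEssential-off e {y} off with any? (λ s → at s ≟ᶠ y)
  ... | yes (s , e′) = contradiction e′ (off s)
  ... | no _         = refl

-- The model given by a labelling of the vertices

module LabelledModel {Γ : Graph n} (2≤n : 2 ℕ.≤ n) (dr : DistanceRegular Γ 2)
  (ia : HasIntersectionArray Γ (3 ∷ 2 ∷ []) (1 ∷ 1 ∷ []))
  (x : Fin n) (o₁ : Ordering Γ x 1 3) (o₂ : Ordering Γ x 2 6) (admissible : Admissible o₂) where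
  open Graph Γ
  open Terwilliger Γ 2 x
  open Petersen Γ 2≤n dr ia
  module L = Labelling x o₁ o₂ admissible

  ρ : Fin 3 → Fin 3
  ρ = perm (L.ρ 0F) (L.ρ 1F) (L.ρ 2F)

  -- The tables concern the function rebuilt from its three values, which agrees with `L.ρ`
  -- pointwise only; `adjacent?-ρ` carries this agreement to adjacency.
  ρ≗L : ∀ i → ρ i ≡ L.ρ i
  ρ≗L 0F = refl
  ρ≗L 1F = refl
  ρ≗L 2F = refl

  opaque
    isTable : IsTable ρ
    isTable = perm-isTable _ _ _ (distinct 0F 1F λ ()) (distinct 0F 2F λ ()) (distinct 1F 2F λ ())
      where
      distinct : ∀ i j → i ≢ j → L.ρ i ≢ L.ρ j
      distinct i j i≢j e = i≢j (L.ρ-injective i j e)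

  open IsTable isTable

  adjacent?-ρ : ∀ l m → adjacent? ρ l m ≡ adjacent? L.ρ l m
  adjacent?-ρ centre    centre    = refl
  adjacent?-ρ centre    (inner _) = refl
  adjacent?-ρ centre    (outer _) = refl
  adjacent?-ρ (inner _) centre    = refl
  adjacent?-ρ (inner _) (inner _) = refl
  adjacent?-ρ (inner k) (outer j) = cong (λ i → does (i ≟ᶠ k)) (ρ≗L (pair j))
  adjacent?-ρ (outer _) centre    = refl
  adjacent?-ρ (outer j) (inner k) = cong (λ i → does (i ≟ᶠ k)) (ρ≗L (pair j))
  adjacent?-ρ (outer _) (outer _) = refl

  π : Permutation 10 n
  π = permutation (λ p → L.place (label p)) (λ v → code (labelOf v))
    (λ v → trans (cong L.place (label-code (labelOf v))) (proj₂ (L.place-surjective v)))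
    (λ p → trans (cong code (L.place-injective (labelOf (L.place (label p))) (label p)
      (proj₂ (L.place-surjective (L.place (label p)))))) (code-label p))
    where
    labelOf : Fin n → Label
    labelOf v = proj₁ (L.place-surjective v)

  open Table π

  A-≋ : ∀ p q → A (σ p , σ q) ≈ᶜ fromℤ (Aℤ ρ p q)
  A-≋ p q = ≡⇒≈ᶜ (trans (cong (λ b → if b then 1ᶜ else 0ᶜ)
      (trans (L.place-adjacency (label p) (label q)) (sym (adjacent?-ρ (label p) (label q)))))
    (branch (adjacent? ρ (label p) (label q))))
    where
    branch : ∀ b → (if b then 1ᶜ else 0ᶜ) ≡ fromℤ (if b then ℤ.1ℤ else ℤ.0ℤ)
    branch true  = refl
    branch false = refl

  E*-*ᵛ : ∀ h v p → (E* h *ᵛ v) (σ p) ≈ᶜ [ level (label p) ℕ.≟ h ]ᶜ *ᶜ v (σ p)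
  E*-*ᵛ h v p = R.trans
    (sum-single (σ p) (λ z → E* h (σ p , z) *ᶜ v z) (λ z z≢ → R.trans (R.*-congʳ (≡⇒≈ᶜ (off z z≢))) (R.zeroˡ (v z))))
    (R.*-congʳ (≡⇒≈ᶜ (trans on (cong (λ d → [ d ℕ.≟ h ]ᶜ) (L.place-level (label p))))))
    where
    off : ∀ z → z ≢ σ p → E* h (σ p , z) ≡ 0ᶜ
    off z z≢ with σ p ≟ᶠ z
    ... | yes e = contradiction (sym e) z≢
    ... | no _  = refl
    on : E* h (σ p , σ p) ≡ [ dist Γ x (σ p) ℕ.≟ h ]ᶜ
    on with σ p ≟ᶠ σ p
    ... | yes _ = refl
    ... | no ≢  = contradiction refl ≢

  e*-≋ : ∀ h → e* h ≋ λ p → δℤ (level (label p) ℕ.≟ h)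
  e*-≋ h p = ≡⇒≈ᶜ (trans (cong (λ d → [ d ℕ.≟ h ]ᶜ) (L.place-level (label p)))
    (sym (fromℤ-δ (level (label p) ℕ.≟ h))))

  inner-≋ : ∀ (e : Vec ℤ 3) → fromEssential o₁ (Vec.map fromℤ e) ≋ λ p → onInner (lookup e) (label p)
  inner-≋ e p = ≡⇒≈ᶜ (go (label p))
    where
    go : ∀ l → fromEssential o₁ (Vec.map fromℤ e) (L.place l) ≡ fromℤ (onInner (lookup e) l)
    go centre    = fromEssential-off o₁ _ (λ t e → case L.place-injective (inner t) centre e of λ ())
    go (inner k) = trans (fromEssential-at o₁ _ k) (Vec.lookup-map k fromℤ e)
    go (outer j) = fromEssential-off o₁ _ (λ t e → case L.place-injective (inner t) (outer j) e of λ ())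

  outer-≋ : ∀ (e : Vec ℤ 6) → fromEssential o₂ (Vec.map fromℤ e) ≋ λ p → onOuter (lookup e) (label p)
  outer-≋ e p = ≡⇒≈ᶜ (go (label p))
    where
    go : ∀ l → fromEssential o₂ (Vec.map fromℤ e) (L.place l) ≡ fromℤ (onOuter (lookup e) l)
    go centre    = fromEssential-off o₂ _ (λ t e → case L.place-injective (outer t) centre e of λ ())
    go (inner k) = fromEssential-off o₂ _ (λ t e → case L.place-injective (outer t) (inner k) e of λ ())
    go (outer j) = trans (fromEssential-at o₂ _ j) (Vec.lookup-map j fromℤ e)

  ν₁ₐ ν₁ᵦ ν₂ₐ ν₂ᵦ ν₂ᵪ : V
  ν₁ₐ = fromEssential o₁ seed₁ₐ
  ν₁ᵦ = fromEssential o₁ seed₁ᵦ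
  ν₂ₐ = fromEssential o₂ seed₂ₐ
  ν₂ᵦ = fromEssential o₂ seed₂ᵦ
  ν₂ᵪ = fromEssential o₂ seed₂ᵪ

  w : ∀ i → Fin (dim (typeOf i)) → V
  w 0F = lookup (e* 0 ∷ e* 1 ∷ e* 2 ∷ [])
  w 1F = lookup (ν₁ₐ ∷ A *ᵛ ν₁ₐ ∷ [])
  w 2F = lookup (ν₁ᵦ ∷ A *ᵛ ν₁ᵦ ∷ [])
  w 3F = lookup (ν₂ₐ ∷ [])
  w 4F = lookup (ν₂ᵦ ∷ [])
  w 5F = lookup (ν₂ᵪ ∷ [])

  private
    -- Column `0F` of the type II matrix is (0, 1), so `A-table` at the seed identifies `A *ᵛ ν`
    -- with the second tabulated vector.
    second-row : (f : Fin 2 → ℤ) → sumℤ (λ a → Bℤ II a 0F ℤ.* f a) ≡ f 1F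
    second-row f = trans (cong₂ ℤ._+_ (ℤ.*-zeroˡ (f 0F)) (ℤ.+-identityʳ (ℤ.1ℤ ℤ.* f 1F)))
      (trans (ℤ.+-identityˡ (ℤ.1ℤ ℤ.* f 1F)) (ℤ.*-identityˡ (f 1F)))

  w-≋ : ∀ i a → w i a ≋ λ p → wℤ ρ i a (label p)
  w-≋ 0F 0F = e*-≋ 0
  w-≋ 0F 1F = e*-≋ 1
  w-≋ 0F 2F = e*-≋ 2
  w-≋ 1F 0F = inner-≋ seedℤ₁ₐ
  w-≋ 1F 1F p = R.trans (*ᵛ-≋ {M = A} {N = Aℤ ρ} A-≋ (inner-≋ seedℤ₁ₐ) p)
    (≡⇒≈ᶜ (cong fromℤ (trans (A-table 1F 0F p) (second-row (λ a → wℤ ρ 1F a (label p))))))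
  w-≋ 2F 0F = inner-≋ seedℤ₁ᵦ
  w-≋ 2F 1F p = R.trans (*ᵛ-≋ {M = A} {N = Aℤ ρ} A-≋ (inner-≋ seedℤ₁ᵦ) p)
    (≡⇒≈ᶜ (cong fromℤ (trans (A-table 2F 0F p) (second-row (λ a → wℤ ρ 2F a (label p))))))
  w-≋ 3F 0F = outer-≋ seedℤ₂ₐ
  w-≋ 4F 0F = outer-≋ seedℤ₂ᵦ
  w-≋ 5F 0F = outer-≋ seedℤ₂ᵪ

  private
    twelfth : ∃[ c ] fromℤ (ℤ.+ 12) *ᶜ c ≈ᶜ 1ᶜ
    twelfth = fromℤ-invertible (λ ())

  coordinate : V → ∀ i → Fin (dim (typeOf i)) → ℂ
  coordinate v i a = proj₁ twelfth *ᶜ (fromℤ (weight ρ i a) *ᶜ (w i a ∙ v))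

  -- The sum of the projections onto the ten orthogonal lines is the identity; after the sums are
  -- exchanged this is `complete-table`, divided by 12.
  w-expansion : ∀ v → v ≈ᵛ sumᵛ (λ i → linComb (coordinate v i) (w i))
  w-expansion v = σ-elim _ λ p → R.sym (begin
      sum (λ i → sum (λ a → coordinate v i a *ᶜ w i a (σ p)))
        ≈⟨ sum-cong (λ i → sum-cong (λ a → term p i a)) ⟩
      sum (λ i → sum (λ a → proj₁ twelfth *ᶜ sum (λ q → v (σ q) *ᶜ fromℤ (K p q i a))))
        ≈⟨ sum-cong (λ i → R.sym (*-distribˡ-sum (proj₁ twelfth) (λ a → sum (λ q → v (σ q) *ᶜ fromℤ (K p q i a))))) ⟩
      sum (λ i → proj₁ twelfth *ᶜ sum (λ a → sum (λ q → v (σ q) *ᶜ fromℤ (K p q i a))))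
        ≈⟨ *-distribˡ-sum (proj₁ twelfth) (λ i → sum (λ a → sum (λ q → v (σ q) *ᶜ fromℤ (K p q i a)))) ⟨
      proj₁ twelfth *ᶜ sum (λ i → sum (λ a → sum (λ q → v (σ q) *ᶜ fromℤ (K p q i a))))
        ≈⟨ R.*-congˡ (sum-cong (λ i → ∑-comm (λ a q → v (σ q) *ᶜ fromℤ (K p q i a)))) ⟩
      proj₁ twelfth *ᶜ sum (λ i → sum (λ q → sum (λ a → v (σ q) *ᶜ fromℤ (K p q i a))))
        ≈⟨ R.*-congˡ (∑-comm (λ i q → sum (λ a → v (σ q) *ᶜ fromℤ (K p q i a)))) ⟩
      proj₁ twelfth *ᶜ sum (λ q → sum (λ i → sum (λ a → v (σ q) *ᶜ fromℤ (K p q i a))))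
        ≈⟨ R.*-congˡ (sum-cong (λ q → collect p q)) ⟩
      proj₁ twelfth *ᶜ sum (λ q → v (σ q) *ᶜ fromℤ (sumℤ (λ i → sumℤ (λ a → K p q i a))))
        ≈⟨ R.*-congˡ (sum-δ-scaled (ℤ.+ 12) v (λ q → sumℤ (λ i → sumℤ (λ a → K p q i a))) p (complete-table p)) ⟩
      proj₁ twelfth *ᶜ (fromℤ (ℤ.+ 12) *ᶜ v (σ p))
        ≈⟨ R.*-assoc _ _ _ ⟨
      proj₁ twelfth *ᶜ fromℤ (ℤ.+ 12) *ᶜ v (σ p)
        ≈⟨ R.*-congʳ (R.trans (R.*-comm _ _) (proj₂ twelfth)) ⟩
      1ᶜ *ᶜ v (σ p)
        ≈⟨ R.*-identityˡ _ ⟩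
      v (σ p) ∎)
    where
    open ℂ-Reasoning
    K : Fin 10 → Fin 10 → ∀ i → Fin (dim (typeOf i)) → ℤ
    K p q i a = weight ρ i a ℤ.* (wℤ ρ i a (label q) ℤ.* wℤ ρ i a (label p))
    term : ∀ p i a → coordinate v i a *ᶜ w i a (σ p) ≈ᶜ proj₁ twelfth *ᶜ sum (λ q → v (σ q) *ᶜ fromℤ (K p q i a))
    term p i a = begin
      proj₁ twelfth *ᶜ (fromℤ ω *ᶜ (w i a ∙ v)) *ᶜ w i a (σ p)
        ≈⟨ R.*-assoc _ _ _ ⟩
      proj₁ twelfth *ᶜ (fromℤ ω *ᶜ (w i a ∙ v) *ᶜ w i a (σ p))
        ≈⟨ R.*-congˡ (begin
          fromℤ ω *ᶜ (w i a ∙ v) *ᶜ w i a (σ p)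
            ≈⟨ R.*-cong (R.*-congˡ (sum-σ (λ y → w i a y *ᶜ v y))) (w-≋ i a p) ⟩
          fromℤ ω *ᶜ sum (λ q → w i a (σ q) *ᶜ v (σ q)) *ᶜ fromℤ (f p)
            ≈⟨ solve 3 (λ m s f → m :* s :* f := s :* (m :* f)) R.refl (fromℤ ω) _ (fromℤ (f p)) ⟩
          sum (λ q → w i a (σ q) *ᶜ v (σ q)) *ᶜ (fromℤ ω *ᶜ fromℤ (f p))
            ≈⟨ *-distribʳ-sum (fromℤ ω *ᶜ fromℤ (f p)) (λ q → w i a (σ q) *ᶜ v (σ q)) ⟩
          sum (λ q → w i a (σ q) *ᶜ v (σ q) *ᶜ (fromℤ ω *ᶜ fromℤ (f p)))
            ≈⟨ sum-cong (λ q → begin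
              w i a (σ q) *ᶜ v (σ q) *ᶜ (fromℤ ω *ᶜ fromℤ (f p))
                ≈⟨ R.*-congʳ (R.*-congʳ (w-≋ i a q)) ⟩
              fromℤ (f q) *ᶜ v (σ q) *ᶜ (fromℤ ω *ᶜ fromℤ (f p))
                ≈⟨ solve 4 (λ g v m f → g :* v :* (m :* f) := v :* (m :* (g :* f))) R.refl (fromℤ (f q)) (v (σ q)) (fromℤ ω) (fromℤ (f p)) ⟩
              v (σ q) *ᶜ (fromℤ ω *ᶜ (fromℤ (f q) *ᶜ fromℤ (f p)))
                ≈⟨ R.*-congˡ (R.trans (fromℤ-* ω (f q ℤ.* f p)) (R.*-congˡ (fromℤ-* (f q) (f p)))) ⟨
              v (σ q) *ᶜ fromℤ (K p q i a) ∎) ⟩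
          sum (λ q → v (σ q) *ᶜ fromℤ (K p q i a)) ∎) ⟩
      proj₁ twelfth *ᶜ sum (λ q → v (σ q) *ᶜ fromℤ (K p q i a)) ∎
      where
      open ℂ-Solver
      ω : ℤ
      ω = weight ρ i a
      f : Fin 10 → ℤ
      f q = wℤ ρ i a (label q)
    collect : ∀ p q → sum (λ i → sum (λ a → v (σ q) *ᶜ fromℤ (K p q i a))) ≈ᶜ
      v (σ q) *ᶜ fromℤ (sumℤ (λ i → sumℤ (λ a → K p q i a)))
    collect p q = R.trans
      (sum-cong (λ i → R.trans (R.sym (*-distribˡ-sum (v (σ q)) (λ a → fromℤ (K p q i a))))
        (R.*-congˡ (R.sym (fromℤ-sum (K p q i))))))
      (R.trans (R.sym (*-distribˡ-sum (v (σ q)) (λ i → fromℤ (sumℤ (K p q i)))))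
        (R.*-congˡ (R.sym (fromℤ-sum (λ i → sumℤ (K p q i))))))

  model : Model Γ x
  model = record
    { w              = w
    ; A-action       = λ i k → ≋⇒≈ᵛ (*ᵛ-≋ {M = A} {N = Aℤ ρ} A-≋ (w-≋ i k))
        (linComb-≋ {c = λ a → Bℤ (typeOf i) a k} {vs = w i} (w-≋ i)) (A-table i k)
    ; E*-action      = λ h i k → σ-elim _ (λ p → R.trans (E*-*ᵛ h (w i k) p) (same-level h i k p (level-table i k p)))
    ; w-spanning     = λ v → coordinate v , w-expansion v
    ; orthogonal     = λ {i} {j} a b i≢j → R.trans (⟨⟩-≋ (w-≋ i a) (w-≋ j b)) (≡⇒≈ᶜ (cong fromℤ (gram-table i j a b i≢j)))
    ; orthogonal-row = λ i {a} {b} a≢b → R.trans (⟨⟩-≋ (w-≋ i a) (w-≋ i b)) (≡⇒≈ᶜ (cong fromℤ (gram-row-table i a b a≢b)))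
    ; norm           = λ i a → let z , e = fromℤ-invertible (norm-table i a) in
        z , R.trans (R.*-congʳ (⟨⟩-≋ (w-≋ i a) (w-≋ i a))) e
    ; w-nonZero      = λ i a → ≋⇒NonZero (w-≋ i a) (nonZero-table i a)
    }
    where
    -- Where the coordinate is not 0, the vertex lies at the distance of its row, and the two
    -- indicators agree.
    same-level : ∀ h i k p → wℤ ρ i k (label p) ≡ ℤ.0ℤ ⊎ level (label p) ≡ endpoint (typeOf i) ℕ.+ toℕ k →
      [ level (label p) ℕ.≟ h ]ᶜ *ᶜ w i k (σ p) ≈ᶜ [ endpoint (typeOf i) ℕ.+ toℕ k ℕ.≟ h ]ᶜ *ᶜ w i k (σ p)
    same-level h i k p (inj₁ e) = R.trans (vanish _) (R.sym (vanish _))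
      where
      vanish : ∀ c → c *ᶜ w i k (σ p) ≈ᶜ 0ᶜ
      vanish c = R.trans (R.*-congˡ (R.trans (w-≋ i k p) (≡⇒≈ᶜ (cong fromℤ e)))) (R.zeroʳ c)
    same-level h i k p (inj₂ e) = R.*-congʳ (≡⇒≈ᶜ (cong (λ d → [ d ℕ.≟ h ]ᶜ) e))

  A-diagonalisation : Diagonalisation 10 A
  A-diagonalisation = diagonalise π A-≋ (eigenTableOfA isTable)

-- The data listed for the summands

multiplicity≡ : ∀ i → ∣ (λ j → typeOf j ≟ᵗ typeOf i) ∣? ≡ TypeData.multiplicity (typeData (typeOf i))
multiplicity≡ 0F = refl
multiplicity≡ 1F = refl
multiplicity≡ 2F = refl
multiplicity≡ 3F = refl
multiplicity≡ 4F = refl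
multiplicity≡ 5F = refl

supportSize≡ : ∀ t → ∣ support? t ∣? ≡ suc (TypeData.diameter (typeData t))
supportSize≡ I   = refl
supportSize≡ II  = refl
supportSize≡ III = refl
supportSize≡ IV  = refl

row₀≡0 : ∀ t → toℕ (row₀ t) ≡ 0
row₀≡0 I   = refl
row₀≡0 II  = refl
row₀≡0 III = refl
row₀≡0 IV  = refl

row<3 : ∀ t (a : Fin (dim t)) → endpoint t ℕ.+ toℕ a ℕ.< 3
row<3 = from-yes (allTypes? λ t → all? {dim t} λ a → endpoint t ℕ.+ toℕ a ℕ.<? 3)

module Summands {Γ : Graph n} {x : Fin n} (M : Model Γ x) where
  open Terwilliger Γ 2 x
  open Model M
  open Modules M

  module _ (W : Fin 6 → TModule) (F : ∀ i → Framed (W i) (typeOf i) (w i)) (i : Fin 6) where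
    private
      module Row = Rows (F i) (w-nonZero i)

    -- Split by type because diameter and shape evaluate only at a given type. Each entry is 1,
    -- realised by a single row.
    shapeOf : ∀ t {b} (F : Framed (W i) t b) (nz : ∀ a → NonZero (b a))
      (a : Fin (suc (TypeData.diameter (typeData t)))) →
      HasDimension (E*[ endpoint t ℕ.+ toℕ a ] (Carrier (W i))) (lookup (TypeData.shape (typeData t)) a)
    shapeOf I   F nz 0F = _ , Rows.row-basis F nz 0F
    shapeOf I   F nz 1F = _ , Rows.row-basis F nz 1F
    shapeOf I   F nz 2F = _ , Rows.row-basis F nz 2F
    shapeOf II  F nz 0F = _ , Rows.row-basis F nz 0F
    shapeOf II  F nz 1F = _ , Rows.row-basis F nz 1F
    shapeOf III F nz 0F = _ , Rows.row-basis F nz 0F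
    shapeOf IV  F nz 0F = _ , Rows.row-basis F nz 0F

    hasData : HasData (W i) (typeData (typeOf i)) (w i)
    hasData = record
      { endpoint     = Row.isEndpoint (row₀ (typeOf i) , row₀≡0 (typeOf i))
      ; multiplicity = subst (HasMultiplicity (W i)) (multiplicity≡ i) (hasMultiplicity W F i)
      ; dimension    = w i , Framed.isBasis (F i)
      ; diameter     = subst (HasCardinality (λ j → NonZeroSpace (E*[ toℕ j ] (Carrier (W i))))) (supportSize≡ (typeOf i)) Row.supportSize
      ; shape        = shapeOf (typeOf i) (F i) (w-nonZero i)
      ; pureBasis    = Row.isPureBasis (row<3 (typeOf i))
      ; represents   = Row.represents
      ; eigenvalues  = eigenvaluesOfType (typeOf i)
      }

-- The Petersen graph

module _ {Γ : Graph n} (2≤n : 2 ℕ.≤ n) (dr : DistanceRegular Γ 2)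
  (ia : HasIntersectionArray Γ (3 ∷ 2 ∷ []) (1 ∷ 1 ∷ [])) where
  open Petersen Γ 2≤n dr ia

  petersen-spectrum : HasSpectrum (adjacency Γ) petersenSpectrum
  petersen-spectrum =
    hasEigenvalues (List.map proj₁ petersenSpectrum) listed attained ,
    eigenspaceDimension (ℤ.+ 3) s₃ (λ {a} {b} → s₃-injective a b) s₃-sound s₃-exhaustive ∷
    eigenspaceDimension (ℤ.+ 1) s₁ (λ {a} {b} → s₁-injective a b) s₁-sound s₁-exhaustive ∷
    eigenspaceDimension ℤ.-[1+ 1 ] s₋₂ (λ {a} {b} → s₋₂-injective a b) s₋₂-sound s₋₂-exhaustive ∷ []
    where
    -- The spectrum involves no base vertex; one is chosen here only to label the vertices.
    x₀ : Fin n
    x₀ = Fin.fromℕ< {0} (ℕ.≤-trans (ℕ.s≤s ℕ.z≤n) 2≤n)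
    open Diagonalisation (LabelledModel.A-diagonalisation 2≤n dr ia x₀
      (Existence.ordering₁ x₀) (Existence.ordering₂ x₀) (Existence.admissible x₀))
    listed : ∀ j → Any (fromℤ (eigenvalue j) ≈ᶜ_) (List.map proj₁ petersenSpectrum)
    listed 0F = here R.refl
    listed 1F = there (here R.refl)
    listed 2F = there (here R.refl)
    listed 3F = there (here R.refl)
    listed 4F = there (here R.refl)
    listed 5F = there (here R.refl)
    listed 6F = there (there (here R.refl))
    listed 7F = there (there (here R.refl))
    listed 8F = there (there (here R.refl))
    listed 9F = there (there (here R.refl))
    attained : ∀ ϑ → Any (ϑ ≈ᶜ_) (List.map proj₁ petersenSpectrum) → ∃[ j ] ϑ ≈ᶜ fromℤ (eigenvalue j)
    attained ϑ (here e)                 = 0F , e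
    attained ϑ (there (here e))         = 1F , e
    attained ϑ (there (there (here e))) = 6F , e
    s₃ : Fin 1 → Fin 10
    s₃ = lookup (0F ∷ [])
    s₁ : Fin 5 → Fin 10
    s₁ = lookup (1F ∷ 2F ∷ 3F ∷ 4F ∷ 5F ∷ [])
    s₋₂ : Fin 4 → Fin 10
    s₋₂ = lookup (6F ∷ 7F ∷ 8F ∷ 9F ∷ [])
    s₃-injective = from-yes (all? λ a → all? λ b → (s₃ a ≟ᶠ s₃ b) →-dec (a ≟ᶠ b))
    s₁-injective = from-yes (all? λ a → all? λ b → (s₁ a ≟ᶠ s₁ b) →-dec (a ≟ᶠ b))
    s₋₂-injective = from-yes (all? λ a → all? λ b → (s₋₂ a ≟ᶠ s₋₂ b) →-dec (a ≟ᶠ b))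
    s₃-sound = from-yes (all? λ a → eigenvalue (s₃ a) ℤ.≟ ℤ.+ 3)
    s₁-sound = from-yes (all? λ a → eigenvalue (s₁ a) ℤ.≟ ℤ.+ 1)
    s₋₂-sound = from-yes (all? λ a → eigenvalue (s₋₂ a) ℤ.≟ ℤ.-[1+ 1 ])
    s₃-exhaustive = from-yes (all? λ j → (eigenvalue j ℤ.≟ ℤ.+ 3) →-dec any? λ a → s₃ a ≟ᶠ j)
    s₁-exhaustive = from-yes (all? λ j → (eigenvalue j ℤ.≟ ℤ.+ 1) →-dec any? λ a → s₁ a ≟ᶠ j)
    s₋₂-exhaustive = from-yes (all? λ j → (eigenvalue j ℤ.≟ ℤ.-[1+ 1 ]) →-dec any? λ a → s₋₂ a ≟ᶠ j)

  module _ (x : Fin n) where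
    open Terwilliger Γ 2 x

    -- The claim mentions no ordering but a model needs one, so the constructed admissible ordering
    -- is used.
    petersen-T-dimension : HasDimension T 15
    petersen-T-dimension = Theory.T-dimension (LabelledModel.model 2≤n dr ia x
      (Existence.ordering₁ x) (Existence.ordering₂ x) (Existence.admissible x))

    petersen-decomposition : (o₁ : Ordering Γ x 1 3) (o₂ : Ordering Γ x 2 6) → Admissible o₂ →
      let
        ν₁ₐ = fromEssential o₁ seed₁ₐ
        ν₁ᵦ = fromEssential o₁ seed₁ᵦ
        ν₂ₐ = fromEssential o₂ seed₂ₐ
        ν₂ᵦ = fromEssential o₂ seed₂ᵦ
        ν₂ᵪ = fromEssential o₂ seed₂ᵪ
      in
      Σ[ W₀ ∈ TModule ] Σ[ W₁ₐ ∈ TModule ] Σ[ W₁ᵦ ∈ TModule ]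
      Σ[ W₂ₐ ∈ TModule ] Σ[ W₂ᵦ ∈ TModule ] Σ[ W₂ᵪ ∈ TModule ]
      (let W = W₀ ∷ W₁ₐ ∷ W₁ᵦ ∷ W₂ₐ ∷ W₂ᵦ ∷ W₂ᵪ ∷ [] in
       IsOrthogonalDecomposition (lookup W) ×
       (∀ i j → (lookup W i ≅ lookup W j) ⇔ (typeOf i ≡ typeOf j)) ×
       HasData W₀ (typeData I) (lookup (e* 0 ∷ e* 1 ∷ e* 2 ∷ [])) ×
       (HasData W₁ₐ (typeData II) (lookup (ν₁ₐ ∷ A *ᵛ ν₁ₐ ∷ [])) ×
         IsSeed W₁ₐ 1 ν₁ₐ × A *ᵛ ν₁ₐ ≈ᵛ E* 2 *ᵛ A *ᵛ ν₁ₐ) ×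
       (HasData W₁ᵦ (typeData II) (lookup (ν₁ᵦ ∷ A *ᵛ ν₁ᵦ ∷ [])) ×
         IsSeed W₁ᵦ 1 ν₁ᵦ × A *ᵛ ν₁ᵦ ≈ᵛ E* 2 *ᵛ A *ᵛ ν₁ᵦ) ×
       (HasData W₂ₐ (typeData III) (lookup (ν₂ₐ ∷ [])) × IsSeed W₂ₐ 2 ν₂ₐ) ×
       (HasData W₂ᵦ (typeData III) (lookup (ν₂ᵦ ∷ [])) × IsSeed W₂ᵦ 2 ν₂ᵦ) ×
       (HasData W₂ᵪ (typeData IV) (lookup (ν₂ᵪ ∷ [])) × IsSeed W₂ᵪ 2 ν₂ᵪ))
    petersen-decomposition o₁ o₂ admissible =
      S 0F , S 1F , S 2F , S 3F , S 4F , S 5F ,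
      isOrthogonalDecomposition W F ,
      isomorphic⇔same-type W F ,
      hasData W F 0F ,
      (hasData W F 1F , seed 1F , ≈ᵛ-sym (Rows.E*-fixed (F 1F) (w-nonZero 1F) 1F refl)) ,
      (hasData W F 2F , seed 2F , ≈ᵛ-sym (Rows.E*-fixed (F 2F) (w-nonZero 2F) 1F refl)) ,
      (hasData W F 3F , seed 3F) ,
      (hasData W F 4F , seed 4F) ,
      (hasData W F 5F , seed 5F)
      where
      M : Model Γ x
      M = LabelledModel.model 2≤n dr ia x o₁ o₂ admissible
      open Model M
      open Modules M
      open Summands M
      S : Fin 6 → TModule
      S i = Span (w-frame i)
      W : Fin 6 → TModule
      W = lookup (S 0F ∷ S 1F ∷ S 2F ∷ S 3F ∷ S 4F ∷ S 5F ∷ [])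
      -- `W i` reduces to `S i` only at a numeral, hence the six clauses.
      F : ∀ i → Framed (W i) (typeOf i) (w i)
      F 0F = Span-framed (w-frame 0F)
      F 1F = Span-framed (w-frame 1F)
      F 2F = Span-framed (w-frame 2F)
      F 3F = Span-framed (w-frame 3F)
      F 4F = Span-framed (w-frame 4F)
      F 5F = Span-framed (w-frame 5F)
      seed : ∀ i → IsBasis {k = 1} (E*[ endpoint (typeOf i) ℕ.+ toℕ (row₀ (typeOf i)) ] (Carrier (W i)))
        (λ _ → w i (row₀ (typeOf i)))
      seed i = Rows.row-basis (F i) (w-nonZero i) (row₀ (typeOf i))

mainTheorem3 : (Γ : Graph 10) →
    DistanceRegular Γ 2 →
    HasIntersectionArray Γ (3 ∷ 2 ∷ []) (1 ∷ 1 ∷ []) →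
    HasSpectrum (adjacency Γ) petersenSpectrum ×
    ((x : Fin 10) →
    let open Terwilliger Γ 2 x in
    Ordering Γ x 1 3 ×
    (Σ[ o ∈ Ordering Γ x 2 6 ] Admissible o) ×
    ((o₁ : Ordering Γ x 1 3) (o₂ : Ordering Γ x 2 6) → Admissible o₂ →
    let
    ν₁ₐ = fromEssential o₁ seed₁ₐ
    ν₁ᵦ = fromEssential o₁ seed₁ᵦ
    ν₂ₐ = fromEssential o₂ seed₂ₐ
    ν₂ᵦ = fromEssential o₂ seed₂ᵦ
    ν₂ᵪ = fromEssential o₂ seed₂ᵪ
    types = I ∷ II ∷ II ∷ III ∷ III ∷ IV ∷ []
    in
    Σ[ W₀ ∈ TModule ] Σ[ W₁ₐ ∈ TModule ] Σ[ W₁ᵦ ∈ TModule ]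
    Σ[ W₂ₐ ∈ TModule ] Σ[ W₂ᵦ ∈ TModule ] Σ[ W₂ᵪ ∈ TModule ]
    (let W = W₀ ∷ W₁ₐ ∷ W₁ᵦ ∷ W₂ₐ ∷ W₂ᵦ ∷ W₂ᵪ ∷ [] in
    IsOrthogonalDecomposition (lookup W) ×
    (∀ i j → (lookup W i ≅ lookup W j) ⇔ (lookup types i ≡ lookup types j)) ×
    HasData W₀ (typeData I) (lookup (e* 0 ∷ e* 1 ∷ e* 2 ∷ [])) ×
    (HasData W₁ₐ (typeData II) (lookup (ν₁ₐ ∷ A *ᵛ ν₁ₐ ∷ [])) ×
    IsSeed W₁ₐ 1 ν₁ₐ × A *ᵛ ν₁ₐ ≈ᵛ E* 2 *ᵛ A *ᵛ ν₁ₐ) ×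
    (HasData W₁ᵦ (typeData II) (lookup (ν₁ᵦ ∷ A *ᵛ ν₁ᵦ ∷ [])) ×
    IsSeed W₁ᵦ 1 ν₁ᵦ × A *ᵛ ν₁ᵦ ≈ᵛ E* 2 *ᵛ A *ᵛ ν₁ᵦ) ×
    (HasData W₂ₐ (typeData III) (lookup (ν₂ₐ ∷ [])) × IsSeed W₂ₐ 2 ν₂ₐ) ×
    (HasData W₂ᵦ (typeData III) (lookup (ν₂ᵦ ∷ [])) × IsSeed W₂ᵦ 2 ν₂ᵦ) ×
    (HasData W₂ᵪ (typeData IV) (lookup (ν₂ᵪ ∷ [])) × IsSeed W₂ᵪ 2 ν₂ᵪ))) ×
    HasDimension T 15 × 3 ^ 2 + 2 ^ 2 + 1 ^ 2 + 1 ^ 2 ≡ 15)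
mainTheorem3 Γ dr ia =
  petersen-spectrum 2≤10 dr ia ,
  λ x →
    Petersen.Existence.ordering₁ Γ 2≤10 dr ia x ,
    (Petersen.Existence.ordering₂ Γ 2≤10 dr ia x , Petersen.Existence.admissible Γ 2≤10 dr ia x) ,
    petersen-decomposition 2≤10 dr ia x ,
    petersen-T-dimension 2≤10 dr ia x ,
    refl
  where
  2≤10 : 2 ℕ.≤ 10
  2≤10 = ℕ.s≤s (ℕ.s≤s ℕ.z≤n)
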